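{- Let $V$ be a model of set theory and $\kappa$ an infinite ordinal. Suppose that $X,\mathscr{L}\in V$, with $X$ an infinite set and $\mathscr{L}$ a relational language, and that $V\models|X|\le\kappa$. Let $\mu\in V$ be a probability $\kappa$-measure on $[\mathrm{Str}^\kappa_{\mathscr{L}}(X)]^V$ and let $G$ be a $\mu$-random generic filter over $V$. Then $\mathcal{M}_G\models[\mathrm{Th}_\kappa(\mu)]^V$, where $\mathcal{M}_G$ is the $\mu$-random generic structure determined by $G$.
   Context: A model of set theory is a transitive model of ZFC. Structures and measures: $\mathrm{Str}_{\mathscr{L}}(X)$ is the set of $\mathscr{L}$-structures with underlying set $X$. An $\mathscr{L}$-literal is an atomic formula or a (possibly iterated) negation of one. $\sigma_\kappa(\mathrm{Str}_{\mathscr{L}}(X))$ is the smallest family of subsets of $\mathrm{Str}_{\mathscr{L}}(X)$ closed under complements and under unions of size $\le\kappa$ and containing all sets $\{\mathcal{M}:\mathcal{M}\models\varphi(\bar a)\}$ for $\varphi$ a literal and $\bar a$ a tuple from $X$. $\mathrm{Str}^\kappa_{\mathscr{L}}(X)$ is $\mathrm{Str}_{\mathscr{L}}(X)$ with this family of measurable sets. A probability $\kappa$-measure on it is a probability measure $\mu$ with $\mu(\bigcup_{i\in\kappa}A_i)=\sum_{i\in\kappa}\mu(A_i)$ for pairwise disjoint measurable $A_i$. Codes: the set $\mathbb{B}^\kappa_{\mathscr{L}:X}$ of $\kappa$-Borel codes is the smallest set containing the basic codes $\langle 0,\varphi,\bar a\rangle$ ($\varphi$ a finite conjunction of $\mathscr{L}$-literals,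 $\bar a$ a tuple from $X$) and closed under formal negation $\neg\gamma$ and formal $\bigvee\Gamma$, $\bigwedge\Gamma$ for $\Gamma=\{\gamma_i\}_{i\in\kappa}$. The interpretation $\mathrm{Int}(\gamma)\subseteq\mathrm{Str}_{\mathscr{L}}(X)$, computed in a given model, interprets basic codes as $\{\mathcal{M}:\mathcal{M}\models\varphi(\bar a)\}$ and $\neg,\bigvee,\bigwedge$ as complement, union, intersection. $\mu(\gamma)=\mu(\mathrm{Int}(\gamma))$. Almost-sure theory: $\mathcal{L}_{\kappa^+,\omega}(\mathscr{L})$ is the set of infinitary formulas built from atomic formulas by negation, quantification over single variables, and conjunctions and disjunctions of fewer than $\kappa^+$ formulas with free variables in a common finite set. When $|X|\le\kappa$, $\{\mathcal{M}\in\mathrm{Str}_{\mathscr{L}}(X):\mathcal{M}\models\varphi\}$ is measurable for each sentence $\varphi$ of this logic, and $\mathrm{Th}_\kappa(\mu)$ is the set of sentences $\varphi\in\mathcal{L}_{\kappa^+,\omega}(\mathscr{L})$ for which this set has $\mu$-measure $1$. Forcing: $\gamma\preceq_\mu\zeta$ means $\mu(\gamma\wedge\neg\zeta)=0$, and $\mathcal{O}^+(\mu)=(\{\gamma\in\mathbb{B}^\kappa_{\mathscr{L}:X}:\mu(\gamma)>0\},\preceq_\mu)$, a pre-order (smaller is stronger), computed in $V$. A $\mu$-random generic filter over $V$ is a filter on $\mathcal{O}^+(\mu)$ generic over $V$. For such $G$, $\mathcal{M}_G$ is the unique $\mathscr{L}$-structure with $V[G]\models\bigcap_{g\in G}\mathrm{Int}(g)=\{\mathcal{M}_G\}$.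 -}

module Defs where

open import Level using (Level; 0ℓ; _⊔_) renaming (suc to lsuc)
open import Data.Nat using (ℕ; zero; suc)
open import Data.Integer using (ℤ; +_; -[1+_])
open import Data.Rational using (ℚ; 0ℚ; 1ℚ; ↥_; ↧ₙ_; _+_; _<_)
open import Data.Bool using (Bool; if_then_else_)
open import Data.Empty.Polymorphic using (⊥)
open import Data.Unit.Polymorphic using (⊤)
open import Data.Maybe using (Maybe; maybe)
open import Data.Fin using (Fin; toℕ)
open import Data.List using (List; []; _∷_; foldr) renaming (map to mapL)
open import Data.List.Relation.Unary.Any using (Any)
open import Data.List.Relation.Unary.All using () renaming (All to AllL)
open import Data.List.Relation.Unary.AllPairs using (AllPairs)
open import Data.Vec using (Vec; []; _∷_; lookup; map)
open import Data.Vec.Relation.Unary.All using (All)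
open import Data.Product using (Σ; ∃; ∃-syntax; _×_; _,_)
open import Data.Sum using (_⊎_)
open import Function using (_∘_)
open import Function.Bundles using (_⇔_)
open import Relation.Nullary using (¬_)
open import Relation.Binary.PropositionalEquality using (_≡_)

infix 4 _≐_ _∈_
infixl 6 _⊕_

1ℓ : Level
1ℓ = lsuc 0ℓ

------------------------------------------------------------------------
-- The ambient universe of sets: Aczel's iterative sets.  Equality of sets
-- is the bisimulation _≐_, for which _∈_ is extensional.

data 𝕊 : Set₁ where
  sup : (A : Set) → (A → 𝕊) → 𝕊

_≐_ : 𝕊 → 𝕊 → Set
sup A f ≐ sup B g = (∀ a → ∃[ b ] f a ≐ g b) × (∀ b → ∃[ a ] f a ≐ g b)

_∈_ : 𝕊 → 𝕊 → Set
x ∈ sup B g = ∃[ b ] x ≐ g b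

Class : Set₂
Class = 𝕊 → Set₁

∅ : 𝕊
∅ = sup ⊥ (λ ())

⟅_,_⟆ : 𝕊 → 𝕊 → 𝕊
⟅ x , y ⟆ = sup Bool (λ b → if b then x else y)

-- Kuratowski ordered pair
⟨_,_⟩ : 𝕊 → 𝕊 → 𝕊
⟨ x , y ⟩ = ⟅ ⟅ x , x ⟆ , ⟅ x , y ⟆ ⟆

-- x ∪ {x}
_⁺ : 𝕊 → 𝕊
(sup A f) ⁺ = sup (Maybe A) (maybe f (sup A f))

nat : ℕ → 𝕊
nat zero    = ∅
nat (suc n) = nat n ⁺

ω : 𝕊
ω = sup ℕ nat

tuple : ∀ {n} → Vec 𝕊 n → 𝕊
tuple []       = ∅
tuple (x ∷ xs) = ⟨ x , tuple xs ⟩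

tag : ℕ → 𝕊 → 𝕊
tag k x = ⟨ nat k , x ⟩

Finite Infinite : 𝕊 → Set₁
Finite x   = ∃[ xs ] (∀ y → y ∈ x → Any (y ≐_) xs)
Infinite x = ¬ Finite x

IsOrdinal : 𝕊 → Set₁
IsOrdinal α = IsTransitive α × (∀ β → β ∈ α → IsTransitive β)
  where
  IsTransitive : 𝕊 → Set₁
  IsTransitive x = ∀ y z → y ∈ x → z ∈ y → z ∈ x

record IsFunction (f A B : 𝕊) : Set₁ where
  field
    graph  : ∀ p → p ∈ f → ∃[ a ] ∃[ b ] (p ≐ ⟨ a , b ⟩ × a ∈ A × b ∈ B)
    total  : ∀ a → a ∈ A → ∃[ b ] ⟨ a , b ⟩ ∈ f
    unique : ∀ a b c → ⟨ a , b ⟩ ∈ f → ⟨ a , c ⟩ ∈ f → b ≐ c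

-- |A| ≤ |B|, computed in M
Card≤ : Class → 𝕊 → 𝕊 → Set₁
Card≤ M A B = ∃[ f ] (M f × IsFunction f A B ×
  (∀ a c b → ⟨ a , b ⟩ ∈ f → ⟨ c , b ⟩ ∈ f → a ≐ c))

-- A = { a_i : i ∈ I } for a family (a_i)_{i ∈ I} that is an element of M
Enumerated : Class → 𝕊 → 𝕊 → Set₁
Enumerated M I A = ∃[ f ] (M f × IsFunction f I A ×
  (∀ a → a ∈ A → ∃[ i ] (i ∈ I × ⟨ i , a ⟩ ∈ f)))

------------------------------------------------------------------------
-- Transitive models of ZFC

-- First-order formulas of set theory with free de Bruijn variables in Fin n
data SetFormula : ℕ → Set where
  _∈ᶠ_ _≐ᶠ_       : ∀ {n} → Fin n → Fin n → SetFormula n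
  ¬ᶠ_             : ∀ {n} → SetFormula n → SetFormula n
  _∧ᶠ_ _∨ᶠ_ _⇒ᶠ_  : ∀ {n} → SetFormula n → SetFormula n → SetFormula n
  ∀ᶠ_ ∃ᶠ_         : ∀ {n} → SetFormula (suc n) → SetFormula n

Holds : Class → ∀ {n} → SetFormula n → Vec 𝕊 n → Set₁
Holds M (i ∈ᶠ j) ρ = Level.Lift 1ℓ (lookup ρ i ∈ lookup ρ j)
Holds M (i ≐ᶠ j) ρ = Level.Lift 1ℓ (lookup ρ i ≐ lookup ρ j)
Holds M (¬ᶠ φ)   ρ = ¬ Holds M φ ρ
Holds M (φ ∧ᶠ ψ) ρ = Holds M φ ρ × Holds M ψ ρ
Holds M (φ ∨ᶠ ψ) ρ = Holds M φ ρ ⊎ Holds M ψ ρ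
Holds M (φ ⇒ᶠ ψ) ρ = Holds M φ ρ → Holds M ψ ρ
Holds M (∀ᶠ φ)   ρ = ∀ x → M x → Holds M φ (x ∷ ρ)
Holds M (∃ᶠ φ)   ρ = ∃[ x ] (M x × Holds M φ (x ∷ ρ))

-- The axioms of ZFC with all quantifiers relativised to M; the two schemas
-- range over all first-order formulas with parameters from M.
record ZFC (M : Class) : Set₁ where
  field
    extensionality : ∀ x y → M x → M y →
      (∀ z → M z → z ∈ x ⇔ z ∈ y) → x ≐ y
    foundation : ∀ x → M x → (∃[ y ] (M y × y ∈ x)) →
      ∃[ y ] (M y × y ∈ x × (∀ z → M z → z ∈ y → ¬ z ∈ x))
    pairing : ∀ x y → M x → M y →
      ∃[ p ] (M p × (∀ z → M z → z ∈ p ⇔ (z ≐ x ⊎ z ≐ y)))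
    union : ∀ x → M x →
      ∃[ u ] (M u × (∀ z → M z → z ∈ u ⇔ (∃[ y ] (M y × y ∈ x × z ∈ y))))
    powerset : ∀ x → M x →
      ∃[ p ] (M p × (∀ y → M y → y ∈ p ⇔ (∀ z → M z → z ∈ y → z ∈ x)))
    infinity : ∃[ w ] (M w ×
      (∃[ e ] (M e × e ∈ w × (∀ z → M z → ¬ z ∈ e))) ×
      (∀ x → M x → x ∈ w →
        ∃[ y ] (M y × y ∈ w × (∀ z → M z → z ∈ y ⇔ (z ∈ x ⊎ z ≐ x)))))
    separation : ∀ {n} (φ : SetFormula (suc n)) (ρ : Vec 𝕊 n) → All M ρ →
      ∀ a → M a →
      ∃[ b ] (M b × (∀ x → M x → x ∈ b ⇔ (x ∈ a × Holds M φ (x ∷ ρ))))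
    replacement : ∀ {n} (φ : SetFormula (suc (suc n))) (ρ : Vec 𝕊 n) → All M ρ →
      ∀ a → M a →
      (∀ x y z → M x → M y → M z → x ∈ a →
        Holds M φ (x ∷ y ∷ ρ) → Holds M φ (x ∷ z ∷ ρ) → y ≐ z) →
      ∃[ b ] (M b × (∀ y → M y →
        y ∈ b ⇔ (∃[ x ] (M x × x ∈ a × Holds M φ (x ∷ y ∷ ρ)))))
    choice : ∀ a → M a →
      (∀ x → M x → x ∈ a → ∃[ y ] (M y × y ∈ x)) →
      (∀ x y z → M x → M y → M z → x ∈ a → y ∈ a → z ∈ x → z ∈ y → x ≐ y) →
      ∃[ c ] (M c × (∀ x → M x → x ∈ a →
        ∃[ y ] (M y × y ∈ x × y ∈ c ×
          (∀ z → M z → z ∈ x → z ∈ c → z ≐ y))))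

record IsModelOfSetTheory (M : Class) : Set₁ where
  field
    respects   : ∀ {x y} → x ≐ y → M x → M y
    transitive : ∀ {x y} → M x → y ∈ x → M y
    zfc        : ZFC M

-- V[G] is characterised as the least transitive model of ZFC that includes V
-- and contains G.
record IsGenericExtension (V : Class) (G : 𝕊) (V[G] : Class) : Set₂ where
  field
    model   : IsModelOfSetTheory V[G]
    extends : ∀ x → V x → V[G] x
    has-G   : V[G] G
    least   : ∀ (N : Class) → IsModelOfSetTheory N → (∀ x → V x → N x) → N G →
              ∀ x → V[G] x → N x

------------------------------------------------------------------------
-- Real numbers: left Dedekind cuts, as sets of (set-encoded) rationals

⌜_⌝ᶻ : ℤ → 𝕊
⌜ + n      ⌝ᶻ = tag 0 (nat n)
⌜ -[1+ n ] ⌝ᶻ = tag 1 (nat n)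

⌜_⌝ : ℚ → 𝕊
⌜ q ⌝ = ⟨ ⌜ ↥ q ⌝ᶻ , nat (↧ₙ q) ⟩

record IsReal (r : 𝕊) : Set₁ where
  field
    rationals : ∀ x → x ∈ r → ∃[ q ] x ≐ ⌜ q ⌝
    inhabited : ∃[ q ] ⌜ q ⌝ ∈ r
    bounded   : ∃[ q ] (¬ ⌜ q ⌝ ∈ r)
    lower     : ∀ p q → p < q → ⌜ q ⌝ ∈ r → ⌜ p ⌝ ∈ r
    open-cut  : ∀ p → ⌜ p ⌝ ∈ r → ∃[ q ] (p < q × ⌜ q ⌝ ∈ r)

Cut : Set₂
Cut = ℚ → Set₁

-- The set r is the cut c
_IsCut_ : 𝕊 → Cut → Set₁
r IsCut c = ∀ q → ⌜ q ⌝ ∈ r ⇔ c q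

rational : ℚ → Cut
rational p q = Level.Lift 1ℓ (q < p)

_⊕_ : Cut → Cut → Cut
(c ⊕ d) q = ∃[ p ] ∃[ p′ ] (q ≡ p + p′ × c p × d p′)

-- Σ_{i ∈ I} c i for nonnegative c i, as the supremum (union of cuts) of the
-- sums over finite lists of distinct indices; it is the improper cut (all of ℚ)
-- when the sum diverges.
sumOver : 𝕊 → (𝕊 → Cut) → Cut
sumOver I c q = ∃[ is ] (AllL (_∈ I) is × AllPairs (λ i j → ¬ i ≐ j) is ×
  foldr _⊕_ (rational 0ℚ) (mapL c is) q)

------------------------------------------------------------------------

-- A relational language is a set of pairs ⟨R , n⟩: R is a relation symbol of
-- arity n.
record IsLanguage (L : 𝕊) : Set₁ where
  field
    graph  : ∀ p → p ∈ L → ∃[ R ] ∃[ n ] p ≐ ⟨ R , nat n ⟩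
    unique : ∀ R m n → ⟨ R , nat m ⟩ ∈ L → ⟨ R , nat n ⟩ ∈ L → m ≡ n

-- Everything below that depends on the model in which it is computed
-- (cardinalities, families, measurable sets, ...) is computed in M.
module _ (M : Class) (L X κ : 𝕊) where

  -- An L-structure with underlying set X is identified with its interpretation
  -- function R ↦ R^N ⊆ Xⁿ (n the arity of R).
  record IsStr (N : 𝕊) : Set₁ where
    field
      graph  : ∀ p → p ∈ N → ∃[ R ] ∃[ r ] (p ≐ ⟨ R , r ⟩ ×
               (∃[ n ] (⟨ R , nat n ⟩ ∈ L ×
                 (∀ t → t ∈ r → Σ (Vec 𝕊 n) λ xs → All (_∈ X) xs × t ≐ tuple xs))))
      total  : ∀ R n → ⟨ R , nat n ⟩ ∈ L → ∃[ r ] ⟨ R , r ⟩ ∈ N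
      unique : ∀ R r s → ⟨ R , r ⟩ ∈ N → ⟨ R , s ⟩ ∈ N → r ≐ s

  -- Fm n φ: the set φ is an L_{κ⁺,ω}(L)-formula of M whose free (de Bruijn)
  -- variables are among the first n.  Being smallest with these closure
  -- properties, the class of such φ is what M takes to be the set of formulas.
  data Fm : ℕ → 𝕊 → Set₁ where
    rel  : ∀ {n φ} k R (vs : Vec (Fin n) k) → ⟨ R , nat k ⟩ ∈ L →
           φ ≐ tag 0 ⟨ R , tuple (map (nat ∘ toℕ) vs) ⟩ → Fm n φ
    eq   : ∀ {n φ} (i j : Fin n) →
           φ ≐ tag 1 ⟨ nat (toℕ i) , nat (toℕ j) ⟩ → Fm n φ
    neg  : ∀ {n φ} ψ → φ ≐ tag 2 ψ → Fm n ψ → Fm n φ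
    ex   : ∀ {n φ} ψ → φ ≐ tag 3 ψ → Fm (suc n) ψ → Fm n φ
    all  : ∀ {n φ} ψ → φ ≐ tag 4 ψ → Fm (suc n) ψ → Fm n φ
    disj : ∀ {n φ} Φ → φ ≐ tag 5 Φ → M Φ → Card≤ M Φ κ →
           (∀ ψ → ψ ∈ Φ → Fm n ψ) → Fm n φ
    conj : ∀ {n φ} Φ → φ ≐ tag 6 Φ → M Φ → Card≤ M Φ κ →
           (∀ ψ → ψ ∈ Φ → Fm n ψ) → Fm n φ

  IsAtomic IsLiteral IsConjOfLiterals : ∀ {n φ} → Fm n φ → Set₁
  IsAtomic (rel _ _ _ _ _)  = ⊤
  IsAtomic (eq _ _ _)       = ⊤
  IsAtomic (neg _ _ _)      = ⊥
  IsAtomic (ex _ _ _)       = ⊥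
  IsAtomic (all _ _ _)      = ⊥
  IsAtomic (disj _ _ _ _ _) = ⊥
  IsAtomic (conj _ _ _ _ _) = ⊥

  IsLiteral (neg _ _ d) = IsLiteral d
  IsLiteral d           = IsAtomic d

  IsConjOfLiterals (conj Φ _ _ _ ds) =
    Finite Φ × (∀ ψ (m : ψ ∈ Φ) → IsLiteral (ds ψ m))
  IsConjOfLiterals _                 = ⊥

  -- N ⊨ φ(xs)
  _⊨_[_] : 𝕊 → ∀ {n φ} → Fm n φ → Vec 𝕊 n → Set₁
  N ⊨ rel k R vs _ _    [ xs ] = ∃[ r ] (⟨ R , r ⟩ ∈ N × tuple (map (lookup xs) vs) ∈ r)
  N ⊨ eq i j _          [ xs ] = Level.Lift 1ℓ (lookup xs i ≐ lookup xs j)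
  N ⊨ neg _ _ d         [ xs ] = ¬ (N ⊨ d [ xs ])
  N ⊨ ex _ _ d          [ xs ] = ∃[ x ] (x ∈ X × N ⊨ d [ x ∷ xs ])
  N ⊨ all _ _ d         [ xs ] = ∀ x → x ∈ X → N ⊨ d [ x ∷ xs ]
  N ⊨ disj Φ _ _ _ ds   [ xs ] = ∃[ ψ ] Σ (ψ ∈ Φ) λ m → N ⊨ ds ψ m [ xs ]
  N ⊨ conj Φ _ _ _ ds   [ xs ] = ∀ ψ (m : ψ ∈ Φ) → N ⊨ ds ψ m [ xs ]

  -- A = { N ∈ Str_L(X) : P N }, computed in M
  _IsSetOfStr_ : ∀ {ℓ} → 𝕊 → (𝕊 → Set ℓ) → Set (1ℓ ⊔ ℓ)
  A IsSetOfStr P = M A × (∀ N → N ∈ A ⇔ (M N × IsStr N × P N))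

  -- σ_κ(Str_L(X))
  data Measurable : 𝕊 → Set₁ where
    basic : ∀ {A n φ} (d : Fm n φ) → IsLiteral d → (xs : Vec 𝕊 n) → All (_∈ X) xs →
            A IsSetOfStr (λ N → N ⊨ d [ xs ]) → Measurable A
    compl : ∀ {A} B → Measurable B → A IsSetOfStr (λ N → ¬ N ∈ B) → Measurable A
    union : ∀ {A} U → M U → Card≤ M U κ → (∀ B → B ∈ U → Measurable B) →
            A IsSetOfStr (λ N → ∃[ B ] (B ∈ U × N ∈ B)) → Measurable A

  -- F ∈ M is a family (F_i)_{i ∈ I} of pairwise disjoint measurable sets
  record IsDisjointFamily (I F : 𝕊) : Set₁ where
    field
      in-M     : M F
      graph    : ∀ p → p ∈ F → ∃[ i ] ∃[ A ] (p ≐ ⟨ i , A ⟩ × i ∈ I × Measurable A)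
      total    : ∀ i → i ∈ I → ∃[ A ] ⟨ i , A ⟩ ∈ F
      unique   : ∀ i A B → ⟨ i , A ⟩ ∈ F → ⟨ i , B ⟩ ∈ F → A ≐ B
      disjoint : ∀ i j A B → ⟨ i , A ⟩ ∈ F → ⟨ j , B ⟩ ∈ F → ¬ i ≐ j →
                 ∀ N → N ∈ A → ¬ N ∈ B

  -- μ(⋃_{i ∈ I} F_i) = Σ_{i ∈ I} μ(F_i) for all such families
  Additive : 𝕊 → 𝕊 → Set₁
  Additive I μ = ∀ F → IsDisjointFamily I F →
    ∀ A r → A IsSetOfStr (λ N → ∃[ i ] ∃[ B ] (⟨ i , B ⟩ ∈ F × N ∈ B)) →
    ⟨ A , r ⟩ ∈ μ →
    r IsCut sumOver I (λ i q → ∃[ B ] ∃[ s ] (⟨ i , B ⟩ ∈ F × ⟨ B , s ⟩ ∈ μ × ⌜ q ⌝ ∈ s))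

  record IsProbabilityκMeasure (μ : 𝕊) : Set₁ where
    field
      in-M       : M μ
      graph      : ∀ p → p ∈ μ → ∃[ A ] ∃[ r ] (p ≐ ⟨ A , r ⟩ × Measurable A × IsReal r)
      total      : ∀ A → Measurable A → ∃[ r ] ⟨ A , r ⟩ ∈ μ
      unique     : ∀ A r s → ⟨ A , r ⟩ ∈ μ → ⟨ A , s ⟩ ∈ μ → r ≐ s
      nonneg     : ∀ A r → ⟨ A , r ⟩ ∈ μ → ∀ q → q < 0ℚ → ⌜ q ⌝ ∈ r
      total-mass : ∀ A r → A IsSetOfStr (λ _ → ⊤ {0ℓ}) → ⟨ A , r ⟩ ∈ μ → r IsCut rational 1ℚ
      σ-additive : Additive ω μ
      κ-additive : Additive κ μ

  -- The κ-Borel codes of M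
  data Code : 𝕊 → Set₁ where
    basic : ∀ {γ n φ} (d : Fm n φ) → IsConjOfLiterals d → (xs : Vec 𝕊 n) → All (_∈ X) xs →
            γ ≐ tag 0 ⟨ φ , tuple xs ⟩ → Code γ
    neg   : ∀ {γ} ζ → γ ≐ tag 1 ζ → Code ζ → Code γ
    disj  : ∀ {γ} Γ → γ ≐ tag 2 Γ → M Γ → Enumerated M κ Γ →
            (∀ ζ → ζ ∈ Γ → Code ζ) → Code γ
    conj  : ∀ {γ} Γ → γ ≐ tag 3 Γ → M Γ → Enumerated M κ Γ →
            (∀ ζ → ζ ∈ Γ → Code ζ) → Code γ

  _⊩_ : 𝕊 → ∀ {γ} → Code γ → Set₁
  N ⊩ basic d _ xs _ _  = N ⊨ d [ xs ]
  N ⊩ neg _ _ c         = ¬ (N ⊩ c)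
  N ⊩ disj Γ _ _ _ cs   = ∃[ ζ ] Σ (ζ ∈ Γ) λ m → N ⊩ cs ζ m
  N ⊩ conj Γ _ _ _ cs   = ∀ ζ (m : ζ ∈ Γ) → N ⊩ cs ζ m

  -- N ∈ Int(γ), where γ is a code of M and Int is computed in the model M′
  Int : Class → ∀ {γ} → Code γ → 𝕊 → Set₁
  Int M′ c N = M′ N × IsStr N × N ⊩ c

  module _ (μ : 𝕊) where

    -- φ ∈ Th_κ(μ), for φ a sentence
    InTh : ∀ {φ} → Fm 0 φ → Set₁
    InTh d = ∃[ A ] ∃[ r ] (A IsSetOfStr (λ N → N ⊨ d [ [] ]) × ⟨ A , r ⟩ ∈ μ ×
      r IsCut rational 1ℚ)

    -- γ is a code and μ(γ) = r
    Value : 𝕊 → 𝕊 → Set₁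
    Value γ r = Σ (Code γ) λ c →
      ∃[ A ] (M A × (∀ N → N ∈ A ⇔ Int M c N) × ⟨ A , r ⟩ ∈ μ)

    -- The carrier of 𝒪⁺(μ); a left cut is positive iff it contains 0
    Pos : 𝕊 → Set₁
    Pos γ = ∃[ r ] (Value γ r × ⌜ 0ℚ ⌝ ∈ r)

    -- tag 3 ⟅ γ , tag 1 ζ ⟆ is the code γ ∧ ¬ ζ
    _≼_ : 𝕊 → 𝕊 → Set₁
    γ ≼ ζ = ∃[ r ] (Value (tag 3 ⟅ γ , tag 1 ζ ⟆) r × r IsCut rational 0ℚ)

    IsDense : 𝕊 → Set₁
    IsDense D = (∀ δ → δ ∈ D → Pos δ) ×
      (∀ γ → Pos γ → ∃[ δ ] (δ ∈ D × δ ≼ γ))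

    record IsRandomGenericFilter (G : 𝕊) : Set₁ where
      field
        conditions : ∀ γ → γ ∈ G → Pos γ
        nonempty   : ∃[ γ ] γ ∈ G
        upward     : ∀ γ ζ → γ ∈ G → Pos ζ → γ ≼ ζ → ζ ∈ G
        directed   : ∀ γ ζ → γ ∈ G → ζ ∈ G → ∃[ δ ] (δ ∈ G × δ ≼ γ × δ ≼ ζ)
        generic    : ∀ D → M D → IsDense D → ∃[ δ ] (δ ∈ D × δ ∈ G)

  -- M[G] ⊨ ⋂_{g ∈ G} Int(g) = {N}
  IsRandomGenericStructure : (M[G] : Class) (G N : 𝕊) → Set₁
  IsRandomGenericStructure M[G] G N =
    ∀ N′ → (∀ g (c : Code g) → g ∈ G → Int M[G] c N′) ⇔ N′ ≐ N

{-# OPTIONS --safe #-}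

-- Let U be the collection of classes P of structures such that some condition in
-- G is contained in P.  U is a consistent family: two conditions in G have a
-- common extension in G, which has positive measure.  Given a family (Qᵢ) of at
-- most κ measurable classes lying in V, the conditions contained in some Qᵢ or
-- disjoint from all of them are dense: a positive set which meets ⋃ Qᵢ positively
-- meets some Qᵢ positively by κ-additivity.  Hence ⋃ Qᵢ ∈ U implies Qᵢ ∈ U for
-- some i, and induction on φ shows that M_G satisfies φ(a) when the class of the
-- models of φ(a) is in U, and fails φ(a) when its complement is.  A class of
-- measure 1 is in U because its complement is null.
--
-- That these families and dense sets lie in V requires satisfaction of infinitary
-- formulas, codes and their interpretations to be definable over V, which is
-- obtained from sets in V of truth values (or of codes with interpretations) each
-- of whose members is justified by others, and from collection in V.

module Submission where

open import Defs hiding (∅; ⟅_,_⟆; ⟨_,_⟩; _⁺; nat; tuple; tag)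
import Defs as D
open import Level using (lift; lower; Lift)
open import Axiom.ExcludedMiddle using (ExcludedMiddle)
open import Data.Bool.Base using (Bool; true; false; not)
open import Data.Empty using (⊥-elim)
open import Data.Fin.Base using (Fin; zero; suc; toℕ; _↑ˡ_; _↑ʳ_)
open import Data.Fin.Patterns using (0F; 1F; 2F; 3F; 4F; 5F; 6F)
open import Data.Fin.Properties using (toℕ-injective)
open import Data.List.Base using (List; []; _∷_; _++_; length; foldr) renaming (map to mapL)
open import Data.List.Membership.Propositional using () renaming (_∈_ to _∈L_)
open import Data.List.Membership.Propositional.Properties using (∈-++⁺ˡ; ∈-++⁺ʳ)
open import Data.List.Relation.Unary.All using () renaming ([] to []A; _∷_ to _∷A_)
open import Data.List.Relation.Unary.AllPairs using () renaming ([] to []P; _∷_ to _∷P_)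
open import Data.List.Relation.Unary.Any as Any using (Any; here; there)
open import Data.Maybe.Base using (just; nothing)
open import Data.Nat.Base using (ℕ; zero; suc; _+_) renaming (_<_ to _<ⁿ_)
open import Data.Nat.Properties
  using (<-cmp; <-trans; m<1+n⇒m<n∨m≡n; n<1+n; m<n⇒m<1+n; +-suc; +-identityʳ; m+1+n≢m; m≢1+m+n)
open import Data.Product using (∃; _×_; _,_; proj₁; proj₂; Σ-syntax; ∃-syntax)
open import Data.Product.Function.NonDependent.Propositional using (_×-⇔_)
open import Data.Rational using (ℚ; 0ℚ; 1ℚ; -_) renaming (_+_ to _+ℚ_; _<_ to _<ℚ_; _-_ to _-ℚ_)
import Data.Rational.Properties as ℚ
open import Data.Rational.Solver using (module +-*-Solver)
open import Data.Sum.Base using (_⊎_; inj₁; inj₂; [_,_]′) renaming (map to map⊎; map₂ to map⊎₂)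
open import Data.Sum.Function.Propositional using (_⊎-⇔_)
open import Data.Unit.Polymorphic using (tt)
open import Data.Vec.Base using (Vec; []; _∷_; lookup; map) renaming (_++_ to _++ᵛ_)
open import Data.Vec.Properties using (lookup-++ˡ; lookup-++ʳ)
open import Data.Vec.Relation.Binary.Pointwise.Inductive as PW using (Pointwise; []; _∷_)
open import Data.Vec.Relation.Unary.All as All using (All; []; _∷_)
open import Data.Vec.Relation.Unary.All.Properties using () renaming (lookup⁺ to All-lookup; ++⁺ to All-++)
open import Function.Base using (_∘_; id)
open import Function.Bundles using (_⇔_; mk⇔; Equivalence)
open import Function.Properties.Equivalence using () renaming (refl to ⇔-refl; sym to ⇔-sym)
open import Relation.Binary.Definitions using (tri<; tri≈; tri>)
open import Relation.Binary.PropositionalEquality using (_≡_; refl; sym; trans; cong; cong₂; subst)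
open import Relation.Nullary using (¬_; Dec; yes; no)

open Equivalence using (to; from)

-- The structure `M_G` need not lie in V, whereas all classes and measures speak of structures in V.
-- The only contact between the two is that `M_G` satisfies every code in G. So only atomic formulas
-- and their negations have to be turned into codes that enter G; every other connective is handled
-- by genericity on the side of V. Density asks for a code inside a positive measurable set that
-- arises abstractly, which is why every measurable set of V must be shown to have a code. Formulas
-- and codes are inductive types of the ambient theory, while separation and replacement in V know
-- only first-order formulas. The rules of satisfaction therefore produce both truth values
-- positively, negation exchanging them. This makes the rules monotone, so that sets of mutually
-- justifying facts can be merged by union. Such sets need not be well-founded in themselves:
-- soundness gets its induction from outside, from the formula or from the code as a set.

infix 4 _≈_ _ϵ_ _⊆_

-- ≐ and ∈ compute on their arguments, which defeats the inference of implicit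
-- arguments; these records do not.
record _≈_ (x y : 𝕊) : Set₁ where
  constructor ↑≐
  field ↓≐ : x ≐ y
open _≈_ public

record _ϵ_ (x y : 𝕊) : Set₁ where
  constructor ↑∈
  field ↓∈ : x ∈ y
open _ϵ_ public

_⊆_ : 𝕊 → 𝕊 → Set₁
x ⊆ y = ∀ z → z ϵ x → z ϵ y

-- Sets up to bisimilarity, and well-founded induction.

≐-refl : ∀ x → x ≐ x
≐-refl (sup A f) = (λ a → a , ≐-refl (f a)) , (λ a → a , ≐-refl (f a))

≐-sym : ∀ x y → x ≐ y → y ≐ x
≐-sym (sup A f) (sup B g) (p , q) =
  (λ b → let a , e = q b in a , ≐-sym (f a) (g b) e) ,
  (λ a → let b , e = p a in b , ≐-sym (f a) (g b) e)

≐-trans : ∀ x y z → x ≐ y → y ≐ z → x ≐ z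
≐-trans (sup A f) (sup B g) (sup C h) (p , q) (r , s) =
  (λ a → let b , e = p a ; c , e′ = r b in c , ≐-trans (f a) (g b) (h c) e e′) ,
  (λ c → let b , e′ = s c ; a , e = q b in a , ≐-trans (f a) (g b) (h c) e e′)

≈-refl : ∀ {x} → x ≈ x
≈-refl {x} = ↑≐ (≐-refl x)

≈-reflexive : ∀ {x y} → x ≡ y → x ≈ y
≈-reflexive refl = ≈-refl

≈-sym : ∀ {x y} → x ≈ y → y ≈ x
≈-sym {x} {y} (↑≐ p) = ↑≐ (≐-sym x y p)

≈-trans : ∀ {x y z} → x ≈ y → y ≈ z → x ≈ z
≈-trans {x} {y} {z} (↑≐ p) (↑≐ q) = ↑≐ (≐-trans x y z p q)

ϵ-sup : ∀ {A} (f : A → 𝕊) a → f a ϵ sup A f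
ϵ-sup f a = ↑∈ (a , ≐-refl (f a))

ϵ-respˡ : ∀ {x y z} → x ≈ y → x ϵ z → y ϵ z
ϵ-respˡ {x} {y} {sup C h} e (↑∈ (c , q)) =
  ↑∈ (c , ↓≐ (≈-trans (≈-sym e) (↑≐ {x} {h c} q)))

ϵ-respʳ : ∀ {x y z} → y ≈ z → x ϵ y → x ϵ z
ϵ-respʳ {x} {sup B g} {sup C h} (↑≐ (p , _)) (↑∈ (b , e)) =
  let c , q = p b in ↑∈ (c , ≐-trans x (g b) (h c) e q)

ϵ-resp : ∀ {x y x′ y′} → x ≈ x′ → y ≈ y′ → x ϵ y → x′ ϵ y′
ϵ-resp e e′ m = ϵ-respʳ e′ (ϵ-respˡ e m)

ext : ∀ {x y} → x ⊆ y → y ⊆ x → x ≈ y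
ext {sup A f} {sup B g} p q = ↑≐
  ( (λ a → ↓∈ (p (f a) (ϵ-sup f a)))
  , (λ b → let a , e = ↓∈ (q (g b) (ϵ-sup g b)) in a , ≐-sym (g b) (f a) e))

-- Structural recursion reaches only the branches of a set, while its members are merely bisimilar
-- to branches, and `P` is not assumed to respect `≈`. Hence `go` proves `P` for everything
-- bisimilar to `x`.
ϵ-induction : ∀ {ℓ} (P : 𝕊 → Set ℓ) → (∀ x → (∀ y → y ϵ x → P y) → P x) → ∀ x → P x
ϵ-induction P step x = go x x ≈-refl
  where
  go : ∀ x y → y ≈ x → P y
  go (sup A f) y e = step y λ z m →
    let a , e′ = ↓∈ (ϵ-respʳ e m) in go (f a) z (↑≐ e′)

ϵ-irrefl : ∀ {x} → ¬ x ϵ x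
ϵ-irrefl {x} = ϵ-induction (λ x → ¬ x ϵ x) (λ x IH m → IH x m m) x

ϵ-asym : ∀ {x y} → x ϵ y → ¬ y ϵ x
ϵ-asym {x} = ϵ-induction (λ x → ∀ y → x ϵ y → ¬ y ϵ x) (λ x IH y m n → IH y n x n m) x _

-- The transitive closure of membership. The second component of a tagged pair lies two memberships
-- below it, so induction on codes as sets cannot descend by `ϵ` alone.
data _⊏_ : 𝕊 → 𝕊 → Set₁ where
  elem  : ∀ {x y} → x ϵ y → x ⊏ y
  _then_ : ∀ {x y z} → x ⊏ y → y ϵ z → x ⊏ z

⊏-trans : ∀ {x y z} → x ⊏ y → y ⊏ z → x ⊏ z
⊏-trans p (elem m)   = p then m
⊏-trans p (q then m) = ⊏-trans p q then m

⊏-induction : ∀ {ℓ} (P : 𝕊 → Set ℓ) → (∀ x → (∀ y → y ⊏ x → P y) → P x) → ∀ x → P x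
⊏-induction P step x = step x (below x)
  where
  below : ∀ x y → y ⊏ x → P y
  below = ϵ-induction (λ x → ∀ y → y ⊏ x → P y) λ where
    x IH y (elem m)             → step y (IH y m)
    x IH y (_then_ {y = z} p m) → IH z m y p

-- Pairs, numerals and tuples as sets.

-- Opaque copies of the basic set constructors, which would otherwise be unfolded
-- during conversion checking.
opaque
  ∅ : 𝕊
  ∅ = D.∅

  ⟅_,_⟆ ⟨_,_⟩ : 𝕊 → 𝕊 → 𝕊
  ⟅_,_⟆ = D.⟅_,_⟆
  ⟨_,_⟩ = D.⟨_,_⟩

  _⁺ : 𝕊 → 𝕊
  _⁺ = D._⁺

nat : ℕ → 𝕊
nat zero    = ∅
nat (suc n) = nat n ⁺

tuple : ∀ {n} → Vec 𝕊 n → 𝕊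
tuple []       = ∅
tuple (x ∷ xs) = ⟨ x , tuple xs ⟩

tag : ℕ → 𝕊 → 𝕊
tag k x = ⟨ nat k , x ⟩

opaque
  unfolding ∅ ⟅_,_⟆ ⟨_,_⟩ _⁺

  ⟅⟆-def : ∀ {x y} → ⟅ x , y ⟆ ≡ D.⟅ x , y ⟆
  ⟅⟆-def = refl

  ⟨⟩-def : ∀ {x y} → ⟨ x , y ⟩ ≡ D.⟨ x , y ⟩
  ⟨⟩-def = refl

  ⟨⟩-⟅⟆ : ∀ {x y} → ⟨ x , y ⟩ ≡ ⟅ ⟅ x , x ⟆ , ⟅ x , y ⟆ ⟆
  ⟨⟩-⟅⟆ = refl

  nat-def : ∀ n → nat n ≡ D.nat n
  nat-def zero    = refl
  nat-def (suc n) = cong D._⁺ (nat-def n)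

  tuple-def : ∀ {n} (xs : Vec 𝕊 n) → tuple xs ≡ D.tuple xs
  tuple-def []       = refl
  tuple-def (x ∷ xs) = cong D.⟨ x ,_⟩ (tuple-def xs)

  ∉∅ : ∀ {x} → ¬ x ϵ ∅
  ∉∅ (↑∈ ())

  ϵ-up⁻ : ∀ {x y z} → z ϵ ⟅ x , y ⟆ → z ≈ x ⊎ z ≈ y
  ϵ-up⁻ (↑∈ (true , e))  = inj₁ (↑≐ e)
  ϵ-up⁻ (↑∈ (false , e)) = inj₂ (↑≐ e)

  ϵ-upˡ : ∀ {x y z} → z ≈ x → z ϵ ⟅ x , y ⟆
  ϵ-upˡ e = ↑∈ (true , ↓≐ e)

  ϵ-upʳ : ∀ {x y z} → z ≈ y → z ϵ ⟅ x , y ⟆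
  ϵ-upʳ e = ↑∈ (false , ↓≐ e)

  up-cong : ∀ {x y x′ y′} → x ≈ x′ → y ≈ y′ → ⟅ x , y ⟆ ≈ ⟅ x′ , y′ ⟆
  up-cong e f = ↑≐ ( (λ { true → true , ↓≐ e ; false → false , ↓≐ f })
                   , (λ { true → true , ↓≐ e ; false → false , ↓≐ f }))

  ϵ-⁺⁻ : ∀ {x z} → z ϵ x ⁺ → z ϵ x ⊎ z ≈ x
  ϵ-⁺⁻ {sup A f} (↑∈ (just a , e))  = inj₁ (↑∈ (a , e))
  ϵ-⁺⁻ {sup A f} (↑∈ (nothing , e)) = inj₂ (↑≐ e)

  ϵ-⁺ˡ : ∀ {x z} → z ϵ x → z ϵ x ⁺
  ϵ-⁺ˡ {sup A f} (↑∈ (a , e)) = ↑∈ (just a , e)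

  ϵ-⁺ʳ : ∀ {x z} → z ≈ x → z ϵ x ⁺
  ϵ-⁺ʳ {sup A f} (↑≐ e) = ↑∈ (nothing , e)

tag-def : ∀ k {x} → tag k x ≡ D.tag k x
tag-def k {x} = trans ⟨⟩-def (cong D.⟨_, x ⟩ (nat-def k))

tag⁺ : ∀ {φ} k x → φ ≐ D.tag k x → φ ≈ tag k x
tag⁺ {φ} k x e = ≈-trans (↑≐ {φ} {D.tag k x} e) (≈-reflexive (sym (tag-def k)))

tag⁻ : ∀ {φ} k x → φ ≈ tag k x → φ ≐ D.tag k x
tag⁻ k x e = ↓≐ (≈-trans e (≈-reflexive (tag-def k)))

pair⁺ : ∀ x y {z} → z ≐ D.⟨ x , y ⟩ → z ≈ ⟨ x , y ⟩
pair⁺ x y {z} e = ≈-trans (↑≐ {z} {D.⟨ x , y ⟩} e) (≈-reflexive (sym ⟨⟩-def))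

pair⁻ : ∀ x y {z} → z ≈ ⟨ x , y ⟩ → z ≐ D.⟨ x , y ⟩
pair⁻ x y e = ↓≐ (≈-trans e (≈-reflexive ⟨⟩-def))

pair∈⁺ : ∀ x y {z} → D.⟨ x , y ⟩ ∈ z → ⟨ x , y ⟩ ϵ z
pair∈⁺ x y {z} m = subst (_ϵ z) (sym ⟨⟩-def) (↑∈ {D.⟨ x , y ⟩} m)

pair∈⁻ : ∀ x y {z} → ⟨ x , y ⟩ ϵ z → D.⟨ x , y ⟩ ∈ z
pair∈⁻ x y {z} m = ↓∈ (subst (_ϵ z) ⟨⟩-def m)

≈-⟅⟆ : ∀ {x y} → ⟨ x , y ⟩ ≈ ⟅ ⟅ x , x ⟆ , ⟅ x , y ⟆ ⟆
≈-⟅⟆ = ≈-reflexive ⟨⟩-⟅⟆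

pair-cong : ∀ {x y x′ y′} → x ≈ x′ → y ≈ y′ → ⟨ x , y ⟩ ≈ ⟨ x′ , y′ ⟩
pair-cong e f = ≈-trans ≈-⟅⟆ (≈-trans (up-cong (up-cong e e) (up-cong e f)) (≈-sym ≈-⟅⟆))

⁺-cong : ∀ {x y} → x ≈ y → x ⁺ ≈ y ⁺
⁺-cong e = ext (λ z → half e) (λ z → half (≈-sym e))
  where
  half : ∀ {x y z} → x ≈ y → z ϵ x ⁺ → z ϵ y ⁺
  half e m with ϵ-⁺⁻ m
  ... | inj₁ m′ = ϵ-⁺ˡ (ϵ-respʳ e m′)
  ... | inj₂ e′ = ϵ-⁺ʳ (≈-trans e′ e)

⁺-injective : ∀ {x y} → x ⁺ ≈ y ⁺ → x ≈ y
⁺-injective {x} {y} e with ϵ-⁺⁻ (ϵ-respʳ e (ϵ-⁺ʳ ≈-refl)) | ϵ-⁺⁻ (ϵ-respʳ (≈-sym e) (ϵ-⁺ʳ ≈-refl))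
... | inj₂ f | _      = f
... | _      | inj₂ f = ≈-sym f
... | inj₁ m | inj₁ n = ⊥-elim (ϵ-asym m n)

∅≉⁺ : ∀ {x} → ¬ ∅ ≈ x ⁺
∅≉⁺ {x} e = ∉∅ {x} (ϵ-respʳ (≈-sym e) (ϵ-⁺ʳ ≈-refl))

∅≉pair : ∀ {x y} → ¬ ∅ ≈ ⟨ x , y ⟩
∅≉pair {x} e = ∉∅ {⟅ x , x ⟆} (ϵ-respʳ (≈-sym (≈-trans e ≈-⟅⟆)) (ϵ-upˡ ≈-refl))

-- For the second components both directions are compared: one gives `y ≈ y′` or the degenerate case
-- `y ≈ x`. If the other direction degenerates too, all four sets coincide.
pair-injective : ∀ {x y x′ y′} → ⟨ x , y ⟩ ≈ ⟨ x′ , y′ ⟩ → x ≈ x′ × y ≈ y′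
pair-injective {x} {y} {x′} {y′} e₀ = x≈x′ , y≈y′
  where
  Pair : 𝕊 → 𝕊 → 𝕊
  Pair x y = ⟅ ⟅ x , x ⟆ , ⟅ x , y ⟆ ⟆

  e : Pair x y ≈ Pair x′ y′
  e = ≈-trans (≈-sym ≈-⟅⟆) (≈-trans e₀ ≈-⟅⟆)

  first : ∀ {x y x′ y′} → Pair x y ≈ Pair x′ y′ → x ≈ x′
  first e with ϵ-up⁻ (ϵ-respʳ e (ϵ-upˡ ≈-refl))
  ... | inj₁ f with ϵ-up⁻ (ϵ-respʳ f (ϵ-upˡ ≈-refl))
  ...   | inj₁ g = g
  ...   | inj₂ g = g
  first e | inj₂ f with ϵ-up⁻ (ϵ-respʳ (≈-sym f) (ϵ-upˡ ≈-refl))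
  ...   | inj₁ g = ≈-sym g
  ...   | inj₂ g = ≈-sym g

  x≈x′ : x ≈ x′
  x≈x′ = first e

  second : ∀ {x y x′ y′} → x ≈ x′ → Pair x y ≈ Pair x′ y′ → y ≈ y′ ⊎ y ≈ x
  second a e with ϵ-up⁻ (ϵ-respʳ e (ϵ-upʳ ≈-refl))
  ... | inj₁ f with ϵ-up⁻ (ϵ-respʳ f (ϵ-upʳ ≈-refl))
  ...   | inj₁ g = inj₂ (≈-trans g (≈-sym a))
  ...   | inj₂ g = inj₂ (≈-trans g (≈-sym a))
  second a e | inj₂ f with ϵ-up⁻ (ϵ-respʳ f (ϵ-upʳ ≈-refl))
  ...   | inj₁ g = inj₂ (≈-trans g (≈-sym a))
  ...   | inj₂ g = inj₁ g

  y≈y′ : y ≈ y′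
  y≈y′ with second x≈x′ e | second (≈-sym x≈x′) (≈-sym e)
  ... | inj₁ f | _      = f
  ... | _      | inj₁ f = ≈-sym f
  ... | inj₂ f | inj₂ g = ≈-trans f (≈-trans x≈x′ (≈-sym g))

nat-ϵ⁻ : ∀ n {x} → x ϵ nat n → ∃[ i ] (i <ⁿ n × x ≈ nat i)
nat-ϵ⁻ zero    m = ⊥-elim (∉∅ m)
nat-ϵ⁻ (suc n) m with ϵ-⁺⁻ m
... | inj₁ m′ = let i , l , e = nat-ϵ⁻ n m′ in i , m<n⇒m<1+n l , e
... | inj₂ e  = n , n<1+n n , e

nat-ϵ : ∀ {i n} → i <ⁿ n → nat i ϵ nat n
nat-ϵ {i} {suc n} l with m<1+n⇒m<n∨m≡n l
... | inj₁ l′   = ϵ-⁺ˡ (nat-ϵ l′)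
... | inj₂ refl = ϵ-⁺ʳ ≈-refl

nat-injective : ∀ {m n} → nat m ≈ nat n → m ≡ n
nat-injective {m} {n} e with <-cmp m n
... | tri< l _ _ = ⊥-elim (ϵ-irrefl (ϵ-respʳ (≈-sym e) (nat-ϵ l)))
... | tri≈ _ p _ = p
... | tri> _ _ l = ⊥-elim (ϵ-irrefl (ϵ-respʳ e (nat-ϵ l)))

nat-ϵ-ω : ∀ n → nat n ϵ ω
nat-ϵ-ω n = ↑∈ (n , ↓≐ (≈-reflexive (nat-def n)))

ϵ-ω⁻ : ∀ {x} → x ϵ ω → ∃[ n ] x ≈ nat n
ϵ-ω⁻ (↑∈ (n , e)) = n , ≈-trans (↑≐ e) (≈-reflexive (sym (nat-def n)))

infixr 0 _▹_

_▹_ : ∀ {a b} {A : Set a} {B : Set b} → A → (A → B) → B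
x ▹ f = f x

-- Comparability of transitive sets.

Transitive : 𝕊 → Set₁
Transitive x = ∀ y z → y ϵ x → z ϵ y → z ϵ x

-- Serves both the levels of the cumulative hierarchy and the ordinals. If `s` neither equals nor
-- belongs to any `K`-member of `t`, and conversely, the two induction hypotheses give `s` and `t`
-- the same `K`-members, and `det` identifies them.
trichotomy : ExcludedMiddle 1ℓ → (K : 𝕊 → Set₁) → (∀ s → K s → Transitive s) →
  (∀ s t → K s → K t → (∀ u → K u → u ϵ s → u ϵ t) → (∀ u → K u → u ϵ t → u ϵ s) → s ≈ t) →
  ∀ s t → K s → K t → s ϵ t ⊎ s ≈ t ⊎ t ϵ s
trichotomy lem K tr det = ϵ-induction _ λ s IHs → ϵ-induction _ λ t IHt Ks Kt → compare s t IHs IHt Ks Kt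
  where
  C : 𝕊 → 𝕊 → Set₁
  C s t = s ϵ t ⊎ s ≈ t ⊎ t ϵ s

  compare : ∀ s t → (∀ s′ → s′ ϵ s → ∀ t → K s′ → K t → C s′ t) →
            (∀ t′ → t′ ϵ t → K s → K t′ → C s t′) → K s → K t → C s t
  compare s t IHs IHt Ks Kt
    with lem {∃[ t′ ] (K t′ × t′ ϵ t × (s ϵ t′ ⊎ s ≈ t′))}
       | lem {∃[ s′ ] (K s′ × s′ ϵ s × (t ϵ s′ ⊎ t ≈ s′))}
  ... | yes (t′ , _ , m , inj₁ n) | _ = inj₁ (tr t Kt t′ s m n)
  ... | yes (t′ , _ , m , inj₂ e) | _ = inj₁ (ϵ-respˡ (≈-sym e) m)
  ... | no _ | yes (s′ , _ , m , inj₁ n) = inj₂ (inj₂ (tr s Ks s′ t m n))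
  ... | no _ | yes (s′ , _ , m , inj₂ e) = inj₂ (inj₂ (ϵ-respˡ (≈-sym e) m))
  ... | no ¬a | no ¬b = inj₂ (inj₁ (det s t Ks Kt left right))
    where
    left : ∀ u → K u → u ϵ s → u ϵ t
    left u Ku m with IHs u m t Ku Kt
    ... | inj₁ n        = n
    ... | inj₂ (inj₁ e) = ⊥-elim (¬b (u , Ku , m , inj₂ (≈-sym e)))
    ... | inj₂ (inj₂ n) = ⊥-elim (¬b (u , Ku , m , inj₁ n))
    right : ∀ u → K u → u ϵ t → u ϵ s
    right u Ku m with IHt u m Ks Ku
    ... | inj₁ n        = ⊥-elim (¬a (u , Ku , m , inj₁ n))
    ... | inj₂ (inj₁ e) = ⊥-elim (¬a (u , Ku , m , inj₂ e))
    ... | inj₂ (inj₂ n) = n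

-- Terms, and formulas definable over V with parameters.

data Term {a} (A : Set a) : Set a where
  var : A → Term A
  ∅ᵗ  : Term A
  _⁺ᵗ : Term A → Term A
  ⟅_,_⟆ᵗ ⟨_,_⟩ᵗ : Term A → Term A → Term A

natᵗ : ∀ {a} {A : Set a} → ℕ → Term A
natᵗ zero    = ∅ᵗ
natᵗ (suc n) = natᵗ n ⁺ᵗ

tagᵗ : ∀ {a} {A : Set a} → ℕ → Term A → Term A
tagᵗ k t = ⟨ natᵗ k , t ⟩ᵗ

eval : ∀ {a} {A : Set a} → (A → 𝕊) → Term A → 𝕊
eval ρ (var x)      = ρ x
eval ρ ∅ᵗ           = ∅
eval ρ (t ⁺ᵗ)       = eval ρ t ⁺
eval ρ ⟅ t , u ⟆ᵗ   = ⟅ eval ρ t , eval ρ u ⟆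
eval ρ ⟨ t , u ⟩ᵗ   = ⟨ eval ρ t , eval ρ u ⟩

_>>=ᵗ_ : ∀ {a b} {A : Set a} {B : Set b} → Term A → (A → Term B) → Term B
var x      >>=ᵗ σ = σ x
∅ᵗ         >>=ᵗ σ = ∅ᵗ
(t ⁺ᵗ)     >>=ᵗ σ = (t >>=ᵗ σ) ⁺ᵗ
⟅ t , u ⟆ᵗ >>=ᵗ σ = ⟅ t >>=ᵗ σ , u >>=ᵗ σ ⟆ᵗ
⟨ t , u ⟩ᵗ >>=ᵗ σ = ⟨ t >>=ᵗ σ , u >>=ᵗ σ ⟩ᵗ

eval-cong : ∀ {a b} {A : Set a} {B : Set b} (t : Term A) (σ : A → Term B) {ρ : B → 𝕊} {ρ′ : A → 𝕊} →
  (∀ x → eval ρ (σ x) ≈ ρ′ x) → eval ρ (t >>=ᵗ σ) ≈ eval ρ′ t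
eval-cong (var x)    σ h = h x
eval-cong ∅ᵗ         σ h = ≈-refl
eval-cong (t ⁺ᵗ)     σ h = ⁺-cong (eval-cong t σ h)
eval-cong ⟅ t , u ⟆ᵗ σ h = up-cong (eval-cong t σ h) (eval-cong u σ h)
eval-cong ⟨ t , u ⟩ᵗ σ h = pair-cong (eval-cong t σ h) (eval-cong u σ h)

module Definability (V : Class) (model : IsModelOfSetTheory V) where
  open IsModelOfSetTheory model
  open ZFC zfc renaming (union to union-axiom)

  infix 8 _∈ᵗ_ _≐ᵗ_
  infixr 7 _∧ᵗ_
  infixr 6 _∨ᵗ_
  infixr 5 _⇒ᵗ_ _⇔ᵗ_
  infix 9 ¬ᵗ_

  V-resp : ∀ {x y} → x ≈ y → V x → V y
  V-resp e = respects (↓≐ e)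

  V-ϵ : ∀ {x y} → V x → y ϵ x → V y
  V-ϵ Vx m = transitive Vx (↓∈ m)

  V-ext : ∀ {x y} → V x → V y → (∀ z → V z → z ϵ x ⇔ z ϵ y) → x ≈ y
  V-ext Vx Vy h = ext (λ z m → to (h z (V-ϵ Vx m)) m) (λ z m → from (h z (V-ϵ Vy m)) m)

  V-∅ : V ∅
  V-∅ with infinity
  ... | _ , _ , (e , Ve , _ , empty) , _ =
    V-resp (ext (λ z m → ⊥-elim (empty z (V-ϵ Ve m) (↓∈ m))) (λ z m → ⊥-elim (∉∅ m))) Ve

  V-up : ∀ {x y} → V x → V y → V ⟅ x , y ⟆
  V-up {x} {y} Vx Vy with pairing x y Vx Vy
  ... | p , Vp , h = V-resp (ext
    (λ z m → [ (λ e → ϵ-upˡ (↑≐ e)) , (λ e → ϵ-upʳ (↑≐ e)) ]′ (to (h z (V-ϵ Vp m)) (↓∈ m)))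
    (λ z m → ↑∈ (from (h z ([ (λ e → V-resp (≈-sym e) Vx) , (λ e → V-resp (≈-sym e) Vy) ]′ (ϵ-up⁻ m)))
                  (map⊎ ↓≐ ↓≐ (ϵ-up⁻ m))))) Vp

  V-pair : ∀ {x y} → V x → V y → V ⟨ x , y ⟩
  V-pair Vx Vy = V-resp (≈-sym ≈-⟅⟆) (V-up (V-up Vx Vx) (V-up Vx Vy))

  V-up⁻ : ∀ {x y} → V ⟅ x , y ⟆ → V x × V y
  V-up⁻ Vp = V-ϵ Vp (ϵ-upˡ ≈-refl) , V-ϵ Vp (ϵ-upʳ ≈-refl)

  V-pair⁻ : ∀ {x y} → V ⟨ x , y ⟩ → V x × V y
  V-pair⁻ Vp = V-up⁻ (proj₂ (V-up⁻ (V-resp ≈-⟅⟆ Vp)))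

  V-⋃ : ∀ {x} → V x → ∃[ u ] (V u × (∀ z → z ϵ u ⇔ (∃[ y ] (y ϵ x × z ϵ y))))
  V-⋃ {x} Vx with union-axiom x Vx
  ... | u , Vu , h = u , Vu , λ z → mk⇔
    (λ m → let y , _ , n , k = to (h z (V-ϵ Vu m)) (↓∈ m) in y , ↑∈ n , ↑∈ k)
    (λ (y , n , k) → ↑∈ (from (h z (V-ϵ (V-ϵ Vx n) k)) (y , V-ϵ Vx n , ↓∈ n , ↓∈ k)))

  V-⁺ : ∀ {x} → V x → V (x ⁺)
  V-⁺ {x} Vx with V-⋃ (V-up Vx (V-up Vx Vx))
  ... | u , Vu , h = V-resp (ext
    (λ z m → let y , n , k = to (h z) m in
      [ (λ e → ϵ-⁺ˡ (ϵ-respʳ e k))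
      , (λ e → [ ϵ-⁺ʳ , ϵ-⁺ʳ ]′ (ϵ-up⁻ (ϵ-respʳ e k))) ]′ (ϵ-up⁻ n))
    (λ z m → from (h z) ([ (λ k → x , ϵ-upˡ ≈-refl , k) , (λ e → ⟅ x , x ⟆ , ϵ-upʳ ≈-refl , ϵ-upˡ e) ]′ (ϵ-⁺⁻ m))))
    Vu

  V-nat : ∀ n → V (nat n)
  V-nat zero    = V-∅
  V-nat (suc n) = V-⁺ (V-nat n)

  V-tag : ∀ {x} k → V x → V (tag k x)
  V-tag k Vx = V-pair (V-nat k) Vx

  V-eval : ∀ {a} {A : Set a} (t : Term A) {ρ : A → 𝕊} → (∀ x → V (ρ x)) → V (eval ρ t)
  V-eval (var x)    h = h x
  V-eval ∅ᵗ         h = V-∅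
  V-eval (t ⁺ᵗ)     h = V-⁺ (V-eval t h)
  V-eval ⟅ t , u ⟆ᵗ h = V-up (V-eval t h) (V-eval u h)
  V-eval ⟨ t , u ⟩ᵗ h = V-pair (V-eval t h) (V-eval u h)

  Const : Set₁
  Const = ∃ V

  Tm : ℕ → Set₁
  Tm n = Term (Fin n ⊎ Const)

  con : ∀ {n} c → V c → Tm n
  con c Vc = var (inj₂ (c , Vc))

  v0 : ∀ {n} → Tm (1 + n)
  v0 = var (inj₁ zero)
  v1 : ∀ {n} → Tm (2 + n)
  v1 = var (inj₁ (suc zero))
  v2 : ∀ {n} → Tm (3 + n)
  v2 = var (inj₁ (suc (suc zero)))
  v3 : ∀ {n} → Tm (4 + n)
  v3 = var (inj₁ (suc (suc (suc zero))))
  v4 : ∀ {n} → Tm (5 + n)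
  v4 = var (inj₁ (suc (suc (suc (suc zero)))))
  v5 : ∀ {n} → Tm (6 + n)
  v5 = var (inj₁ (suc (suc (suc (suc (suc zero))))))
  v6 : ∀ {n} → Tm (7 + n)
  v6 = var (inj₁ (suc (suc (suc (suc (suc (suc zero)))))))
  v7 : ∀ {n} → Tm (8 + n)
  v7 = var (inj₁ (suc (suc (suc (suc (suc (suc (suc zero))))))))

  -- A surface syntax for set theory over V in which pairs, numerals and elements of V occur as
  -- terms. With `app` the substitution is left to the semantics, where it computes, so that a
  -- formula can be reused at terms without a substitution lemma.
  data Fo (n : ℕ) : Set₁ where
    _∈ᵗ_ _≐ᵗ_        : Tm n → Tm n → Fo n
    ¬ᵗ_              : Fo n → Fo n
    _∧ᵗ_ _∨ᵗ_ _⇒ᵗ_   : Fo n → Fo n → Fo n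
    ∀∈ ∃∈            : Tm n → Fo (suc n) → Fo n
    ∀V ∃V            : Fo (suc n) → Fo n
    app              : ∀ {k} → Fo k → Vec (Tm n) k → Fo n

  env : ∀ {n} → Vec 𝕊 n → Fin n ⊎ Const → 𝕊
  env ρ (inj₁ i) = lookup ρ i
  env ρ (inj₂ c) = proj₁ c

  ev : ∀ {n} → Vec 𝕊 n → Tm n → 𝕊
  ev ρ = eval (env ρ)

  evs : ∀ {n k} → Vec 𝕊 n → Vec (Tm n) k → Vec 𝕊 k
  evs ρ []       = []
  evs ρ (t ∷ ts) = ev ρ t ∷ evs ρ ts

  ⟦_⟧ : ∀ {n} → Fo n → Vec 𝕊 n → Set₁
  ⟦ t ∈ᵗ u ⟧   ρ = ev ρ t ϵ ev ρ u
  ⟦ t ≐ᵗ u ⟧   ρ = ev ρ t ≈ ev ρ u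
  ⟦ ¬ᵗ F ⟧     ρ = ¬ ⟦ F ⟧ ρ
  ⟦ F ∧ᵗ H ⟧   ρ = ⟦ F ⟧ ρ × ⟦ H ⟧ ρ
  ⟦ F ∨ᵗ H ⟧   ρ = ⟦ F ⟧ ρ ⊎ ⟦ H ⟧ ρ
  ⟦ F ⇒ᵗ H ⟧   ρ = ⟦ F ⟧ ρ → ⟦ H ⟧ ρ
  ⟦ ∀∈ t F ⟧   ρ = ∀ x → x ϵ ev ρ t → ⟦ F ⟧ (x ∷ ρ)
  ⟦ ∃∈ t F ⟧   ρ = ∃[ x ] (x ϵ ev ρ t × ⟦ F ⟧ (x ∷ ρ))
  ⟦ ∀V F ⟧     ρ = ∀ x → V x → ⟦ F ⟧ (x ∷ ρ)
  ⟦ ∃V F ⟧     ρ = ∃[ x ] (V x × ⟦ F ⟧ (x ∷ ρ))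
  ⟦ app F ts ⟧ ρ = ⟦ F ⟧ (evs ρ ts)

  _⇔ᵗ_ : ∀ {n} → Fo n → Fo n → Fo n
  F ⇔ᵗ H = (F ⇒ᵗ H) ∧ᵗ (H ⇒ᵗ F)

  infix 4 _≋_
  _≋_ : ∀ {n} → Vec 𝕊 n → Vec 𝕊 n → Set₁
  _≋_ = Pointwise _≈_

  ≋-sym : ∀ {n} {ρ ρ′ : Vec 𝕊 n} → ρ ≋ ρ′ → ρ′ ≋ ρ
  ≋-sym = PW.sym ≈-sym

  bind-id : ∀ {a} {A : Set a} (t : Term A) → t >>=ᵗ var ≡ t
  bind-id (var x)    = refl
  bind-id ∅ᵗ         = refl
  bind-id (t ⁺ᵗ)     = cong _⁺ᵗ (bind-id t)
  bind-id ⟅ t , u ⟆ᵗ rewrite bind-id t | bind-id u = refl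
  bind-id ⟨ t , u ⟩ᵗ rewrite bind-id t | bind-id u = refl

  ev-resp : ∀ {n} (t : Tm n) {ρ ρ′} → ρ ≋ ρ′ → ev ρ t ≈ ev ρ′ t
  ev-resp t {ρ} {ρ′} e = subst (λ s → ev ρ s ≈ ev ρ′ t) (bind-id t)
    (eval-cong t var λ { (inj₁ i) → PW.lookup e i ; (inj₂ _) → ≈-refl })

  evs-resp : ∀ {n k} (ts : Vec (Tm n) k) {ρ ρ′} → ρ ≋ ρ′ → evs ρ ts ≋ evs ρ′ ts
  evs-resp []       e = []
  evs-resp (t ∷ ts) e = ev-resp t e ∷ evs-resp ts e

  ⟦⟧-resp : ∀ {n} (F : Fo n) {ρ ρ′} → ρ ≋ ρ′ → ⟦ F ⟧ ρ → ⟦ F ⟧ ρ′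
  ⟦⟧-resp (t ∈ᵗ u)   e m = ϵ-resp (ev-resp t e) (ev-resp u e) m
  ⟦⟧-resp (t ≐ᵗ u)   e m = ≈-trans (≈-sym (ev-resp t e)) (≈-trans m (ev-resp u e))
  ⟦⟧-resp (¬ᵗ F)     e h = h ∘ ⟦⟧-resp F (≋-sym e)
  ⟦⟧-resp (F ∧ᵗ H)   e (p , q) = ⟦⟧-resp F e p , ⟦⟧-resp H e q
  ⟦⟧-resp (F ∨ᵗ H)   e h = map⊎ (⟦⟧-resp F e) (⟦⟧-resp H e) h
  ⟦⟧-resp (F ⇒ᵗ H)   e h = ⟦⟧-resp H e ∘ h ∘ ⟦⟧-resp F (≋-sym e)
  ⟦⟧-resp (∀∈ t F)   e h x m = ⟦⟧-resp F (≈-refl ∷ e) (h x (ϵ-respʳ (≈-sym (ev-resp t e)) m))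
  ⟦⟧-resp (∃∈ t F)   e (x , m , p) = x , ϵ-respʳ (ev-resp t e) m , ⟦⟧-resp F (≈-refl ∷ e) p
  ⟦⟧-resp (∀V F)     e h x Vx = ⟦⟧-resp F (≈-refl ∷ e) (h x Vx)
  ⟦⟧-resp (∃V F)     e (x , Vx , p) = x , Vx , ⟦⟧-resp F (≈-refl ∷ e) p
  ⟦⟧-resp (app F ts) e h = ⟦⟧-resp F (evs-resp ts e) h

  private
    _⇔ᶠ_ : ∀ {m} → SetFormula m → SetFormula m → SetFormula m
    φ ⇔ᶠ ψ = (φ ⇒ᶠ ψ) ∧ᶠ (ψ ⇒ᶠ φ)

    suc² : ∀ {m} → Fin m → Fin (2 + m)
    suc² i = suc (suc i)

    -- "xᵢ ≐ {xⱼ , xₖ}"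
    upᶠ : ∀ {m} → Fin m → Fin m → Fin m → SetFormula m
    upᶠ i j k = ∀ᶠ ((zero ∈ᶠ suc i) ⇔ᶠ ((zero ≐ᶠ suc j) ∨ᶠ (zero ≐ᶠ suc k)))

    -- "xᵢ ≐ t"
    isᶠ : ∀ {m k} → Term (Fin k) → (Fin k → Fin m) → Fin m → SetFormula m
    isᶠ (var j) f i = i ≐ᶠ f j
    isᶠ ∅ᵗ f i = ∀ᶠ (¬ᶠ (zero ∈ᶠ suc i))
    isᶠ (t ⁺ᵗ) f i = ∃ᶠ (isᶠ t (suc ∘ f) zero ∧ᶠ
      (∀ᶠ ((zero ∈ᶠ suc (suc i)) ⇔ᶠ ((zero ∈ᶠ suc zero) ∨ᶠ (zero ≐ᶠ suc zero)))))
    isᶠ ⟅ t , u ⟆ᵗ f i = ∃ᶠ (isᶠ t (suc ∘ f) zero ∧ᶠ (∃ᶠ (isᶠ u (suc² ∘ f) zero ∧ᶠ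
      upᶠ (suc² i) (suc zero) zero)))
    isᶠ ⟨ t , u ⟩ᵗ f i = ∃ᶠ (isᶠ t (suc ∘ f) zero ∧ᶠ (∃ᶠ (isᶠ u (suc² ∘ f) zero ∧ᶠ
      (∃ᶠ (upᶠ zero (suc² zero) (suc² zero) ∧ᶠ (∃ᶠ (upᶠ zero (suc² (suc zero)) (suc² zero) ∧ᶠ
      upᶠ (suc² (suc² i)) (suc zero) zero)))))))

    upᶠ-ok : ∀ {m} (i j k : Fin m) (ρ : Vec 𝕊 m) → All V ρ →
      Holds V (upᶠ i j k) ρ ⇔ (lookup ρ i ≈ ⟅ lookup ρ j , lookup ρ k ⟆)
    upᶠ-ok i j k ρ Vρ = mk⇔
      (λ h → ext
        (λ z m → [ (λ n → ϵ-upˡ (↑≐ (lower n))) , (λ n → ϵ-upʳ (↑≐ (lower n))) ]′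
           (proj₁ (h z (V-ϵ (All-lookup Vρ i) m)) (lift (↓∈ m))))
        (λ z m → ↑∈ (lower (proj₂ (h z (V-ϵ (V-up (All-lookup Vρ j) (All-lookup Vρ k)) m))
           (map⊎ (lift ∘ ↓≐) (lift ∘ ↓≐) (ϵ-up⁻ m))))))
      (λ p z _ →
        (λ m → map⊎ (lift ∘ ↓≐) (lift ∘ ↓≐) (ϵ-up⁻ (ϵ-respʳ p (↑∈ (lower m))))) ,
        (λ m → lift (↓∈ (ϵ-respʳ (≈-sym p) ([ (λ n → ϵ-upˡ (↑≐ (lower n))) , (λ n → ϵ-upʳ (↑≐ (lower n))) ]′ m)))))

    -- In the backward direction the values of the subterms must be exhibited in V: they are
    -- members, or members of members, of the value of the whole term, and V is transitive.
    isᶠ-ok : ∀ {m k} (t : Term (Fin k)) (f : Fin k → Fin m) (i : Fin m) (ρ : Vec 𝕊 m) → All V ρ →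
      (σ : Fin k → 𝕊) → (∀ j → lookup ρ (f j) ≈ σ j) →
      Holds V (isᶠ t f i) ρ ⇔ (lookup ρ i ≈ eval σ t)
    isᶠ-ok (var j) f i ρ Vρ σ e = mk⇔ (λ (lift p) → ≈-trans (↑≐ p) (e j)) (λ p → lift (↓≐ (≈-trans p (≈-sym (e j)))))
    isᶠ-ok ∅ᵗ f i ρ Vρ σ e = mk⇔
      (λ h → ext (λ z m → ⊥-elim (h z (V-ϵ (All-lookup Vρ i) m) (lift (↓∈ m)))) (λ z m → ⊥-elim (∉∅ m)))
      (λ p z _ (lift m) → ∉∅ (ϵ-respʳ p (↑∈ m)))
    isᶠ-ok (t ⁺ᵗ) f i ρ Vρ σ e = mk⇔
      (λ (x , Vx , p , h) → let q = to (isᶠ-ok t (suc ∘ f) zero (x ∷ ρ) (Vx ∷ Vρ) σ e) p in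
        ≈-trans (ext
          (λ z m → [ (λ n → ϵ-⁺ˡ (↑∈ (lower n))) , (λ n → ϵ-⁺ʳ (↑≐ (lower n))) ]′
             (proj₁ (h z (V-ϵ (All-lookup Vρ i) m)) (lift (↓∈ m))))
          (λ z m → ↑∈ (lower (proj₂ (h z (V-ϵ (V-⁺ Vx) m)) (map⊎ (lift ∘ ↓∈) (lift ∘ ↓≐) (ϵ-⁺⁻ m))))))
        (⁺-cong q))
      (λ p → let x = eval σ t ; Vx = V-ϵ (All-lookup Vρ i) (ϵ-respʳ (≈-sym p) (ϵ-⁺ʳ ≈-refl)) in
        x , Vx , from (isᶠ-ok t (suc ∘ f) zero (x ∷ ρ) (Vx ∷ Vρ) σ e) ≈-refl , λ z _ →
          (λ m → map⊎ (lift ∘ ↓∈) (lift ∘ ↓≐) (ϵ-⁺⁻ (ϵ-respʳ p (↑∈ (lower m))))) ,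
          (λ m → lift (↓∈ (ϵ-respʳ (≈-sym p) ([ (λ n → ϵ-⁺ˡ (↑∈ (lower n))) , (λ n → ϵ-⁺ʳ (↑≐ (lower n))) ]′ m)))))
    isᶠ-ok ⟅ t , u ⟆ᵗ f i ρ Vρ σ e = mk⇔
      (λ (x , Vx , p , y , Vy , q , h) →
        ≈-trans (to (upᶠ-ok (suc² i) (suc zero) zero (y ∷ x ∷ ρ) (Vy ∷ Vx ∷ Vρ)) h) (up-cong
          (to (isᶠ-ok t (suc ∘ f) zero (x ∷ ρ) (Vx ∷ Vρ) σ e) p)
          (to (isᶠ-ok u (suc² ∘ f) zero (y ∷ x ∷ ρ) (Vy ∷ Vx ∷ Vρ) σ e) q)))
      (λ p → V-up⁻ (V-resp p (All-lookup Vρ i)) ▹ λ (Vx , Vy) →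
        eval σ t , Vx , from (isᶠ-ok t (suc ∘ f) zero (eval σ t ∷ ρ) (Vx ∷ Vρ) σ e) ≈-refl ,
        eval σ u , Vy , from (isᶠ-ok u (suc² ∘ f) zero (eval σ u ∷ eval σ t ∷ ρ) (Vy ∷ Vx ∷ Vρ) σ e) ≈-refl ,
        from (upᶠ-ok (suc² i) (suc zero) zero (eval σ u ∷ eval σ t ∷ ρ) (Vy ∷ Vx ∷ Vρ)) p)
    isᶠ-ok ⟨ t , u ⟩ᵗ f i ρ Vρ σ e = mk⇔
      (λ (x , Vx , p , y , Vy , q , a , Va , ha , b , Vb , hb , h) →
        ≈-trans (to (upᶠ-ok (suc² (suc² i)) (suc zero) zero (b ∷ a ∷ y ∷ x ∷ ρ) (Vb ∷ Va ∷ Vy ∷ Vx ∷ Vρ)) h)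
        (≈-trans (up-cong
          (to (upᶠ-ok zero (suc² zero) (suc² zero) (a ∷ y ∷ x ∷ ρ) (Va ∷ Vy ∷ Vx ∷ Vρ)) ha)
          (to (upᶠ-ok zero (suc² (suc zero)) (suc² zero) (b ∷ a ∷ y ∷ x ∷ ρ) (Vb ∷ Va ∷ Vy ∷ Vx ∷ Vρ)) hb))
        (≈-trans (≈-sym ≈-⟅⟆) (pair-cong
          (to (isᶠ-ok t (suc ∘ f) zero (x ∷ ρ) (Vx ∷ Vρ) σ e) p)
          (to (isᶠ-ok u (suc² ∘ f) zero (y ∷ x ∷ ρ) (Vy ∷ Vx ∷ Vρ) σ e) q)))))
      (λ p → V-pair⁻ (V-resp p (All-lookup Vρ i)) ▹ λ (Vx , Vy) →
        V-up Vx Vx ▹ λ Va → V-up Vx Vy ▹ λ Vb →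
        eval σ t , Vx , from (isᶠ-ok t (suc ∘ f) zero (eval σ t ∷ ρ) (Vx ∷ Vρ) σ e) ≈-refl ,
        eval σ u , Vy , from (isᶠ-ok u (suc² ∘ f) zero (eval σ u ∷ eval σ t ∷ ρ) (Vy ∷ Vx ∷ Vρ) σ e) ≈-refl ,
        _ , Va , from (upᶠ-ok zero (suc² zero) (suc² zero) (_ ∷ eval σ u ∷ eval σ t ∷ ρ) (Va ∷ Vy ∷ Vx ∷ Vρ)) ≈-refl ,
        _ , Vb , from (upᶠ-ok zero (suc² (suc zero)) (suc² zero) (_ ∷ _ ∷ eval σ u ∷ eval σ t ∷ ρ) (Vb ∷ Va ∷ Vy ∷ Vx ∷ Vρ)) ≈-refl ,
        from (upᶠ-ok (suc² (suc² i)) (suc zero) zero (_ ∷ _ ∷ eval σ u ∷ eval σ t ∷ ρ) (Vb ∷ Va ∷ Vy ∷ Vx ∷ Vρ)) (≈-trans p ≈-⟅⟆))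

    STm : ℕ → Set
    STm m = Term (Fin m)

    wk : ∀ {m} → STm m → STm (suc m)
    wk t = t >>=ᵗ (var ∘ suc)

    memᶠ eqᶠ : ∀ {m} → STm m → STm m → SetFormula m
    memᶠ t u = ∃ᶠ (isᶠ t suc zero ∧ᶠ (∃ᶠ (isᶠ u suc² zero ∧ᶠ (suc zero ∈ᶠ zero))))
    eqᶠ t u = ∃ᶠ (isᶠ t suc zero ∧ᶠ isᶠ u suc zero)

    memᶠ-ok : ∀ {m} (t u : STm m) (ρ : Vec 𝕊 m) → All V ρ →
      Holds V (memᶠ t u) ρ ⇔ (eval (lookup ρ) t ϵ eval (lookup ρ) u)
    memᶠ-ok t u ρ Vρ = mk⇔
      (λ (x , Vx , p , y , Vy , q , m) → ϵ-resp
        (to (isᶠ-ok t suc zero (x ∷ ρ) (Vx ∷ Vρ) (lookup ρ) (λ _ → ≈-refl)) p)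
        (to (isᶠ-ok u suc² zero (y ∷ x ∷ ρ) (Vy ∷ Vx ∷ Vρ) (lookup ρ) (λ _ → ≈-refl)) q) (↑∈ (lower m)))
      (λ m → let x = eval (lookup ρ) t ; Vx = V-eval t (All-lookup Vρ)
                 y = eval (lookup ρ) u ; Vy = V-eval u (All-lookup Vρ) in
        x , Vx , from (isᶠ-ok t suc zero (x ∷ ρ) (Vx ∷ Vρ) (lookup ρ) (λ _ → ≈-refl)) ≈-refl ,
        y , Vy , from (isᶠ-ok u suc² zero (y ∷ x ∷ ρ) (Vy ∷ Vx ∷ Vρ) (lookup ρ) (λ _ → ≈-refl)) ≈-refl ,
        lift (↓∈ m))

    eqᶠ-ok : ∀ {m} (t u : STm m) (ρ : Vec 𝕊 m) → All V ρ →
      Holds V (eqᶠ t u) ρ ⇔ (eval (lookup ρ) t ≈ eval (lookup ρ) u)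
    eqᶠ-ok t u ρ Vρ = mk⇔
      (λ (x , Vx , p , q) → ≈-trans
        (≈-sym (to (isᶠ-ok t suc zero (x ∷ ρ) (Vx ∷ Vρ) (lookup ρ) (λ _ → ≈-refl)) p))
        (to (isᶠ-ok u suc zero (x ∷ ρ) (Vx ∷ Vρ) (lookup ρ) (λ _ → ≈-refl)) q))
      (λ m → let x = eval (lookup ρ) t ; Vx = V-eval t (All-lookup Vρ) in
        x , Vx , from (isᶠ-ok t suc zero (x ∷ ρ) (Vx ∷ Vρ) (lookup ρ) (λ _ → ≈-refl)) ≈-refl ,
        from (isᶠ-ok u suc zero (x ∷ ρ) (Vx ∷ Vρ) (lookup ρ) (λ _ → ≈-refl)) m)

    constsᵗ : ∀ {n} → Tm n → List Const
    constsᵗ (var (inj₁ _)) = []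
    constsᵗ (var (inj₂ c)) = c ∷ []
    constsᵗ ∅ᵗ         = []
    constsᵗ (t ⁺ᵗ)     = constsᵗ t
    constsᵗ ⟅ t , u ⟆ᵗ = constsᵗ t ++ constsᵗ u
    constsᵗ ⟨ t , u ⟩ᵗ = constsᵗ t ++ constsᵗ u

    constsᵗˢ : ∀ {n k} → Vec (Tm n) k → List Const
    constsᵗˢ []       = []
    constsᵗˢ (t ∷ ts) = constsᵗ t ++ constsᵗˢ ts

    consts : ∀ {n} → Fo n → List Const
    consts (t ∈ᵗ u)   = constsᵗ t ++ constsᵗ u
    consts (t ≐ᵗ u)   = constsᵗ t ++ constsᵗ u
    consts (¬ᵗ F)     = consts F
    consts (F ∧ᵗ H)   = consts F ++ consts H
    consts (F ∨ᵗ H)   = consts F ++ consts H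
    consts (F ⇒ᵗ H)   = consts F ++ consts H
    consts (∀∈ t F)   = constsᵗ t ++ consts F
    consts (∃∈ t F)   = constsᵗ t ++ consts F
    consts (∀V F)     = consts F
    consts (∃V F)     = consts F
    consts (app F ts) = constsᵗˢ ts ++ consts F

    -- The axiom schemas take a pure formula and a vector of parameters. Each occurrence of a
    -- constant is assigned the variable that will carry its value.
    Places : ℕ → List Const → Set₁
    Places m cs = ∀ c → c ∈L cs → Fin m

    left : ∀ {m} {cs ds : List Const} → Places m (cs ++ ds) → Places m cs
    left g c p = g c (∈-++⁺ˡ p)

    right : ∀ {m} (cs : List Const) {ds : List Const} → Places m (cs ++ ds) → Places m ds
    right cs g c p = g c (∈-++⁺ʳ cs p)

    inst : ∀ {n m} (t : Tm n) → (Fin n → STm m) → Places m (constsᵗ t) → STm m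
    inst (var (inj₁ i)) σ g = σ i
    inst (var (inj₂ c)) σ g = var (g c (Any.here refl))
    inst ∅ᵗ         σ g = ∅ᵗ
    inst (t ⁺ᵗ)     σ g = inst t σ g ⁺ᵗ
    inst ⟅ t , u ⟆ᵗ σ g = ⟅ inst t σ (left g) , inst u σ (right (constsᵗ t) g) ⟆ᵗ
    inst ⟨ t , u ⟩ᵗ σ g = ⟨ inst t σ (left g) , inst u σ (right (constsᵗ t) g) ⟩ᵗ

    insts : ∀ {n m k} (ts : Vec (Tm n) k) → (Fin n → STm m) → Places m (constsᵗˢ ts) → Fin k → STm m
    insts (t ∷ ts) σ g zero    = inst t σ (left g)
    insts (t ∷ ts) σ g (suc i) = insts ts σ (right (constsᵗ t) g) i

    under : ∀ {n m} → (Fin n → STm m) → Fin (suc n) → STm (suc m)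
    under σ zero    = var zero
    under σ (suc i) = wk (σ i)

    -- Variables are interpreted by terms and not by variables, so that `app` compiles by putting
    -- the argument terms in place of the variables of `F`.
    compile : ∀ {n m} (F : Fo n) → (Fin n → STm m) → Places m (consts F) → SetFormula m
    compile (t ∈ᵗ u)   σ g = memᶠ (inst t σ (left g)) (inst u σ (right (constsᵗ t) g))
    compile (t ≐ᵗ u)   σ g = eqᶠ (inst t σ (left g)) (inst u σ (right (constsᵗ t) g))
    compile (¬ᵗ F)     σ g = ¬ᶠ compile F σ g
    compile (F ∧ᵗ H)   σ g = compile F σ (left g) ∧ᶠ compile H σ (right (consts F) g)
    compile (F ∨ᵗ H)   σ g = compile F σ (left g) ∨ᶠ compile H σ (right (consts F) g)
    compile (F ⇒ᵗ H)   σ g = compile F σ (left g) ⇒ᶠ compile H σ (right (consts F) g)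
    compile (∀∈ t F)   σ g = ∀ᶠ (memᶠ (var zero) (wk (inst t σ (left g))) ⇒ᶠ
                                 compile F (under σ) (λ c p → suc (right (constsᵗ t) g c p)))
    compile (∃∈ t F)   σ g = ∃ᶠ (memᶠ (var zero) (wk (inst t σ (left g))) ∧ᶠ
                                 compile F (under σ) (λ c p → suc (right (constsᵗ t) g c p)))
    compile (∀V F)     σ g = ∀ᶠ compile F (under σ) (λ c p → suc (g c p))
    compile (∃V F)     σ g = ∃ᶠ compile F (under σ) (λ c p → suc (g c p))
    compile (app F ts) σ g = compile F (insts ts σ (left g)) (right (constsᵗˢ ts) g)

    -- ρ interprets the terms σ as xs and the places g as the constants cs.
    record Env {n m} (cs : List Const) (σ : Fin n → STm m) (g : Places m cs) (ρ : Vec 𝕊 m) (xs : Vec 𝕊 n) : Set₁ where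
      field
        inV    : All V ρ
        locals : ∀ i → eval (lookup ρ) (σ i) ≈ lookup xs i
        params : ∀ c (p : c ∈L cs) → lookup ρ (g c p) ≈ proj₁ c
    open Env

    envˡ : ∀ {n m cs ds σ g ρ xs} → Env {n} {m} (cs ++ ds) σ g ρ xs → Env cs σ (left g) ρ xs
    envˡ a = record { inV = inV a ; locals = locals a ; params = λ c p → params a c (∈-++⁺ˡ p) }

    envʳ : ∀ {n m} cs {ds σ g ρ xs} → Env {n} {m} (cs ++ ds) σ g ρ xs → Env ds σ (right cs g) ρ xs
    envʳ cs a = record { inV = inV a ; locals = locals a ; params = λ c p → params a c (∈-++⁺ʳ cs p) }

    inst-ok : ∀ {n m} (t : Tm n) {σ : Fin n → STm m} {g ρ xs} → Env (constsᵗ t) σ g ρ xs →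
      eval (lookup ρ) (inst t σ g) ≈ ev xs t
    inst-ok (var (inj₁ i)) a = locals a i
    inst-ok (var (inj₂ _)) a = params a _ (Any.here refl)
    inst-ok ∅ᵗ a = ≈-refl
    inst-ok (t ⁺ᵗ) a = ⁺-cong (inst-ok t a)
    inst-ok ⟅ t , u ⟆ᵗ a = up-cong (inst-ok t (envˡ a)) (inst-ok u (envʳ (constsᵗ t) a))
    inst-ok ⟨ t , u ⟩ᵗ a = pair-cong (inst-ok t (envˡ a)) (inst-ok u (envʳ (constsᵗ t) a))

    insts-ok : ∀ {n m k} (ts : Vec (Tm n) k) {σ : Fin n → STm m} {g ρ xs} → Env (constsᵗˢ ts) σ g ρ xs →
      ∀ i → eval (lookup ρ) (insts ts σ g i) ≈ lookup (evs xs ts) i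
    insts-ok (t ∷ ts) a zero    = inst-ok t (envˡ a)
    insts-ok (t ∷ ts) a (suc i) = insts-ok ts (envʳ (constsᵗ t) a) i

    wk-ok : ∀ {m} (t : STm m) (ρ : Vec 𝕊 m) x → eval (lookup (x ∷ ρ)) (wk t) ≈ eval (lookup ρ) t
    wk-ok t ρ x = eval-cong t (var ∘ suc) (λ _ → ≈-refl)

    extend : ∀ {n m cs σ g ρ xs x} → Env {n} {m} cs σ g ρ xs → V x →
      Env cs (under σ) (λ c p → suc (g c p)) (x ∷ ρ) (x ∷ xs)
    extend {σ = σ} {ρ = ρ} {x = x} a Vx = record
      { inV = Vx ∷ inV a
      ; locals = λ { zero → ≈-refl ; (suc i) → ≈-trans (wk-ok (σ i) ρ x) (locals a i) }
      ; params = params a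
      }

    →-⇔ : ∀ {a} {A B : Set₁} {C D : Set a} → A ⇔ B → C ⇔ D → (A → C) ⇔ (B → D)
    →-⇔ p q = mk⇔ (λ f b → to q (f (from p b))) (λ f a → from q (f (to p a)))

    bound-ok : ∀ {n m} (t : Tm n) {σ : Fin n → STm m} {g ρ xs x} → Env (constsᵗ t) σ g ρ xs → V x →
      Holds V (memᶠ (var zero) (wk (inst t σ g))) (x ∷ ρ) ⇔ (x ϵ ev xs t)
    bound-ok t {σ} {g} {ρ} {x = x} a Vx =
      ≈-trans (wk-ok (inst t σ g) ρ x) (inst-ok t a) ▹ λ q →
      memᶠ-ok (var zero) (wk (inst t σ g)) (x ∷ ρ) (Vx ∷ inV a) ▹ λ r →
      mk⇔ (λ h → ϵ-respʳ q (to r h)) (λ m → from r (ϵ-respʳ (≈-sym q) m))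

    bound-V : ∀ {n m} (t : Tm n) {σ : Fin n → STm m} {g ρ xs} → Env (constsᵗ t) σ g ρ xs → V (ev xs t)
    bound-V t {σ} {g} a = V-resp (inst-ok t a) (V-eval (inst t σ g) (All-lookup (inV a)))

    compile-ok : ∀ {n m} (F : Fo n) {σ : Fin n → STm m} {g ρ xs} → Env (consts F) σ g ρ xs →
      Holds V (compile F σ g) ρ ⇔ ⟦ F ⟧ xs
    compile-ok (t ∈ᵗ u) a =
      inst-ok t (envˡ a) ▹ λ p → inst-ok u (envʳ (constsᵗ t) a) ▹ λ q → memᶠ-ok _ _ _ (inV a) ▹ λ r →
      mk⇔ (λ h → ϵ-resp p q (to r h)) (λ h → from r (ϵ-resp (≈-sym p) (≈-sym q) h))
    compile-ok (t ≐ᵗ u) a =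
      inst-ok t (envˡ a) ▹ λ p → inst-ok u (envʳ (constsᵗ t) a) ▹ λ q → eqᶠ-ok _ _ _ (inV a) ▹ λ r →
      mk⇔ (λ h → ≈-trans (≈-sym p) (≈-trans (to r h) q)) (λ h → from r (≈-trans p (≈-trans h (≈-sym q))))
    compile-ok (¬ᵗ F)   a = →-⇔ (compile-ok F a) ⇔-refl
    compile-ok (F ∧ᵗ H) a = compile-ok F (envˡ a) ×-⇔ compile-ok H (envʳ (consts F) a)
    compile-ok (F ∨ᵗ H) a = compile-ok F (envˡ a) ⊎-⇔ compile-ok H (envʳ (consts F) a)
    compile-ok (F ⇒ᵗ H) a = →-⇔ (compile-ok F (envˡ a)) (compile-ok H (envʳ (consts F) a))
    -- The compiled quantifier ranges over V only; by transitivity of V every member of the bound is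
    -- in that range.
    compile-ok (∀∈ t F) a = mk⇔
      (λ k x m → V-ϵ (bound-V t (envˡ a)) m ▹ λ Vx →
        to (compile-ok F (extend (envʳ (constsᵗ t) a) Vx)) (k x Vx (from (bound-ok t (envˡ a) Vx) m)))
      (λ k x Vx m → from (compile-ok F (extend (envʳ (constsᵗ t) a) Vx)) (k x (to (bound-ok t (envˡ a) Vx) m)))
    compile-ok (∃∈ t F) a = mk⇔
      (λ (x , Vx , m , k) →
        x , to (bound-ok t (envˡ a) Vx) m , to (compile-ok F (extend (envʳ (constsᵗ t) a) Vx)) k)
      (λ (x , m , k) → V-ϵ (bound-V t (envˡ a)) m ▹ λ Vx →
        x , Vx , from (bound-ok t (envˡ a) Vx) m , from (compile-ok F (extend (envʳ (constsᵗ t) a) Vx)) k)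
    compile-ok (∀V F) a = mk⇔
      (λ k x Vx → to (compile-ok F (extend a Vx)) (k x Vx)) (λ k x Vx → from (compile-ok F (extend a Vx)) (k x Vx))
    compile-ok (∃V F) a = mk⇔
      (λ (x , Vx , k) → x , Vx , to (compile-ok F (extend a Vx)) k)
      (λ (x , Vx , k) → x , Vx , from (compile-ok F (extend a Vx)) k)
    compile-ok (app F ts) a = compile-ok F (record
      { inV = inV a ; locals = insts-ok ts (envˡ a) ; params = λ c p → params a c (∈-++⁺ʳ (constsᵗˢ ts) p) })

    values : (cs : List Const) → Vec 𝕊 (length cs)
    values []       = []
    values (c ∷ cs) = proj₁ c ∷ values cs

    values-V : (cs : List Const) → All V (values cs)
    values-V []       = []
    values-V (c ∷ cs) = proj₂ c ∷ values-V cs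

    place : (cs : List Const) → Places (length cs) cs
    place cs c = Any.index

    place-ok : (cs : List Const) {c : Const} (p : c ∈L cs) → lookup (values cs) (place cs c p) ≈ proj₁ c
    place-ok (c ∷ cs) (Any.here refl) = ≈-refl
    place-ok (c ∷ cs) (Any.there p)   = place-ok cs p

    -- The free variables come first and the constants behind them, which is the shape of
    -- environment that separation and replacement expect.
    closed : ∀ {n} (F : Fo n) {xs} → All V xs → Env (consts F) (λ i → var (i ↑ˡ length (consts F)))
      (λ c p → n ↑ʳ place (consts F) c p) (xs ++ᵛ values (consts F)) xs
    closed {n} F {xs} Vxs = record
      { inV = All-++ Vxs (values-V (consts F))
      ; locals = λ i → ≈-reflexive (lookup-++ˡ xs (values (consts F)) i)
      ; params = λ c p → ≈-trans (≈-reflexive (lookup-++ʳ xs (values (consts F)) (place (consts F) c p))) (place-ok (consts F) p)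
      }

    closedᶠ : ∀ {n} (F : Fo n) → SetFormula (n + length (consts F))
    closedᶠ {n} F = compile F (λ i → var (i ↑ˡ length (consts F))) (λ c p → n ↑ʳ place (consts F) c p)

  sep : (F : Fo 1) → ∀ {a} → V a →
    ∃[ b ] (V b × (∀ x → x ϵ b ⇔ (x ϵ a × ⟦ F ⟧ (x ∷ []))))
  sep F {a} Va =
    separation (closedᶠ F) (values (consts F)) (values-V (consts F)) a Va ▹ λ (b , Vb , h) →
    b , Vb , λ x → mk⇔
      (λ m → V-ϵ Vb m ▹ λ Vx → to (h x Vx) (↓∈ m) ▹ λ (n , k) → ↑∈ n , to (compile-ok F (closed F (Vx ∷ []))) k)
      (λ (m , k) → V-ϵ Va m ▹ λ Vx → ↑∈ (from (h x Vx) (↓∈ m , from (compile-ok F (closed F (Vx ∷ []))) k)))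

  repl : (F : Fo 2) → ∀ {a} → V a →
    (∀ x y z → x ϵ a → V y → V z → ⟦ F ⟧ (x ∷ y ∷ []) → ⟦ F ⟧ (x ∷ z ∷ []) → y ≈ z) →
    ∃[ b ] (V b × (∀ y → V y → y ϵ b ⇔ (∃[ x ] (x ϵ a × ⟦ F ⟧ (x ∷ y ∷ [])))))
  repl F {a} Va functional =
    replacement (closedᶠ F) (values (consts F)) (values-V (consts F)) a Va
      (λ x y z Vx Vy Vz m p q → ↓≐ (functional x y z (↑∈ m) Vy Vz (to (ok Vx Vy) p) (to (ok Vx Vz) q))) ▹ λ (b , Vb , h) →
    b , Vb , λ y Vy → mk⇔
      (λ m → to (h y Vy) (↓∈ m) ▹ λ (x , Vx , n , k) → x , ↑∈ n , to (ok Vx Vy) k)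
      (λ (x , m , k) → V-ϵ Va m ▹ λ Vx → ↑∈ (from (h y Vy) (x , Vx , ↓∈ m , from (ok Vx Vy) k)))
    where
    ok : ∀ {x y} → V x → V y → Holds V (closedᶠ F) (x ∷ y ∷ values (consts F)) ⇔ ⟦ F ⟧ (x ∷ y ∷ [])
    ok Vx Vy = compile-ok F (closed F (Vx ∷ Vy ∷ []))

  V-𝒫 : ∀ {x} → V x → ∃[ p ] (V p × (∀ y → V y → y ϵ p ⇔ y ⊆ x))
  V-𝒫 {x} Vx with powerset x Vx
  ... | p , Vp , h = p , Vp , λ y Vy → mk⇔
    (λ m z n → ↑∈ (to (h y Vy) (↓∈ m) z (V-ϵ Vy n) (↓∈ n)))
    (λ k → ↑∈ (from (h y Vy) (λ z Vz n → ↓∈ (k z (↑∈ n)))))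

  image : (t : Tm 1) → ∀ {a} → V a → ∃[ b ] (V b × (∀ y → y ϵ b ⇔ (∃[ x ] (x ϵ a × y ≈ ev (x ∷ []) t))))
  image t {a} Va =
    let b , Vb , h = repl (v1 ≐ᵗ (t >>=ᵗ σ)) Va
          (λ x y z _ _ _ p q → ≈-trans (≈-trans p (e x y)) (≈-sym (≈-trans q (e x z)))) in
    b , Vb , λ y → mk⇔
      (λ m → let x , n , p = to (h y (V-ϵ Vb m)) m in x , n , ≈-trans p (e x y))
      (λ (x , n , p) → from (h y (V-resp (≈-sym p) (V-eval t (λ { (inj₁ zero) → V-ϵ Va n ; (inj₂ c) → proj₂ c }))))
                         (x , n , ≈-trans p (≈-sym (e x y))))
    where
    σ : Fin 1 ⊎ Const → Tm 2
    σ (inj₁ zero) = v0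
    σ (inj₂ c)    = var (inj₂ c)
    e : ∀ x y → ev (x ∷ y ∷ []) (t >>=ᵗ σ) ≈ ev (x ∷ []) t
    e x y = eval-cong t σ (λ { (inj₁ zero) → ≈-refl ; (inj₂ _) → ≈-refl })

  -- Cut by separation out of the double power set of the union of `a` and `b`, which contains all
  -- the Kuratowski pairs in question.
  product : ∀ {a b} → V a → V b → ∃[ c ] (V c × (∀ p → p ϵ c ⇔ (∃[ x ] ∃[ y ] (x ϵ a × y ϵ b × p ≈ ⟨ x , y ⟩))))
  product {a} {b} Va Vb =
    let u , Vu , hu = V-⋃ (V-up Va Vb)
        p , Vp , hp = V-𝒫 Vu
        q , Vq , hq = V-𝒫 Vp
        c , Vc , hc = sep (∃∈ (con a Va) (∃∈ (con b Vb) (v2 ≐ᵗ ⟨ v1 , v0 ⟩ᵗ))) Vq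
        ina : ∀ {x} → x ϵ a → x ϵ u
        ina m = from (hu _) (a , ϵ-upˡ ≈-refl , m)
        inb : ∀ {x} → x ϵ b → x ϵ u
        inb m = from (hu _) (b , ϵ-upʳ ≈-refl , m)
        inp : ∀ {x y} → x ϵ u → y ϵ u → ⟅ x , y ⟆ ϵ p
        inp m n = from (hp _ (V-up (V-ϵ Vu m) (V-ϵ Vu n)))
          (λ z k → [ (λ e → ϵ-respˡ (≈-sym e) m) , (λ e → ϵ-respˡ (≈-sym e) n) ]′ (ϵ-up⁻ k)) in
    c , Vc , λ z → mk⇔
      (λ m → let _ , x , mx , y , my , e = to (hc z) m in x , y , mx , my , e)
      (λ (x , y , mx , my , e) → from (hc z)
        ( ϵ-respˡ (≈-trans (≈-sym ≈-⟅⟆) (≈-sym e)) (from (hq _ (V-up (V-up (V-ϵ Va mx) (V-ϵ Va mx)) (V-up (V-ϵ Va mx) (V-ϵ Vb my))))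
            (λ w k → [ (λ e → ϵ-respˡ (≈-sym e) (inp (ina mx) (ina mx)))
                     , (λ e → ϵ-respˡ (≈-sym e) (inp (ina mx) (inb my))) ]′ (ϵ-up⁻ k)))
        , x , mx , y , my , e))

-- The cumulative hierarchy in V, collection and choice functions.

module Collection (lem : ExcludedMiddle 1ℓ) (V : Class) (model : IsModelOfSetTheory V) where
  open Definability V model public

  private
    subᵗ : ∀ {n} → Tm n → Tm n → Fo n
    subᵗ t u = app (∀∈ v0 (v0 ∈ᵗ v2)) (t ∷ u ∷ [])

    -- Levels s of the cumulative hierarchy, defined without ordinals: s is the
    -- union of the power sets of the members of a history h, where h is a set
    -- each of whose members t is the union of the power sets of h ∩ t.
    historyᵗ levelᵗ : Fo 1
    historyᵗ = ∀∈ v0 (∀V ((v0 ∈ᵗ v1) ⇔ᵗ ∃∈ v2 ((v0 ∈ᵗ v2) ∧ᵗ subᵗ v1 v0)))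
    levelᵗ = ∃V (app historyᵗ (v0 ∷ []) ∧ᵗ ∀V ((v0 ∈ᵗ v2) ⇔ᵗ ∃∈ v1 (subᵗ v1 v0)))

    History Level : 𝕊 → Set₁
    History h = ⟦ historyᵗ ⟧ (h ∷ [])
    Level s = V s × ⟦ levelᵗ ⟧ (s ∷ [])

    history-transitive : ∀ {h} → V h → History h → ∀ t → t ϵ h → Transitive t
    history-transitive Vh H = ϵ-induction _ λ t IH th y z yt zy →
      let Vt = V-ϵ Vh th
          u , uh , ut , y⊆u = proj₁ (H t th y (V-ϵ Vt yt)) yt in
      proj₂ (H t th z (V-ϵ (V-ϵ Vt yt) zy)) (u , uh , ut , λ w → IH u ut uh z w (y⊆u z zy))

    level-transitive : ∀ s → Level s → Transitive s
    level-transitive s (Vs , h , Vh , H , acc) y z ys zy =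
      let t , th , y⊆t = proj₁ (acc y (V-ϵ Vs ys)) ys in
      proj₂ (acc z (V-ϵ (V-ϵ Vs ys) zy)) (t , th , λ w → history-transitive Vh H t th z w (y⊆t z zy))

    level-⊆ : ∀ {s x y} → Level s → y ϵ s → V x → x ⊆ y → x ϵ s
    level-⊆ (Vs , h , Vh , H , acc) ys Vx x⊆y =
      let t , th , y⊆t = proj₁ (acc _ (V-ϵ Vs ys)) ys in
      proj₂ (acc _ Vx) (t , th , λ w m → y⊆t w (x⊆y w m))

    -- The intersection of `h` with `t` is a history for `t`: since `t` is transitive, a member `s`
    -- of the intersection has the same predecessors in it as in `h`.
    history-level : ∀ {h t} → V h → History h → t ϵ h → Level t
    history-level {h} {t} Vh H th =
      let Vt = V-ϵ Vh th
          k , Vk , hk = sep (v0 ∈ᵗ con t Vt) Vh in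
      Vt , k , Vk ,
      (λ s sk z Vz → let sh , st = to (hk s) sk in
        (λ m → let u , uh , us , z⊆u = proj₁ (H s sh z Vz) m in
           u , from (hk u) (uh , history-transitive Vh H t th s u st us) , us , z⊆u) ,
        (λ (u , uk , us , z⊆u) → proj₂ (H s sh z Vz) (u , proj₁ (to (hk u) uk) , us , z⊆u))) ,
      (λ z Vz →
        (λ m → let u , uh , ut , z⊆u = proj₁ (H t th z Vz) m in u , from (hk u) (uh , ut) , z⊆u) ,
        (λ (u , uk , z⊆u) → let uh , ut = to (hk u) uk in proj₂ (H t th z Vz) (u , uh , ut , z⊆u)))

    level-below : ∀ {s x} → Level s → x ϵ s → ∃[ t ] (Level t × t ϵ s × x ⊆ t)
    level-below (Vs , h , Vh , H , acc) xs =
      let t , th , x⊆t = proj₁ (acc _ (V-ϵ Vs xs)) xs in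
      t , history-level Vh H th , proj₂ (acc t (V-ϵ Vh th)) (t , th , λ _ m → m) , x⊆t

    -- Levels with the same levels as members are equal, because each element of a level is included
    -- in some level that belongs to it, and levels are closed under subsets lying in V.
    level-compare : ∀ s t → Level s → Level t → s ϵ t ⊎ s ≈ t ⊎ t ϵ s
    level-compare = trichotomy lem Level level-transitive λ s t Ls Lt p q →
      ext (half Ls Lt p) (half Lt Ls q)
      where
      half : ∀ {s t} → Level s → Level t → (∀ u → Level u → u ϵ s → u ϵ t) → s ⊆ t
      half Ls Lt p x xs = let u , Lu , us , x⊆u = level-below Ls xs in
        level-⊆ Lt (p u Lu us) (V-ϵ (proj₁ Ls) xs) x⊆u

    least-level : (P : 𝕊 → Set₁) → ∀ s → Level s → P s →
      ∃[ s ] (Level s × P s × (∀ t → Level t → P t → s ⊆ t))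
    least-level P = ϵ-induction _ λ s IH Ls Ps → search s IH Ls Ps
      where
      Least : Set₁
      Least = ∃[ s ] (Level s × P s × (∀ t → Level t → P t → s ⊆ t))
      search : ∀ s → (∀ t → t ϵ s → Level t → P t → Least) → Level s → P s → Least
      search s IH Ls Ps with lem {∃[ t ] (t ϵ s × Level t × P t)}
      ... | yes (t , ts , Lt , Pt) = IH t ts Lt Pt
      ... | no none = s , Ls , Ps , λ t Lt Pt → minimal t Lt Pt (level-compare s t Ls Lt)
        where
        minimal : ∀ t → Level t → P t → s ϵ t ⊎ s ≈ t ⊎ t ϵ s → s ⊆ t
        minimal t Lt Pt (inj₁ st)        z zs = level-transitive t Lt s z st zs
        minimal t Lt Pt (inj₂ (inj₁ e))  z zs = ϵ-respʳ e zs
        minimal t Lt Pt (inj₂ (inj₂ ts)) z zs = ⊥-elim (none (t , ts , Lt , Pt))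

    -- Scott's trick: the least level s with F(x, s) is unique, so replacement applies.
    leastᵗ : Fo 2 → Fo 2
    leastᵗ F = app levelᵗ (v1 ∷ []) ∧ᵗ F ∧ᵗ
      ∀V (app levelᵗ (v0 ∷ []) ⇒ᵗ app F (v1 ∷ v0 ∷ []) ⇒ᵗ subᵗ v2 v0)

    least-levels : (F : Fo 2) → ∀ {a} → V a → ∃[ H ] (V H × (∀ s → s ϵ H → Level s) ×
      (∀ x → x ϵ a → (∃[ s ] (Level s × ⟦ F ⟧ (x ∷ s ∷ []))) → ∃[ s ] (s ϵ H × ⟦ F ⟧ (x ∷ s ∷ []))))
    least-levels F Va =
      let H , VH , hH = repl (leastᵗ F) Va
            (λ x s t _ Vs Vt (Ls , Fs , ms) (Lt , Ft , mt) → ext (ms t Vt Lt Ft) (mt s Vs Ls Fs)) in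
      H , VH , (λ s m → let _ , _ , Ls , _ = to (hH s (V-ϵ VH m)) m in V-ϵ VH m , Ls) ,
      λ x xa (s , Ls , Fs) →
        let t , (Vt , Lt) , Ft , mt = least-level (λ s → ⟦ F ⟧ (x ∷ s ∷ [])) s Ls Fs in
        t , from (hH t Vt) (x , xa , Lt , Ft , λ s Vs Ls Fs → mt s (Vs , Ls) Fs) , Ft

    -- The new history consists of the levels found in `H` or in its union. Adding the union closes
    -- it downwards: a level inside one of its members is again a member, so each member finds its
    -- own sublevels there. The required level collects the subsets of the members of this history.
    level-of-levels : ∀ {H} → V H → (∀ s → s ϵ H → Level s) → ∃[ s ] (Level s ×
      (∀ x t → V x → t ϵ H → x ⊆ t → x ϵ s))
    level-of-levels {H} VH LH =
      V-⋃ VH ▹ λ (U , VU , hU) →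
      V-⋃ (V-up VH VU) ▹ λ (W , VW , hW) →
      sep levelᵗ VW ▹ λ (h , Vh , hh) →
      V-⋃ Vh ▹ λ (u , Vu , hu) →
      V-𝒫 Vu ▹ λ (p , Vp , hp) →
      sep (∃∈ (con h Vh) (subᵗ v1 v0)) Vp ▹ λ (s , Vs , hs) →
      build U hU W VW hW h Vh hh s Vs
        (λ z Vz → mk⇔ (λ m → proj₂ (to (hs z) m))
          (λ (t , th , z⊆t) → from (hs z) (from (hp z Vz) (λ w m → from (hu w) (t , th , z⊆t w m)) , t , th , z⊆t)))
      where
      build : ∀ U → (∀ z → z ϵ U ⇔ (∃[ y ] (y ϵ H × z ϵ y))) →
        ∀ W → V W → (∀ z → z ϵ W ⇔ (∃[ y ] (y ϵ ⟅ H , U ⟆ × z ϵ y))) →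
        ∀ h → V h → (∀ x → x ϵ h ⇔ (x ϵ W × ⟦ levelᵗ ⟧ (x ∷ []))) →
        ∀ s → V s → (∀ z → V z → z ϵ s ⇔ (∃[ t ] (t ϵ h × z ⊆ t))) →
        ∃[ s ] (Level s × (∀ x t → V x → t ϵ H → x ⊆ t → x ϵ s))
      build U hU W VW hW h Vh hh s Vs hs =
        s , (Vs , h , Vh , history , λ z Vz → to (hs z Vz) , from (hs z Vz)) ,
        λ x t Vx tH x⊆t → from (hs x Vx) (t , from (hh t) (inH tH , proj₂ (LH t tH)) , x⊆t)
        where
        inH : ∀ {t} → t ϵ H → t ϵ W
        inH m = from (hW _) (H , ϵ-upˡ ≈-refl , m)
        inU : ∀ {t} → t ϵ U → t ϵ W
        inU m = from (hW _) (U , ϵ-upʳ ≈-refl , m)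
        inW : ∀ {t r} → t ϵ W → r ϵ t → r ϵ U
        inW tW rt with to (hW _) tW
        ... | w , wHU , tw with ϵ-up⁻ wHU
        ...   | inj₁ e = from (hU _) (_ , ϵ-respʳ e tw , rt)
        ...   | inj₂ e with to (hU _) (ϵ-respʳ e tw)
        ...     | t₀ , t₀H , tt₀ = from (hU _) (t₀ , t₀H , level-transitive t₀ (LH t₀ t₀H) _ _ tt₀ rt)
        down : ∀ {t r} → t ϵ W → Level r → r ϵ t → r ϵ h
        down tW Lr rt = from (hh _) (inU (inW tW rt) , proj₂ Lr)
        history : History h
        history t th z Vz =
          to (hh t) th ▹ λ (tW , Lt) →
          (λ m → level-below (V-ϵ VW tW , Lt) m ▹ λ (r , Lr , rt , z⊆r) → r , down tW Lr rt , rt , z⊆r) ,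
          (λ (r , rh , rt , z⊆r) → level-⊆ (V-ϵ VW tW , Lt) rt Vz z⊆r)

    -- By induction each member of `x` is included in some level. The least such levels form a set
    -- by replacement, and one level above them all contains every member of `x`.
    in-level : ∀ x → V x → ∃[ s ] (Level s × x ⊆ s)
    in-level = ϵ-induction _ λ x IH Vx →
      least-levels (subᵗ v0 v1) Vx ▹ λ (H , VH , LH , hH) →
      level-of-levels VH LH ▹ λ (s , Ls , hs) →
      s , Ls , λ y yx →
        hH y yx (IH y yx (V-ϵ Vx yx)) ▹ λ (t , tH , y⊆t) → hs y t (V-ϵ Vx yx) tH y⊆t

  -- A witness for `x` is not a function of `x`, but the least level that includes some witness is.
  -- Replacement gathers these levels, and the power set of their union contains a witness for each
  -- `x`.
  collection : (F : Fo 2) → ∀ {a} → V a → ∃[ b ] (V b ×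
    (∀ x → x ϵ a → (∃[ y ] (V y × ⟦ F ⟧ (x ∷ y ∷ []))) → ∃[ y ] (y ϵ b × ⟦ F ⟧ (x ∷ y ∷ []))))
  collection F Va =
    least-levels (∃V (subᵗ v0 v2 ∧ᵗ app F (v1 ∷ v0 ∷ []))) Va ▹ λ (H , VH , LH , hH) →
    V-⋃ VH ▹ λ (U , VU , hU) →
    V-𝒫 VU ▹ λ (p , Vp , hp) →
    p , Vp , λ x xa (y , Vy , Fxy) →
      in-level y Vy ▹ λ (s , Ls , y⊆s) →
      hH x xa (s , Ls , y , Vy , y⊆s , Fxy) ▹ λ (t , tH , y′ , Vy′ , y′⊆t , Fxy′) →
      y′ , from (hp y′ Vy′) (λ w m → from (hU w) (t , tH , y′⊆t w m)) , Fxy′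

  IsGraph : (I h : 𝕊) → (𝕊 → 𝕊 → Set₁) → Set₁
  IsGraph I h Q = (∀ p → p ϵ h → ∃[ i ] ∃[ w ] (i ϵ I × Q i w × p ≈ ⟨ i , w ⟩)) ×
    (∀ i → i ϵ I → ∃[ w ] ⟨ i , w ⟩ ϵ h) ×
    (∀ i w w′ → ⟨ i , w ⟩ ϵ h → ⟨ i , w′ ⟩ ϵ h → w ≈ w′)

  -- Choice in V selects from pairwise disjoint nonempty sets. Collection bounds the values, and the
  -- fibres of the resulting relation, taken as sets of pairs, are disjoint because their members
  -- show the index in the first component.
  choice-function : (Q : Fo 2) → ∀ {I} → V I → (∀ i → i ϵ I → ∃[ w ] (V w × ⟦ Q ⟧ (i ∷ w ∷ []))) →
    ∃[ h ] (V h × IsGraph I h (λ i w → ⟦ Q ⟧ (i ∷ w ∷ [])))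
  choice-function Q {I} VI some =
    collection Q VI ▹ λ (b , Vb , hb) →
    product VI Vb ▹ λ (c , Vc , hc) →
    choose c Vc λ i iI → hb i iI (some i iI) ▹ λ (w , wb , q) → w , q , from (hc _) (i , w , iI , wb , ≈-refl)
    where
    choose : ∀ c → V c → (∀ i → i ϵ I → ∃[ w ] (⟦ Q ⟧ (i ∷ w ∷ []) × ⟨ i , w ⟩ ϵ c)) →
      ∃[ h ] (V h × IsGraph I h (λ i w → ⟦ Q ⟧ (i ∷ w ∷ [])))
    choose c Vc some′ =
      repl fibreᵗ VI (λ i E E′ _ VE VE′ h h′ → fibre-unique ≈-refl VE VE′ h h′) ▹ λ (a , Va , ha) →
      ZFC.choice (IsModelOfSetTheory.zfc model) a Va (inhabited ha) (disjoint ha) ▹ λ (d , Vd , hd) →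
      -- The selector `d` may contain anything outside the fibres, so it is cut down to the pairs
      -- that lie in some fibre.
      sep (v0 ∈ᵗ con d Vd ∧ᵗ ∃∈ (con a Va) (v1 ∈ᵗ v0)) Vc ▹ λ (h , Vh , hh) →
      h , Vh , result Va ha hd hh
      where
      fibreᵗ : Fo 2
      fibreᵗ = ∀V ((v0 ∈ᵗ v2) ⇔ᵗ ((v0 ∈ᵗ con c Vc) ∧ᵗ ∃V (v1 ≐ᵗ ⟨ v2 , v0 ⟩ᵗ ∧ᵗ app Q (v2 ∷ v0 ∷ []))))

      Fibre : 𝕊 → 𝕊 → Set₁
      Fibre i E = ⟦ fibreᵗ ⟧ (i ∷ E ∷ [])

      fibre-unique : ∀ {i i′ E E′} → i ≈ i′ → V E → V E′ → Fibre i E → Fibre i′ E′ → E ≈ E′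
      fibre-unique {i} {i′} {E} {E′} e VE VE′ h h′ = V-ext VE VE′ (λ z Vz → mk⇔
          (λ m → proj₂ (h″ z Vz) (proj₁ (h z Vz) m)) (λ m → proj₂ (h z Vz) (proj₁ (h″ z Vz) m)))
        where
        h″ : Fibre i E′
        h″ = ⟦⟧-resp fibreᵗ (≈-sym e ∷ ≈-refl ∷ []) h′

      fibre : ∀ i → i ϵ I → ∃[ E ] (V E × Fibre i E)
      fibre i iI =
        sep (∃V (v1 ≐ᵗ ⟨ con i (V-ϵ VI iI) , v0 ⟩ᵗ ∧ᵗ app Q (con i (V-ϵ VI iI) ∷ v0 ∷ []))) Vc ▹ λ (E , VE , hE) →
        E , VE , λ p Vp → to (hE p) , from (hE p)

      in-fibre : ∀ {i E p} → V E → Fibre i E → p ϵ E → ∃[ w ] (⟦ Q ⟧ (i ∷ w ∷ []) × p ≈ ⟨ i , w ⟩)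
      in-fibre VE hE pE = proj₁ (hE _ (V-ϵ VE pE)) pE ▹ λ (_ , w , _ , e , q) → w , q , e

      Fibres : 𝕊 → Set₁
      Fibres a = ∀ E → V E → E ϵ a ⇔ (∃[ i ] (i ϵ I × Fibre i E))

      inhabited : ∀ {a} → Fibres a → ∀ E → V E → E ∈ a → ∃[ p ] (V p × p ∈ E)
      inhabited ha E VE Ea =
        to (ha E VE) (↑∈ Ea) ▹ λ (i , iI , hE) →
        some′ i iI ▹ λ (w , q , m) →
        ⟨ i , w ⟩ , V-ϵ Vc m ,
        ↓∈ (proj₂ (hE ⟨ i , w ⟩ (V-ϵ Vc m)) (m , w , proj₂ (V-pair⁻ (V-ϵ Vc m)) , ≈-refl , q))

      disjoint : ∀ {a} → Fibres a → ∀ E E′ p → V E → V E′ → V p →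
        E ∈ a → E′ ∈ a → p ∈ E → p ∈ E′ → E ≐ E′
      disjoint ha E E′ p VE VE′ Vp Ea E′a pE pE′ =
        to (ha E VE) (↑∈ Ea) ▹ λ (i , iI , hE) →
        to (ha E′ VE′) (↑∈ E′a) ▹ λ (i′ , i′I , hE′) →
        in-fibre VE hE (↑∈ pE) ▹ λ (w , q , e) →
        in-fibre VE′ hE′ (↑∈ pE′) ▹ λ (w′ , q′ , e′) →
        ↓≐ (fibre-unique (proj₁ (pair-injective (≈-trans (≈-sym e) e′))) VE VE′ hE hE′)

      result : ∀ {a d h} → V a → Fibres a →
        (∀ x → V x → x ∈ a → ∃[ y ] (V y × y ∈ x × y ∈ d × (∀ z → V z → z ∈ x → z ∈ d → z ≐ y))) →
        (∀ p → p ϵ h ⇔ (p ϵ c × p ϵ d × ∃[ E ] (E ϵ a × p ϵ E))) →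
        IsGraph I h (λ i w → ⟦ Q ⟧ (i ∷ w ∷ []))
      result {a} {d} {h} Va ha hd hh = graph , total , unique
        where
        graph : ∀ p → p ϵ h → ∃[ i ] ∃[ w ] (i ϵ I × ⟦ Q ⟧ (i ∷ w ∷ []) × p ≈ ⟨ i , w ⟩)
        graph p ph =
          to (hh p) ph ▹ λ (_ , _ , E , Ea , pE) →
          to (ha E (V-ϵ Va Ea)) Ea ▹ λ (i , iI , hE) →
          in-fibre (V-ϵ Va Ea) hE pE ▹ λ (w , q , e) →
          i , w , iI , q , e

        total : ∀ i → i ϵ I → ∃[ w ] ⟨ i , w ⟩ ϵ h
        total i iI =
          fibre i iI ▹ λ (E , VE , hE) →
          from (ha E VE) (i , iI , hE) ▹ λ Ea →
          hd E VE (↓∈ Ea) ▹ λ (p , Vp , pE , pd , _) →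
          in-fibre VE hE (↑∈ pE) ▹ λ (w , q , e) →
          w , ϵ-respˡ e (from (hh p) (proj₁ (proj₁ (hE p Vp) (↑∈ pE)) , ↑∈ pd , E , Ea , ↑∈ pE))

        unique : ∀ i w w′ → ⟨ i , w ⟩ ϵ h → ⟨ i , w′ ⟩ ϵ h → w ≈ w′
        unique i w w′ m m′ =
          to (hh _) m ▹ λ (_ , wd , E , Ea , wE) →
          to (hh _) m′ ▹ λ (_ , w′d , E′ , E′a , w′E′) →
          V-ϵ Va Ea ▹ λ VE →
          V-ϵ Va E′a ▹ λ VE′ →
          to (ha E VE) Ea ▹ λ (i₁ , i₁I , hE) →
          to (ha E′ VE′) E′a ▹ λ (i₂ , i₂I , hE′) →
          in-fibre VE hE wE ▹ λ (_ , _ , e₁) →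
          in-fibre VE′ hE′ w′E′ ▹ λ (_ , _ , e₂) →
          fibre-unique (≈-trans (≈-sym (proj₁ (pair-injective e₁))) (proj₁ (pair-injective e₂))) VE VE′ hE hE′ ▹ λ E≈E′ →
          ϵ-respʳ (≈-sym E≈E′) w′E′ ▹ λ w′E →
          hd E VE (↓∈ Ea) ▹ λ (p , Vp , pE , pd , only) →
          proj₂ (pair-injective (≈-trans (↑≐ (only ⟨ i , w ⟩ (V-ϵ VE wE) (↓∈ wE) (↓∈ wd)))
            (≈-sym (↑≐ (only ⟨ i , w′ ⟩ (V-ϵ VE w′E) (↓∈ w′E) (↓∈ w′d))))))

-- Inductive definitions over V by self-justifying sets, and tuples.

module Derivations (lem : ExcludedMiddle 1ℓ) (V : Class) (model : IsModelOfSetTheory V) where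
  open Collection lem V model public

  -- A formula J(w, W) says that w follows from the members of W; w is derivable
  -- when it belongs to a set each of whose members follows from that set.
  derᵗ : Fo 2 → Fo 1
  derᵗ J = ∃V ((v1 ∈ᵗ v0) ∧ᵗ ∀∈ v0 (app J (v0 ∷ v1 ∷ [])))

  Der : Fo 2 → 𝕊 → Set₁
  Der J w = ⟦ derᵗ J ⟧ (w ∷ [])

  Monotone : Fo 2 → Set₁
  Monotone J = ∀ w W W′ → W ⊆ W′ → ⟦ J ⟧ (w ∷ W ∷ []) → ⟦ J ⟧ (w ∷ W′ ∷ [])

  Der-resp : ∀ J {w w′} → w ≈ w′ → Der J w → Der J w′
  Der-resp J e = ⟦⟧-resp (derᵗ J) (e ∷ [])

  Der⇒V : ∀ J {w} → Der J w → V w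
  Der⇒V J (W , VW , m , _) = V-ϵ VW m

  der-inversion : ∀ J {w} → Der J w → ∃[ W ] (⟦ J ⟧ (w ∷ W ∷ []) × (∀ p → p ϵ W → Der J p))
  der-inversion J {w} (W , VW , m , closed) = W , closed w m , λ p k → W , VW , k , closed

  -- Each premise has its own self-justifying set. Collection yields a set containing one for each
  -- premise, perhaps among other sets, which separation discards. By monotonicity the union of the
  -- rest justifies itself, and it still does after `w` is adjoined.
  der-intro : ∀ J → Monotone J → ∀ {w P} → V w → V P → (∀ p → p ϵ P → Der J p) →
    ⟦ J ⟧ (w ∷ P ∷ []) → Der J w
  der-intro J mono {w} {P} Vw VP dP j =
    collection ((v0 ∈ᵗ v1) ∧ᵗ ∀∈ v1 (app J (v0 ∷ v2 ∷ []))) VP ▹ λ (b , Vb , hb) →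
    sep (∀∈ v0 (app J (v0 ∷ v1 ∷ []))) Vb ▹ λ (c , Vc , hc) →
    V-⋃ Vc ▹ λ (U , VU , hU) →
    V-⋃ (V-up VU (V-up Vw Vw)) ▹ λ (W , VW , hW) →
    W , VW , from (hW w) (⟅ w , w ⟆ , ϵ-upʳ ≈-refl , ϵ-upˡ ≈-refl) ,
    λ p pW → to (hW p) pW ▹ λ (y , m , py) → [
      (λ e → to (hU p) (ϵ-respʳ e py) ▹ λ (Q , Qc , pQ) →
        mono p Q W (λ z zQ → from (hW z) (U , ϵ-upˡ ≈-refl , from (hU z) (Q , Qc , zQ)))
          (proj₂ (to (hc Q) Qc) p pQ)) ,
      (λ e → ⟦⟧-resp J (≈-sym ([ id , id ]′ (ϵ-up⁻ (ϵ-respʳ e py))) ∷ ≈-refl ∷ [])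
        (mono w P W (λ z zP → hb z zP (dP z zP) ▹ λ (Q , Qb , zQ , closed) →
          from (hW z) (U , ϵ-upˡ ≈-refl , from (hU z) (Q , from (hc Q) (Qb , closed) , zQ))) j)) ]′ (ϵ-up⁻ m)

  der-intro₀ : ∀ J → Monotone J → ∀ {w} → V w → ⟦ J ⟧ (w ∷ ∅ ∷ []) → Der J w
  der-intro₀ J mono Vw = der-intro J mono Vw V-∅ (λ p m → ⊥-elim (∉∅ m))

  der-intro₁ : ∀ J → Monotone J → ∀ {w p} → V w → Der J p → ⟦ J ⟧ (w ∷ ⟅ p , p ⟆ ∷ []) → Der J w
  der-intro₁ J mono Vw d = der-intro J mono Vw (V-up (Der⇒V J d) (Der⇒V J d))
    (λ p m → Der-resp J (≈-sym ([ id , id ]′ (ϵ-up⁻ m))) d)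

  V-tuple : ∀ {n} {xs : Vec 𝕊 n} → All V xs → V (tuple xs)
  V-tuple []        = V-∅
  V-tuple (Vx ∷ Vs) = V-pair Vx (V-tuple Vs)

  V-lookup : ∀ {n} {xs : Vec 𝕊 n} → All V xs → ∀ i → V (lookup xs i)
  V-lookup (Vx ∷ Vs) zero    = Vx
  V-lookup (Vx ∷ Vs) (suc i) = V-lookup Vs i

  -- Rules for facts `⟨ i , ⟨ t , x ⟩ ⟩`, where `x` is the entry of the nested pair `t` at index
  -- `i`. Tuples of all lengths occur in one definition of satisfaction, so projection has to be a
  -- single definable relation and not a term for each index.
  lookupᵗ : Fo 2
  lookupᵗ = ∃V (∃V (v2 ≐ᵗ ⟨ ∅ᵗ , ⟨ ⟨ v1 , v0 ⟩ᵗ , v1 ⟩ᵗ ⟩ᵗ)) ∨ᵗ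
    ∃V (∃V (∃V (∃V (v4 ≐ᵗ ⟨ v3 ⁺ᵗ , ⟨ ⟨ v2 , v1 ⟩ᵗ , v0 ⟩ᵗ ⟩ᵗ ∧ᵗ ⟨ v3 , ⟨ v1 , v0 ⟩ᵗ ⟩ᵗ ∈ᵗ v5))))

  lookup-mono : Monotone lookupᵗ
  lookup-mono w W W′ s = map⊎₂ λ (i , Vi , y , Vy , t , Vt , x , Vx , e , m) → i , Vi , y , Vy , t , Vt , x , Vx , e , s _ m

  Lookup : 𝕊 → 𝕊 → 𝕊 → Set₁
  Lookup i t x = Der lookupᵗ ⟨ i , ⟨ t , x ⟩ ⟩

  Lookup-intro : ∀ {n} {xs : Vec 𝕊 n} → All V xs → ∀ i → Lookup (nat (toℕ i)) (tuple xs) (lookup xs i)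
  Lookup-intro (Vx ∷ Vs) zero = der-intro₀ lookupᵗ lookup-mono
    (V-pair V-∅ (V-pair (V-tuple (Vx ∷ Vs)) Vx)) (inj₁ (_ , Vx , _ , V-tuple Vs , ≈-refl))
  Lookup-intro (Vx ∷ Vs) (suc i) = der-intro₁ lookupᵗ lookup-mono
    (V-pair (V-nat (suc (toℕ i))) (V-pair (V-tuple (Vx ∷ Vs)) (V-lookup Vs i))) (Lookup-intro Vs i)
    (inj₂ (_ , V-nat (toℕ i) , _ , Vx , _ , V-tuple Vs , _ , V-lookup Vs i , ≈-refl , ϵ-upˡ ≈-refl))

  Lookup-elim : ∀ {n i t x} (xs : Vec 𝕊 n) → t ≈ tuple xs → Lookup i t x →
    Σ[ j ∈ Fin n ] (i ≈ nat (toℕ j) × x ≈ lookup xs j)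
  Lookup-elim xs e d with der-inversion lookupᵗ d
  Lookup-elim [] e d | W , inj₁ (x , _ , t , _ , p) , _ =
    ⊥-elim (∅≉pair (≈-trans (≈-sym e) (proj₁ (pair-injective (proj₂ (pair-injective p))))))
  Lookup-elim (y ∷ ys) e d | W , inj₁ (x , _ , t , _ , p) , _ =
    pair-injective p ▹ λ (p₁ , p₂) → pair-injective p₂ ▹ λ (p₃ , p₄) →
    zero , p₁ , ≈-trans p₄ (≈-sym (proj₁ (pair-injective (≈-trans (≈-sym e) p₃))))
  Lookup-elim [] e d | W , inj₂ (i , _ , y , _ , t , _ , x , _ , p , m) , dW =
    ⊥-elim (∅≉pair (≈-trans (≈-sym e) (proj₁ (pair-injective (proj₂ (pair-injective p))))))
  Lookup-elim (z ∷ zs) e d | W , inj₂ (i , _ , y , _ , t , _ , x , _ , p , m) , dW =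
    pair-injective p ▹ λ (p₁ , p₂) → pair-injective p₂ ▹ λ (p₃ , p₄) →
    Lookup-elim zs (≈-sym (proj₂ (pair-injective (≈-trans (≈-sym e) p₃)))) (dW _ m) ▹ λ (j , q , r) →
    suc j , ≈-trans p₁ (⁺-cong q) , ≈-trans p₄ r

  lookupsᵗ : Fo 2
  lookupsᵗ = ∃V (v1 ≐ᵗ ⟨ ∅ᵗ , ⟨ ∅ᵗ , ⟨ v0 , ∅ᵗ ⟩ᵗ ⟩ᵗ ⟩ᵗ) ∨ᵗ
    ∃V (∃V (∃V (∃V (∃V (∃V (v6 ≐ᵗ ⟨ v5 ⁺ᵗ , ⟨ ⟨ v4 , v3 ⟩ᵗ , ⟨ v2 , ⟨ v1 , v0 ⟩ᵗ ⟩ᵗ ⟩ᵗ ⟩ᵗ ∧ᵗ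
      app (derᵗ lookupᵗ) (⟨ v4 , ⟨ v2 , v1 ⟩ᵗ ⟩ᵗ ∷ []) ∧ᵗ
      ⟨ v5 , ⟨ v3 , ⟨ v2 , v0 ⟩ᵗ ⟩ᵗ ⟩ᵗ ∈ᵗ v7))))))

  lookups-mono : Monotone lookupsᵗ
  lookups-mono w W W′ s = map⊎₂ λ (k , Vk , i , Vi , v , Vv , t , Vt , x , Vx , u , Vu , e , l , m) →
    k , Vk , i , Vi , v , Vv , t , Vt , x , Vx , u , Vu , e , l , s _ m

  -- v is a k-tuple of indices into the tuple t, and u the tuple of the entries of t there.
  Lookups : 𝕊 → 𝕊 → 𝕊 → 𝕊 → Set₁
  Lookups k v t u = Der lookupsᵗ ⟨ k , ⟨ v , ⟨ t , u ⟩ ⟩ ⟩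

  indices : ∀ {n k} → Vec (Fin n) k → 𝕊
  indices vs = tuple (map (nat ∘ toℕ) vs)

  V-indices : ∀ {n k} (vs : Vec (Fin n) k) → V (indices vs)
  V-indices []       = V-∅
  V-indices (v ∷ vs) = V-pair (V-nat (toℕ v)) (V-indices vs)

  V-lookups : ∀ {n k} {xs : Vec 𝕊 n} → All V xs → (vs : Vec (Fin n) k) → V (tuple (map (lookup xs) vs))
  V-lookups Vxs []       = V-∅
  V-lookups Vxs (v ∷ vs) = V-pair (V-lookup Vxs v) (V-lookups Vxs vs)

  Lookups-intro : ∀ {n k} {xs : Vec 𝕊 n} → All V xs → (vs : Vec (Fin n) k) →
    Lookups (nat k) (indices vs) (tuple xs) (tuple (map (lookup xs) vs))
  Lookups-intro Vxs [] = der-intro₀ lookupsᵗ lookups-mono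
    (V-pair V-∅ (V-pair V-∅ (V-pair (V-tuple Vxs) V-∅))) (inj₁ (_ , V-tuple Vxs , ≈-refl))
  Lookups-intro {k = suc k} Vxs (v ∷ vs) = der-intro₁ lookupsᵗ lookups-mono
    (V-pair (V-nat (suc k)) (V-pair (V-indices (v ∷ vs)) (V-pair (V-tuple Vxs) (V-lookups Vxs (v ∷ vs)))))
    (Lookups-intro Vxs vs)
    (inj₂ (_ , V-nat k , _ , V-nat (toℕ v) , _ , V-indices vs , _ , V-tuple Vxs , _ , V-lookup Vxs v ,
      _ , V-lookups Vxs vs , ≈-refl , Lookup-intro Vxs v , ϵ-upˡ ≈-refl))

  Lookups-elim : ∀ {n k v t u} m (xs : Vec 𝕊 n) → k ≈ nat m → t ≈ tuple xs → Lookups k v t u →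
    Σ[ vs ∈ Vec (Fin n) m ] (v ≈ indices vs × u ≈ tuple (map (lookup xs) vs))
  Lookups-elim m xs ek et d with der-inversion lookupsᵗ d
  Lookups-elim zero xs ek et d | W , inj₁ (t , _ , p) , _ =
    pair-injective p ▹ λ (p₁ , p₂) → pair-injective p₂ ▹ λ (p₃ , p₄) →
    [] , p₃ , proj₂ (pair-injective p₄)
  Lookups-elim (suc m) xs ek et d | W , inj₁ (t , _ , p) , _ =
    ⊥-elim (∅≉⁺ (≈-trans (≈-sym (proj₁ (pair-injective p))) ek))
  Lookups-elim zero xs ek et d | W , inj₂ (k , _ , i , _ , v , _ , t , _ , x , _ , u , _ , p , l , q) , dW =
    ⊥-elim (∅≉⁺ (≈-trans (≈-sym ek) (proj₁ (pair-injective p))))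
  Lookups-elim (suc m) xs ek et d | W , inj₂ (k , _ , i , _ , v , _ , t , _ , x , _ , u , _ , p , l , q) , dW =
    pair-injective p ▹ λ (p₁ , p₂) → pair-injective p₂ ▹ λ (p₃ , p₄) → pair-injective p₄ ▹ λ (p₅ , p₆) →
    ≈-trans (≈-sym p₅) et ▹ λ et′ →
    Lookups-elim m xs (⁺-injective (≈-trans (≈-sym p₁) ek)) et′ (dW _ q) ▹ λ (vs , r₁ , r₂) →
    Lookup-elim xs et′ l ▹ λ (j , r₃ , r₄) →
    j ∷ vs , ≈-trans p₃ (pair-cong r₃ r₁) , ≈-trans p₆ (pair-cong r₄ r₂)

  module Tuples (X : 𝕊) (VX : V X) where

    tuplesᵗ : Fo 2
    tuplesᵗ = v0 ≐ᵗ ⟨ ∅ᵗ , ∅ᵗ ⟩ᵗ ∨ᵗ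
      ∃V (∃V (∃V (v3 ≐ᵗ ⟨ v2 ⁺ᵗ , ⟨ v1 , v0 ⟩ᵗ ⟩ᵗ ∧ᵗ v1 ∈ᵗ con X VX ∧ᵗ ⟨ v2 , v0 ⟩ᵗ ∈ᵗ v4)))

    tuples-mono : Monotone tuplesᵗ
    tuples-mono w W W′ s = map⊎₂ λ (k , Vk , x , Vx , t , Vt , e , l , m) → k , Vk , x , Vx , t , Vt , e , l , s _ m

    IsTuple : 𝕊 → 𝕊 → Set₁
    IsTuple k t = Der tuplesᵗ ⟨ k , t ⟩

    ∈X⇒V : ∀ {n} {xs : Vec 𝕊 n} → All (_∈ X) xs → All V xs
    ∈X⇒V = All.map (λ m → V-ϵ VX (↑∈ m))

    IsTuple-intro : ∀ {n} {xs : Vec 𝕊 n} → All (_∈ X) xs → IsTuple (nat n) (tuple xs)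
    IsTuple-intro [] = der-intro₀ tuplesᵗ tuples-mono (V-pair V-∅ V-∅) (inj₁ ≈-refl)
    IsTuple-intro {suc n} (m ∷ ms) = der-intro₁ tuplesᵗ tuples-mono
      (V-pair (V-nat (suc n)) (V-tuple (∈X⇒V (m ∷ ms)))) (IsTuple-intro ms)
      (inj₂ (_ , V-nat n , _ , V-ϵ VX (↑∈ m) , _ , V-tuple (∈X⇒V ms) , ≈-refl , ↑∈ m , ϵ-upˡ ≈-refl))

    IsTuple-elim : ∀ {k t} n → k ≈ nat n → IsTuple k t → Σ[ xs ∈ Vec 𝕊 n ] (All (_∈ X) xs × t ≈ tuple xs)
    IsTuple-elim n ek d with der-inversion tuplesᵗ d
    IsTuple-elim zero    ek d | W , inj₁ p , _ = [] , [] , proj₂ (pair-injective p)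
    IsTuple-elim (suc n) ek d | W , inj₁ p , _ =
      ⊥-elim (∅≉⁺ (≈-trans (≈-sym (proj₁ (pair-injective p))) ek))
    IsTuple-elim zero    ek d | W , inj₂ (k , _ , x , _ , t , _ , p , l , m) , dW =
      ⊥-elim (∅≉⁺ (≈-trans (≈-sym ek) (proj₁ (pair-injective p))))
    IsTuple-elim (suc n) ek d | W , inj₂ (k , _ , x , _ , t , _ , p , l , m) , dW =
      pair-injective p ▹ λ (p₁ , p₂) →
      IsTuple-elim n (⁺-injective (≈-trans (≈-sym p₁) ek)) (dW _ m) ▹ λ (xs , ms , q) →
      x ∷ xs , ↓∈ l ∷ ms , ≈-trans p₂ (pair-cong ≈-refl q)

-- Satisfaction of infinitary formulas, defined inside V.

sign : Bool → 𝕊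
sign true  = nat 1
sign false = nat 0

Signed : Bool → Set₁ → Set₁
Signed true  P = P
Signed false P = ¬ P

indices-injective : ∀ {n k} (vs us : Vec (Fin n) k) →
  tuple (map (nat ∘ toℕ) vs) ≈ tuple (map (nat ∘ toℕ) us) → vs ≡ us
indices-injective []       []       _ = refl
indices-injective (v ∷ vs) (u ∷ us) e = pair-injective e ▹ λ (p , q) →
  cong₂ _∷_ (toℕ-injective (nat-injective p)) (indices-injective vs us q)

-- The element `x₀` serves as the parameter of a contradictory literal, from which a code of the
-- empty class is made.
record Setting : Set₂ where
  field
    lem        : ExcludedMiddle 1ℓ
    V          : Class
    model      : IsModelOfSetTheory V
    κ X L      : 𝕊
    Vκ         : V κ
    VX         : V X
    VL         : V L
    language   : IsLanguage L
    κ-ordinal  : IsOrdinal κ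
    κ-infinite : Infinite κ
    card-X     : Card≤ V X κ
    x₀         : 𝕊
    x₀ϵX       : x₀ ϵ X

module Satisfaction (setting : Setting) where
  open Setting setting public
  open Derivations lem V model public
  open Tuples X VX public
  module Language = IsLanguage language

  by-contradiction : ∀ {P : Set₁} → ¬ ¬ P → P
  by-contradiction {P} ¬¬p with lem {P}
  ... | yes p = p
  ... | no ¬p = ⊥-elim (¬¬p ¬p)

  Formula : ℕ → 𝕊 → Set₁
  Formula = Fm V L X κ

  infix 4 _⊨⟨_⟩_
  _⊨⟨_⟩_ : 𝕊 → ∀ {n φ} → Formula n φ → Vec 𝕊 n → Set₁
  N ⊨⟨ d ⟩ xs = _⊨_[_] V L X κ N d xs

  indices-def : ∀ {n k} (vs : Vec (Fin n) k) → indices vs ≡ D.tuple (map (D.nat ∘ toℕ) vs)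
  indices-def []       = tuple-def []
  indices-def (v ∷ vs) = trans ⟨⟩-def (cong₂ D.⟨_,_⟩ (nat-def (toℕ v)) (indices-def vs))

  symbol⁺ : ∀ R k → D.⟨ R , D.nat k ⟩ ∈ L → ⟨ R , nat k ⟩ ϵ L
  symbol⁺ R k m = subst (λ n → ⟨ R , n ⟩ ϵ L) (sym (nat-def k)) (pair∈⁺ R (D.nat k) m)

  symbol⁻ : ∀ R k → ⟨ R , nat k ⟩ ϵ L → D.⟨ R , D.nat k ⟩ ∈ L
  symbol⁻ R k m = pair∈⁻ R (D.nat k) (subst (λ n → ⟨ R , n ⟩ ϵ L) (nat-def k) m)

  rel⁺ : ∀ {φ n k} R (vs : Vec (Fin n) k) → φ ≐ D.tag 0 D.⟨ R , D.tuple (map (D.nat ∘ toℕ) vs) ⟩ →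
    φ ≈ tag 0 ⟨ R , indices vs ⟩
  rel⁺ R vs e = ≈-trans (tag⁺ 0 _ e)
    (≈-reflexive (cong (tag 0) (sym (trans ⟨⟩-def (cong D.⟨ R ,_⟩ (indices-def vs))))))

  eq⁺ : ∀ {φ n} (i j : Fin n) → φ ≐ D.tag 1 D.⟨ D.nat (toℕ i) , D.nat (toℕ j) ⟩ →
    φ ≈ tag 1 ⟨ nat (toℕ i) , nat (toℕ j) ⟩
  eq⁺ i j e = ≈-trans (tag⁺ 1 _ e)
    (≈-reflexive (cong (tag 1) (sym (trans ⟨⟩-def (cong₂ D.⟨_,_⟩ (nat-def (toℕ i)) (nat-def (toℕ j)))))))

  Fm⇒V : ∀ {n φ} → Formula n φ → V φ
  Fm⇒V (rel k R vs m e)  = V-resp (≈-sym (rel⁺ R vs e)) (V-tag 0 (V-pair (proj₁ (V-pair⁻ (V-ϵ VL (symbol⁺ R k m)))) (V-indices vs)))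
  Fm⇒V (eq i j e)        = V-resp (≈-sym (eq⁺ i j e)) (V-tag 1 (V-pair (V-nat (toℕ i)) (V-nat (toℕ j))))
  Fm⇒V (neg ψ e d)       = V-resp (≈-sym (tag⁺ 2 ψ e)) (V-tag 2 (Fm⇒V d))
  Fm⇒V (ex ψ e d)        = V-resp (≈-sym (tag⁺ 3 ψ e)) (V-tag 3 (Fm⇒V d))
  Fm⇒V (all ψ e d)       = V-resp (≈-sym (tag⁺ 4 ψ e)) (V-tag 4 (Fm⇒V d))
  Fm⇒V (disj Φ e VΦ _ _) = V-resp (≈-sym (tag⁺ 5 Φ e)) (V-tag 5 VΦ)
  Fm⇒V (conj Φ e VΦ _ _) = V-resp (≈-sym (tag⁺ 6 Φ e)) (V-tag 6 VΦ)

  private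
    -- Case distinction on the numeral that tags a formula. The empty table is a false formula, so
    -- an unknown tag justifies nothing.
    switch : ∀ {n m} → ℕ → Tm n → Vec (Fo n) m → Fo n
    switch j t []       = ¬ᵗ (t ≐ᵗ t)
    switch j t (c ∷ cs) = (t ≐ᵗ natᵗ j ∧ᵗ c) ∨ᵗ switch (suc j) t cs

    eval-nat : ∀ {a} {A : Set a} (ρ : A → 𝕊) n → eval ρ (natᵗ n) ≡ nat n
    eval-nat ρ zero    = refl
    eval-nat ρ (suc n) = cong _⁺ (eval-nat ρ n)

    +-toℕ-suc : ∀ j {m} (i : Fin m) → nat (j + toℕ {suc m} (suc i)) ≈ nat (suc j + toℕ i)
    +-toℕ-suc j i = ≈-reflexive (cong nat (+-suc j (toℕ i)))

    switch-intro : ∀ {n m j ρ t} (cs : Vec (Fo n) m) (i : Fin m) → ev ρ t ≈ nat (j + toℕ i) →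
      ⟦ lookup cs i ⟧ ρ → ⟦ switch j t cs ⟧ ρ
    switch-intro {j = j} {ρ} (c ∷ cs) zero e h =
      inj₁ (≈-trans e (≈-reflexive (trans (cong nat (+-identityʳ j)) (sym (eval-nat (env ρ) j)))) , h)
    switch-intro {j = j} (c ∷ cs) (suc i) e h = inj₂ (switch-intro cs i (≈-trans e (+-toℕ-suc j i)) h)

    switch-elim : ∀ {n m j ρ t} (cs : Vec (Fo n) m) (i : Fin m) → ev ρ t ≈ nat (j + toℕ i) →
      ⟦ switch j t cs ⟧ ρ → ⟦ lookup cs i ⟧ ρ
    switch-elim (c ∷ cs) zero    e (inj₁ (_ , h)) = h
    switch-elim {j = j} {ρ} (c ∷ cs) (suc i) e (inj₁ (e′ , h)) = ⊥-elim (m+1+n≢m j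
      (nat-injective (≈-trans (≈-sym e) (≈-trans e′ (≈-reflexive (eval-nat (env ρ) j))))))
    switch-elim {j = j} {ρ} {t} (c ∷ cs) zero e (inj₂ h) =
      ⊥-elim (later cs (subst (λ i → ⟦ switch (suc i) t cs ⟧ ρ) (sym (+-identityʳ j)) h))
      where
      later : ∀ {m k} (cs : Vec (Fo _) m) → ¬ ⟦ switch (suc j + k) t cs ⟧ ρ
      later         []       h = h ≈-refl
      later {k = k} (c ∷ cs) (inj₁ (e′ , _)) = m≢1+m+n j (trans (sym (+-identityʳ j))
        (nat-injective (≈-trans (≈-sym e) (≈-trans e′ (≈-reflexive (eval-nat (env ρ) (suc j + k)))))))
      later {k = k} (c ∷ cs) (inj₂ h) =
        later {k = suc k} cs (subst (λ i → ⟦ switch (suc i) t cs ⟧ ρ) (sym (+-suc j k)) h)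
    switch-elim {j = j} (c ∷ cs) (suc i) e (inj₂ h) = switch-elim cs i (≈-trans e (+-toℕ-suc j i)) h

    signed : ∀ {n} → Tm n → Fo n → Fo n → Fo n
    signed b F H = (b ≐ᵗ natᵗ 1 ∧ᵗ F) ∨ᵗ (b ≐ᵗ natᵗ 0 ∧ᵗ H)

    choose : Bool → Set₁ → Set₁ → Set₁
    choose true  P Q = P
    choose false P Q = Q

    signed-elim : ∀ {P Q : Set₁} {b} s → b ≈ sign s → (b ≈ nat 1 × P) ⊎ (b ≈ nat 0 × Q) → choose s P Q
    signed-elim true  e (inj₁ (_ , h)) = h
    signed-elim true  e (inj₂ (p , _)) = ⊥-elim (∅≉⁺ (≈-trans (≈-sym p) e))
    signed-elim false e (inj₁ (p , _)) = ⊥-elim (∅≉⁺ (≈-trans (≈-sym e) p))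
    signed-elim false e (inj₂ (_ , h)) = h

    signed-intro : ∀ {P Q : Set₁} s → choose s P Q → (sign s ≈ nat 1 × P) ⊎ (sign s ≈ nat 0 × Q)
    signed-intro true  h = inj₁ (≈-refl , h)
    signed-intro false h = inj₂ (≈-refl , h)

    holdsᵗ : ∀ {n} → Tm n → Tm n → Tm n → Fo n
    holdsᵗ R u N = app (∃V (⟨ v1 , v0 ⟩ᵗ ∈ᵗ v3 ∧ᵗ v2 ∈ᵗ v0)) (R ∷ u ∷ N ∷ [])

    -- Variables: b, N, t, β, k, w, W, where w = ⟨⟨k , β⟩ , ⟨t , ⟨N , b⟩⟩⟩ says that the
    -- truth value of the formula ⟨k , β⟩ at t in N is b.
    clauses : Vec (Fo 7) 7
    clauses =
      ∃V (∃V (∃V (∃V (v7 ≐ᵗ ⟨ v3 , v2 ⟩ᵗ ∧ᵗ ⟨ v3 , v1 ⟩ᵗ ∈ᵗ con L VL ∧ᵗ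
        app (derᵗ lookupsᵗ) (⟨ v1 , ⟨ v2 , ⟨ v6 , v0 ⟩ᵗ ⟩ᵗ ⟩ᵗ ∷ []) ∧ᵗ
        signed v4 (holdsᵗ v3 v0 v5) (¬ᵗ holdsᵗ v3 v0 v5)))))
      ∷ ∃V (∃V (∃V (∃V (v7 ≐ᵗ ⟨ v3 , v2 ⟩ᵗ ∧ᵗ
          app (derᵗ lookupᵗ) (⟨ v3 , ⟨ v6 , v1 ⟩ᵗ ⟩ᵗ ∷ []) ∧ᵗ
          app (derᵗ lookupᵗ) (⟨ v2 , ⟨ v6 , v0 ⟩ᵗ ⟩ᵗ ∷ []) ∧ᵗ
          signed v4 (v1 ≐ᵗ v0) (¬ᵗ (v1 ≐ᵗ v0))))))
      ∷ signed v0 (⟨ v3 , ⟨ v2 , ⟨ v1 , natᵗ 0 ⟩ᵗ ⟩ᵗ ⟩ᵗ ∈ᵗ v6) (⟨ v3 , ⟨ v2 , ⟨ v1 , natᵗ 1 ⟩ᵗ ⟩ᵗ ⟩ᵗ ∈ᵗ v6)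
      ∷ signed v0 (∃∈ (con X VX) instanceᵗ) (∀∈ (con X VX) instanceᵗ)
      ∷ signed v0 (∀∈ (con X VX) instanceᵗ) (∃∈ (con X VX) instanceᵗ)
      ∷ signed v0 (∃∈ v3 memberᵗ) (∀∈ v3 memberᵗ)
      ∷ signed v0 (∀∈ v3 memberᵗ) (∃∈ v3 memberᵗ)
      ∷ []
      where
      instanceᵗ memberᵗ : Fo 8
      instanceᵗ = ⟨ v4 , ⟨ ⟨ v0 , v3 ⟩ᵗ , ⟨ v2 , v1 ⟩ᵗ ⟩ᵗ ⟩ᵗ ∈ᵗ v7
      memberᵗ = ⟨ v0 , ⟨ v3 , ⟨ v2 , v1 ⟩ᵗ ⟩ᵗ ⟩ᵗ ∈ᵗ v7

  -- The truth value is part of the fact. Truth of a negation rests on falsity of its body, falsity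
  -- of a disjunction on falsity of all its members, and so on. No clause mentions the absence of a
  -- fact from the justifying set, which is what `sat-mono` requires.
  satᵗ : Fo 2
  satᵗ = ∃V (∃V (∃V (∃V (∃V (v5 ≐ᵗ ⟨ ⟨ v4 , v3 ⟩ᵗ , ⟨ v2 , ⟨ v1 , v0 ⟩ᵗ ⟩ᵗ ⟩ᵗ ∧ᵗ switch 0 v4 clauses)))))

  private
    switch-mono : ∀ {n m j ρ ρ′} (t : Tm n) (cs : Vec (Fo n) m) → ev ρ t ≡ ev ρ′ t →
      (∀ i → ⟦ lookup cs i ⟧ ρ → ⟦ lookup cs i ⟧ ρ′) → ⟦ switch j t cs ⟧ ρ → ⟦ switch j t cs ⟧ ρ′
    switch-mono t [] e f h = λ _ → h ≈-refl
    switch-mono {j = j} {ρ} {ρ′} t (c ∷ cs) e f (inj₁ (p , h)) =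
      inj₁ (≈-trans (≈-reflexive (sym e)) (≈-trans p (≈-reflexive (trans (eval-nat (env ρ) j) (sym (eval-nat (env ρ′) j))))) , f zero h)
    switch-mono t (c ∷ cs) e f (inj₂ h) = inj₂ (switch-mono t cs e (f ∘ suc) h)

  sat-mono : Monotone satᵗ
  sat-mono w W W′ s (k , Vk , β , Vβ , t , Vt , N , VN , b , Vb , e , h) =
    k , Vk , β , Vβ , t , Vt , N , VN , b , Vb , e ,
    switch-mono {j = 0} {ρ = b ∷ N ∷ t ∷ β ∷ k ∷ w ∷ W ∷ []} {ρ′ = b ∷ N ∷ t ∷ β ∷ k ∷ w ∷ W′ ∷ []} v4 clauses refl
      (λ { 0F → id
         ; 1F → id
         ; 2F → map⊎ (λ (p , h) → p , s _ h) (λ (p , h) → p , s _ h)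
         ; 3F → map⊎ (λ (p , x , m , h) → p , x , m , s _ h) (λ (p , h) → p , λ x m → s _ (h x m))
         ; 4F → map⊎ (λ (p , h) → p , λ x m → s _ (h x m)) (λ (p , x , m , h) → p , x , m , s _ h)
         ; 5F → map⊎ (λ (p , x , m , h) → p , x , m , s _ h) (λ (p , h) → p , λ x m → s _ (h x m))
         ; 6F → map⊎ (λ (p , h) → p , λ x m → s _ (h x m)) (λ (p , x , m , h) → p , x , m , s _ h)
         }) h

  V-sign : ∀ s → V (sign s)
  V-sign true  = V-nat 1
  V-sign false = V-nat 0

  Sat : Bool → 𝕊 → 𝕊 → 𝕊 → Set₁
  Sat s φ t N = Der satᵗ ⟨ φ , ⟨ t , ⟨ N , sign s ⟩ ⟩ ⟩

  private
    canonical : Bool → 𝕊 → 𝕊 → 𝕊 → Fin 7 → 𝕊 → Vec 𝕊 7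
    canonical s N t β i W = sign s ∷ N ∷ t ∷ β ∷ nat (toℕ i) ∷ ⟨ tag (toℕ i) β , ⟨ t , ⟨ N , sign s ⟩ ⟩ ⟩ ∷ W ∷ []

    Sat-inversion : ∀ s {φ t N} i {β} → φ ≈ tag (toℕ i) β → Sat s φ t N →
      ∃[ W ] (⟦ lookup clauses i ⟧ (canonical s N t β i W) × (∀ p → p ϵ W → Der satᵗ p))
    Sat-inversion s i e d with der-inversion satᵗ d
    ... | W , (k , _ , β , _ , t , _ , N , _ , b , _ , p , h) , dW =
      pair-injective p ▹ λ (p₁ , p₂) → pair-injective p₂ ▹ λ (p₃ , p₄) → pair-injective p₄ ▹ λ (p₅ , p₆) →
      pair-injective (≈-trans (≈-sym e) p₁) ▹ λ (p₇ , p₈) →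
      W , ⟦⟧-resp (lookup clauses i)
        (≈-sym p₆ ∷ ≈-sym p₅ ∷ ≈-sym p₃ ∷ ≈-sym p₈ ∷ ≈-sym p₇ ∷ pair-cong e ≈-refl ∷ ≈-refl ∷ [])
        (switch-elim {j = 0} {ρ = b ∷ N ∷ t ∷ β ∷ k ∷ _ ∷ W ∷ []} {t = v4} clauses i (≈-sym p₇) h) , dW

    Sat-intro : ∀ s {φ t N} i {β P} → φ ≈ tag (toℕ i) β → V φ → V t → V N → V P → (∀ p → p ϵ P → Der satᵗ p) →
      ⟦ lookup clauses i ⟧ (canonical s N t β i P) → Sat s φ t N
    Sat-intro s {φ} {t} {N} i {β} {P} e Vφ Vt VN VP dP h =
      V-pair⁻ (V-resp e Vφ) ▹ λ (Vi , Vβ) →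
      Der-resp satᵗ (pair-cong (≈-sym e) ≈-refl) (der-intro satᵗ sat-mono
        (V-pair (V-resp e Vφ) (V-pair Vt (V-pair VN (V-sign s)))) VP dP
        (nat (toℕ i) , Vi , β , Vβ , t , Vt , N , VN , sign s , V-sign s , ≈-refl ,
         switch-intro {j = 0} {ρ = canonical s N t β i P} {t = v4} clauses i ≈-refl h))

    arity : ∀ {R R′ j} k → D.⟨ R , D.nat k ⟩ ∈ L → ⟨ R′ , j ⟩ ϵ L → R ≈ R′ → j ≈ nat k
    arity {R} {R′} {j} k m m′ e with Language.graph _ (↓∈ m′)
    ... | R₀ , n , p =
      pair-injective (pair⁺ R₀ (D.nat n) p) ▹ λ (_ , q) →
      ≈-trans q (≈-reflexive (sym (nat-def n))) ▹ λ q →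
      ≈-trans q (≈-reflexive (cong nat (Language.unique R n k (symbol⁻ R n (ϵ-respˡ (pair-cong (≈-sym e) q) m′)) m)))

  entries⁺ : ∀ {n r} (xs : Vec 𝕊 n) → D.tuple xs ∈ r → tuple xs ϵ r
  entries⁺ {r = r} xs m = subst (_ϵ r) (sym (tuple-def xs)) (↑∈ {D.tuple xs} m)

  entries⁻ : ∀ {n r} (xs : Vec 𝕊 n) → tuple xs ϵ r → D.tuple xs ∈ r
  entries⁻ {r = r} xs m = ↓∈ (subst (_ϵ r) (tuple-def xs) m)

  -- Recursion on `d` supplies the well-foundedness that a self-justifying set may lack. At each
  -- step the tag of `φ` singles out the one clause that can have justified the fact.
  Sat-sound : ∀ s {n φ} (d : Formula n φ) xs {N} → Sat s φ (tuple xs) N → Signed s (N ⊨⟨ d ⟩ xs)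
  Sat-sound s (rel k R vs m e) xs {N} h =
    Sat-inversion s 0F (rel⁺ R vs e) h ▹ λ (W , (R′ , _ , v , _ , j , _ , u , _ , p , l , q , c) , _) →
    pair-injective p ▹ λ (p₁ , p₂) →
    Lookups-elim k xs (arity k m l p₁) ≈-refl q ▹ λ (us , r₁ , r₂) →
    indices-injective vs us (≈-trans p₂ r₁) ▹ λ r₃ →
    ≈-trans r₂ (≈-reflexive (cong (λ ws → tuple (map (lookup xs) ws)) (sym r₃))) ▹ λ r₄ →
    finish s (λ (r , _ , a , b) → r , pair∈⁻ R r (ϵ-respˡ (pair-cong (≈-sym p₁) ≈-refl) a) , entries⁻ (map (lookup xs) vs) (ϵ-respˡ r₄ b))
      (λ (r , a , b) → r , proj₂ (V-pair⁻ (V-ϵ VN (pair∈⁺ R r a))) , ϵ-respˡ (pair-cong p₁ ≈-refl) (pair∈⁺ R r a) , ϵ-respˡ (≈-sym r₄) (entries⁺ (map (lookup xs) vs) b))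
      (signed-elim s ≈-refl c)
    where
    VN : V N
    VN = proj₁ (V-pair⁻ (proj₂ (V-pair⁻ (proj₂ (V-pair⁻ (Der⇒V satᵗ h))))))
    finish : ∀ s {P Q : Set₁} → (P → Q) → (Q → P) → choose s P (¬ P) → Signed s Q
    finish true  f g h = f h
    finish false f g h = h ∘ g
  Sat-sound s (eq i j e) xs h =
    Sat-inversion s 1F (eq⁺ i j e) h ▹ λ (W , (i′ , _ , j′ , _ , x , _ , y , _ , p , l , l′ , c) , _) →
    pair-injective p ▹ λ (p₁ , p₂) →
    value i p₁ l ▹ λ q₁ → value j p₂ l′ ▹ λ q₂ →
    finish s (λ r → lift (↓≐ (≈-trans (≈-sym q₁) (≈-trans r q₂))))
      (λ (lift r) → ≈-trans q₁ (≈-trans (↑≐ r) (≈-sym q₂))) (signed-elim s ≈-refl c)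
    where
    value : ∀ i {i′ x} → nat (toℕ i) ≈ i′ → Lookup i′ (tuple xs) x → x ≈ lookup xs i
    value i p l = Lookup-elim xs ≈-refl l ▹ λ (a , q , r) →
      ≈-trans r (≈-reflexive (cong (lookup xs) (sym (toℕ-injective (nat-injective (≈-trans p q))))))
    finish : ∀ s {P Q : Set₁} → (P → Q) → (Q → P) → choose s P (¬ P) → Signed s Q
    finish true  f g h = f h
    finish false f g h = h ∘ g
  Sat-sound true (neg ψ e d) xs h =
    Sat-inversion true 2F (tag⁺ 2 ψ e) h ▹ λ (W , c , dW) → Sat-sound false d xs (dW _ (signed-elim true ≈-refl c))
  Sat-sound false (neg ψ e d) xs h =
    Sat-inversion false 2F (tag⁺ 2 ψ e) h ▹ λ (W , c , dW) → λ k → k (Sat-sound true d xs (dW _ (signed-elim false ≈-refl c)))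
  Sat-sound true (ex ψ e d) xs h =
    Sat-inversion true 3F (tag⁺ 3 ψ e) h ▹ λ (W , c , dW) → signed-elim true ≈-refl c ▹ λ (x , m , k) →
    x , ↓∈ m , Sat-sound true d (x ∷ xs) (dW _ k)
  Sat-sound false (ex ψ e d) xs h =
    Sat-inversion false 3F (tag⁺ 3 ψ e) h ▹ λ (W , c , dW) → λ (x , m , k) →
    Sat-sound false d (x ∷ xs) (dW _ (signed-elim false ≈-refl c x (↑∈ m))) k
  Sat-sound true (all ψ e d) xs h =
    Sat-inversion true 4F (tag⁺ 4 ψ e) h ▹ λ (W , c , dW) → λ x m →
    Sat-sound true d (x ∷ xs) (dW _ (signed-elim true ≈-refl c x (↑∈ m)))
  Sat-sound false (all ψ e d) xs h =
    Sat-inversion false 4F (tag⁺ 4 ψ e) h ▹ λ (W , c , dW) → λ f → signed-elim false ≈-refl c ▹ λ (x , m , k) →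
    Sat-sound false d (x ∷ xs) (dW _ k) (f x (↓∈ m))
  Sat-sound true (disj Φ e VΦ _ ds) xs h =
    Sat-inversion true 5F (tag⁺ 5 Φ e) h ▹ λ (W , c , dW) → signed-elim true ≈-refl c ▹ λ (ψ , m , k) →
    ψ , ↓∈ m , Sat-sound true (ds ψ (↓∈ m)) xs (dW _ k)
  Sat-sound false (disj Φ e VΦ _ ds) xs h =
    Sat-inversion false 5F (tag⁺ 5 Φ e) h ▹ λ (W , c , dW) → λ (ψ , m , k) →
    Sat-sound false (ds ψ m) xs (dW _ (signed-elim false ≈-refl c ψ (↑∈ m))) k
  Sat-sound true (conj Φ e VΦ _ ds) xs h =
    Sat-inversion true 6F (tag⁺ 6 Φ e) h ▹ λ (W , c , dW) → λ ψ m →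
    Sat-sound true (ds ψ m) xs (dW _ (signed-elim true ≈-refl c ψ (↑∈ m)))
  Sat-sound false (conj Φ e VΦ _ ds) xs h =
    Sat-inversion false 6F (tag⁺ 6 Φ e) h ▹ λ (W , c , dW) → λ f → signed-elim false ≈-refl c ▹ λ (ψ , m , k) →
    Sat-sound false (ds ψ (↓∈ m)) xs (dW _ k) (f ψ (↓∈ m))

  private
    premise : ∀ {p} → Der satᵗ p → ∃[ P ] (V P × (∀ q → q ϵ P → Der satᵗ q) × p ϵ P)
    premise {p} k = ⟅ p , p ⟆ , V-up (Der⇒V satᵗ k) (Der⇒V satᵗ k) ,
      (λ q m → Der-resp satᵗ (≈-sym ([ id , id ]′ (ϵ-up⁻ m))) k) , ϵ-upˡ ≈-refl

    premises : ∀ {a} → V a → (t : Tm 1) → (∀ x → x ϵ a → Der satᵗ (ev (x ∷ []) t)) →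
      ∃[ P ] (V P × (∀ q → q ϵ P → Der satᵗ q) × (∀ x → x ϵ a → ev (x ∷ []) t ϵ P))
    premises Va t k = image t Va ▹ λ (P , VP , hP) →
      P , VP , (λ q m → to (hP q) m ▹ λ (x , n , e) → Der-resp satᵗ (≈-sym e) (k x n)) ,
      λ x m → from (hP _) (x , m , ≈-refl)

    instanceᵗ : ∀ s {ψ t N} → V ψ → V t → V N → Tm 1
    instanceᵗ s {ψ} {t} {N} Vψ Vt VN =
      ⟨ con ψ Vψ , ⟨ ⟨ v0 , con t Vt ⟩ᵗ , ⟨ con N VN , con (sign s) (V-sign s) ⟩ᵗ ⟩ᵗ ⟩ᵗ

    memberᵗ : ∀ s {t N} → V t → V N → Tm 1
    memberᵗ s {t} {N} Vt VN = ⟨ v0 , ⟨ con t Vt , ⟨ con N VN , con (sign s) (V-sign s) ⟩ᵗ ⟩ᵗ ⟩ᵗ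

  -- The facts required by a universal step, over `X` or over the members of a connective, are the
  -- image of a set of V under a term; hence they form a set of premises in V.
  Sat-complete : ∀ s {n φ} (d : Formula n φ) {xs} → All V xs → ∀ {N} → V N →
    Signed s (N ⊨⟨ d ⟩ xs) → Sat s φ (tuple xs) N
  Sat-complete s d@(rel k R vs m e) {xs} Vxs {N} VN h =
    Sat-intro s 0F (rel⁺ R vs e) (Fm⇒V d) (V-tuple Vxs) VN V-∅ (λ p n → ⊥-elim (∉∅ n))
      (R , proj₁ (V-pair⁻ (V-ϵ VL (symbol⁺ R k m))) , _ , V-indices vs , nat k , V-nat k , _ , V-lookups Vxs vs ,
       ≈-refl , symbol⁺ R k m , Lookups-intro Vxs vs , signed-intro s (start s h))
    where
    start : ∀ s → Signed s (N ⊨⟨ d ⟩ xs) →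
      choose s (⟦ holdsᵗ v2 v1 v0 ⟧ (N ∷ tuple (map (lookup xs) vs) ∷ R ∷ []))
        (¬ ⟦ holdsᵗ v2 v1 v0 ⟧ (N ∷ tuple (map (lookup xs) vs) ∷ R ∷ []))
    start true  (r , a , b) = r , proj₂ (V-pair⁻ (V-ϵ VN (pair∈⁺ R r a))) , pair∈⁺ R r a , entries⁺ (map (lookup xs) vs) b
    start false h (r , _ , a , b) = h (r , pair∈⁻ R r a , entries⁻ (map (lookup xs) vs) b)
  Sat-complete s d@(eq i j e) {xs} Vxs VN h =
    Sat-intro s 1F (eq⁺ i j e) (Fm⇒V d) (V-tuple Vxs) VN V-∅ (λ p n → ⊥-elim (∉∅ n))
      (_ , V-nat (toℕ i) , _ , V-nat (toℕ j) , _ , V-lookup Vxs i , _ , V-lookup Vxs j ,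
       ≈-refl , Lookup-intro Vxs i , Lookup-intro Vxs j , signed-intro s (start s h))
    where
    start : ∀ s → Signed s (Lift 1ℓ (lookup xs i ≐ lookup xs j)) →
      choose s (lookup xs i ≈ lookup xs j) (¬ (lookup xs i ≈ lookup xs j))
    start true  (lift p) = ↑≐ p
    start false h p = h (lift (↓≐ p))
  Sat-complete true d@(neg ψ e d′) Vxs VN h =
    premise (Sat-complete false d′ Vxs VN h) ▹ λ (P , VP , dP , m) →
    Sat-intro true 2F (tag⁺ 2 ψ e) (Fm⇒V d) (V-tuple Vxs) VN VP dP (signed-intro true m)
  Sat-complete false d@(neg ψ e d′) Vxs VN h =
    premise (Sat-complete true d′ Vxs VN (by-contradiction h)) ▹ λ (P , VP , dP , m) →
    Sat-intro false 2F (tag⁺ 2 ψ e) (Fm⇒V d) (V-tuple Vxs) VN VP dP (signed-intro false m)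
  Sat-complete true d@(ex ψ e d′) Vxs VN (x , m , h) =
    premise (Sat-complete true d′ (V-ϵ VX (↑∈ m) ∷ Vxs) VN h) ▹ λ (P , VP , dP , n) →
    Sat-intro true 3F (tag⁺ 3 ψ e) (Fm⇒V d) (V-tuple Vxs) VN VP dP
      (signed-intro true (x , ↑∈ m , n))
  Sat-complete false d@(ex ψ e d′) Vxs VN h =
    premises VX (instanceᵗ false (Fm⇒V d′) (V-tuple Vxs) VN)
      (λ x m → Sat-complete false d′ (V-ϵ VX m ∷ Vxs) VN (λ k → h (x , ↓∈ m , k))) ▹ λ (P , VP , dP , n) →
    Sat-intro false 3F (tag⁺ 3 ψ e) (Fm⇒V d) (V-tuple Vxs) VN VP dP (signed-intro false n)
  Sat-complete true d@(all ψ e d′) Vxs VN h =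
    premises VX (instanceᵗ true (Fm⇒V d′) (V-tuple Vxs) VN)
      (λ x m → Sat-complete true d′ (V-ϵ VX m ∷ Vxs) VN (h x (↓∈ m))) ▹ λ (P , VP , dP , n) →
    Sat-intro true 4F (tag⁺ 4 ψ e) (Fm⇒V d) (V-tuple Vxs) VN VP dP (signed-intro true n)
  Sat-complete false d@(all ψ e d′) {xs} Vxs {N} VN h =
    by-contradiction {∃[ x ] (x ϵ X × ¬ (N ⊨⟨ d′ ⟩ (x ∷ xs)))}
      (λ none → h (λ x m → by-contradiction (λ k → none (x , ↑∈ m , k)))) ▹ λ (x , m , k) →
    premise (Sat-complete false d′ (V-ϵ VX m ∷ Vxs) VN k) ▹ λ (P , VP , dP , n) →
    Sat-intro false 4F (tag⁺ 4 ψ e) (Fm⇒V d) (V-tuple Vxs) VN VP dP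
      (signed-intro false (x , m , n))
  Sat-complete true d@(disj Φ e VΦ _ ds) Vxs VN (ψ , m , h) =
    premise (Sat-complete true (ds ψ m) Vxs VN h) ▹ λ (P , VP , dP , n) →
    Sat-intro true 5F (tag⁺ 5 Φ e) (Fm⇒V d) (V-tuple Vxs) VN VP dP
      (signed-intro true (ψ , ↑∈ m , n))
  Sat-complete false d@(disj Φ e VΦ _ ds) Vxs VN h =
    premises VΦ (memberᵗ false (V-tuple Vxs) VN)
      (λ ψ m → Sat-complete false (ds ψ (↓∈ m)) Vxs VN (λ k → h (ψ , ↓∈ m , k))) ▹ λ (P , VP , dP , n) →
    Sat-intro false 5F (tag⁺ 5 Φ e) (Fm⇒V d) (V-tuple Vxs) VN VP dP (signed-intro false n)
  Sat-complete true d@(conj Φ e VΦ _ ds) Vxs VN h =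
    premises VΦ (memberᵗ true (V-tuple Vxs) VN)
      (λ ψ m → Sat-complete true (ds ψ (↓∈ m)) Vxs VN (h ψ (↓∈ m))) ▹ λ (P , VP , dP , n) →
    Sat-intro true 6F (tag⁺ 6 Φ e) (Fm⇒V d) (V-tuple Vxs) VN VP dP (signed-intro true n)
  Sat-complete false d@(conj Φ e VΦ _ ds) {xs} Vxs {N} VN h =
    by-contradiction {∃[ ψ ] Σ[ m ∈ ψ ∈ Φ ] ¬ (N ⊨⟨ ds ψ m ⟩ xs)}
      (λ none → h (λ ψ m → by-contradiction (λ k → none (ψ , m , k)))) ▹ λ (ψ , m , k) →
    premise (Sat-complete false (ds ψ m) Vxs VN k) ▹ λ (P , VP , dP , n) →
    Sat-intro false 6F (tag⁺ 6 Φ e) (Fm⇒V d) (V-tuple Vxs) VN VP dP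
      (signed-intro false (ψ , ↑∈ m , n))

-- Ordinals, the set of structures and its measurable classes.

ordinal-transitive : ∀ {α} → IsOrdinal α → Transitive α
ordinal-transitive (t , _) y z m n = ↑∈ (t y z (↓∈ m) (↓∈ n))

ordinal-ϵ : ∀ {α β} → IsOrdinal α → β ϵ α → IsOrdinal β
ordinal-ϵ {α} (t , h) m = h _ (↓∈ m) , λ γ n → h γ (t _ γ (↓∈ m) n)

ordinal-compare : ExcludedMiddle 1ℓ → ∀ α β → IsOrdinal α → IsOrdinal β → α ϵ β ⊎ α ≈ β ⊎ β ϵ α
ordinal-compare lem = trichotomy lem IsOrdinal (λ _ → ordinal-transitive)
  λ α β Oα Oβ p q → ext (λ γ m → p γ (ordinal-ϵ Oα m) m) (λ γ m → q γ (ordinal-ϵ Oβ m) m)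

nat-transitive : ∀ n {x} → x ≈ nat n → ∀ y z → y ∈ x → z ∈ y → z ∈ x
nat-transitive n e y z m k =
  nat-ϵ⁻ n (ϵ-respʳ e (↑∈ m)) ▹ λ (i , i<n , p) →
  nat-ϵ⁻ i (ϵ-respʳ p (↑∈ k)) ▹ λ (j , j<i , q) →
  ↓∈ (ϵ-resp (≈-sym q) (≈-sym e) (nat-ϵ (<-trans j<i i<n)))

ω-ordinal : IsOrdinal ω
ω-ordinal =
  (λ y z m k → ϵ-ω⁻ (↑∈ m) ▹ λ (n , e) → nat-ϵ⁻ n (ϵ-respʳ e (↑∈ k)) ▹ λ (i , _ , p) →
    ↓∈ (ϵ-respˡ (≈-sym p) (nat-ϵ-ω i))) ,
  (λ x m → ϵ-ω⁻ (↑∈ m) ▹ λ (n , e) → nat-transitive n e)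

nat-finite : ∀ n {x} → x ≈ nat n → Finite x
nat-finite n e = below n , λ y m → nat-ϵ⁻ n (ϵ-respʳ e (↑∈ m)) ▹ λ (i , i<n , p) → listed n i<n p
  where
  below : ℕ → List 𝕊
  below zero    = []
  below (suc n) = nat n ∷ below n
  listed : ∀ n {i y} → i <ⁿ n → y ≈ nat i → Any (y ≐_) (below n)
  listed (suc n) l p with m<1+n⇒m<n∨m≡n l
  ... | inj₁ l′   = there (listed n l′ p)
  ... | inj₂ refl = here (↓≐ p)

module Structures (setting : Setting) where
  open Satisfaction setting public

  -- By comparability of ordinals: if κ belonged to ω it would be finite. In the other cases ω is an
  -- element of κ or κ itself, and so belongs to V.
  ω⊆κ : V ω × ω ⊆ κ
  ω⊆κ with ordinal-compare lem ω κ ω-ordinal κ-ordinal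
  ... | inj₁ m        = V-ϵ Vκ m , λ z n → ordinal-transitive κ-ordinal ω z m n
  ... | inj₂ (inj₁ e) = V-resp (≈-sym e) Vκ , λ z n → ϵ-respʳ e n
  ... | inj₂ (inj₂ m) = ϵ-ω⁻ m ▹ λ (n , e) → ⊥-elim (κ-infinite (nat-finite n e))

  V-ω : V ω
  V-ω = proj₁ ω⊆κ

  nat-ϵ-κ : ∀ n → nat n ϵ κ
  nat-ϵ-κ n = proj₂ ω⊆κ (nat n) (nat-ϵ-ω n)

  function⁺ : ∀ {f A B} → IsFunction f A B → IsGraph A f (λ _ b → b ϵ B)
  function⁺ {f} F =
    (λ p m → IsFunction.graph F p (↓∈ m) ▹ λ (a , b , e , ma , mb) → a , b , ↑∈ ma , ↑∈ mb , pair⁺ a b e) ,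
    (λ a m → IsFunction.total F a (↓∈ m) ▹ λ (b , n) → b , pair∈⁺ a b n) ,
    (λ a b c m n → ↑≐ (IsFunction.unique F a b c (pair∈⁻ a b m) (pair∈⁻ a c n)))

  function⁻ : ∀ {f A B} {Q : 𝕊 → 𝕊 → Set₁} → IsGraph A f Q → (∀ a b → a ϵ A → Q a b → b ϵ B) → IsFunction f A B
  function⁻ (g , t , u) h = record
    { graph  = λ p m → g p (↑∈ m) ▹ λ (a , b , ma , q , e) → a , b , pair⁻ a b e , ↓∈ ma , ↓∈ (h a b ma q)
    ; total  = λ a m → t a (↑∈ m) ▹ λ (b , n) → b , pair∈⁻ a b n
    ; unique = λ a b c m n → ↓≐ (u a b c (pair∈⁺ a b m) (pair∈⁺ a c n))
    }

  graph-value : ∀ {f A Q} → IsGraph A f Q → (∀ {a b a′ b′} → a ≈ a′ → b ≈ b′ → Q a b → Q a′ b′) →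
    ∀ {a b} → ⟨ a , b ⟩ ϵ f → a ϵ A × Q a b
  graph-value (g , _ , _) resp m =
    g _ m ▹ λ (a′ , b′ , ma , q , e) → pair-injective e ▹ λ (e₁ , e₂) →
    ϵ-respˡ (≈-sym e₁) ma , resp (≈-sym e₁) (≈-sym e₂) q

  Injection : 𝕊 → 𝕊 → Set₁
  Injection A f = V f × IsGraph A f (λ _ b → b ϵ κ) × (∀ a c b → ⟨ a , b ⟩ ϵ f → ⟨ c , b ⟩ ϵ f → a ≈ c)

  card⁺ : ∀ {A} → Card≤ V A κ → ∃[ f ] Injection A f
  card⁺ (f , Vf , F , inj) = f , Vf , function⁺ F ,
    λ a c b m n → ↑≐ (inj a c b (pair∈⁻ a b m) (pair∈⁻ c b n))

  card⁻ : ∀ {A} → ∃[ f ] Injection A f → Card≤ V A κ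
  card⁻ (f , Vf , F , inj) = f , Vf , function⁻ F (λ _ _ _ m → m) ,
    λ a c b m n → ↓≐ (inj a c b (pair∈⁺ a b m) (pair∈⁺ c b n))

  card-ω : Card≤ V ω κ
  card-ω = card⁻ (image ⟨ v0 , v0 ⟩ᵗ V-ω ▹ λ (f , Vf , hf) → f , Vf ,
    ((λ p m → to (hf p) m ▹ λ (x , n , e) → x , x , n , proj₂ ω⊆κ x n , e) ,
     (λ i m → i , from (hf _) (i , m , ≈-refl)) ,
     (λ i a b m n → ≈-trans (≈-sym (diagonal (to (hf _) m))) (diagonal (to (hf _) n)))) ,
    (λ a c b m n → ≈-trans (diagonal (to (hf _) m)) (≈-sym (diagonal (to (hf _) n)))))
    where
    diagonal : ∀ {a b} → ∃[ x ] (x ϵ ω × ⟨ a , b ⟩ ≈ ⟨ x , x ⟩) → a ≈ b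
    diagonal (x , _ , e) = pair-injective e ▹ λ (p , q) → ≈-trans p (≈-sym q)

  strᵗ : Fo 1
  strᵗ =
    ∀∈ v0 (∃V (∃V (∃V (v3 ≐ᵗ ⟨ v2 , v1 ⟩ᵗ ∧ᵗ ⟨ v2 , v0 ⟩ᵗ ∈ᵗ con L VL ∧ᵗ
      ∀∈ v1 (app (derᵗ tuplesᵗ) (⟨ v1 , v0 ⟩ᵗ ∷ []))))))
    ∧ᵗ (∀V (∀V (⟨ v1 , v0 ⟩ᵗ ∈ᵗ con L VL ⇒ᵗ ∃V (⟨ v2 , v0 ⟩ᵗ ∈ᵗ v3)))
    ∧ᵗ ∀V (∀V (∀V (⟨ v2 , v1 ⟩ᵗ ∈ᵗ v3 ⇒ᵗ ⟨ v2 , v0 ⟩ᵗ ∈ᵗ v3 ⇒ᵗ v1 ≐ᵗ v0))))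

  symbol-nat : ∀ {R k} → ⟨ R , k ⟩ ϵ L → ∃[ n ] k ≈ nat n
  symbol-nat {R} {k} m = Language.graph _ (↓∈ m) ▹ λ (R₀ , n , p) →
    pair-injective (pair⁺ R₀ (D.nat n) p) ▹ λ (_ , q) → n , ≈-trans q (≈-reflexive (sym (nat-def n)))

  str⁺ : ∀ {N} → V N → IsStr V L X κ N → ⟦ strᵗ ⟧ (N ∷ [])
  str⁺ {N} VN str =
    (λ p m → IsStr.graph str p (↓∈ m) ▹ λ (R , r , e , n , mL , ts) →
      symbol⁺ R n mL ▹ λ mL′ →
      V-pair⁻ (V-resp (pair⁺ R r e) (V-ϵ VN m)) ▹ λ (VR , Vr) →
      R , VR , r , Vr , nat n , V-nat n , pair⁺ R r e , mL′ ,
      λ t mt → ts t (↓∈ mt) ▹ λ (xs , mxs , et) →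
        Der-resp tuplesᵗ (pair-cong ≈-refl (≈-trans (≈-reflexive (tuple-def xs)) (≈-sym (↑≐ et))))
          (IsTuple-intro mxs)) ,
    (λ R VR k Vk m → symbol-nat m ▹ λ (n , e) →
      IsStr.total str R n (symbol⁻ R n (ϵ-respˡ (pair-cong ≈-refl e) m)) ▹ λ (r , mr) →
      r , proj₂ (V-pair⁻ (V-ϵ VN (pair∈⁺ R r mr))) , pair∈⁺ R r mr) ,
    (λ R _ r _ s _ m n → ↑≐ (IsStr.unique str R r s (pair∈⁻ R r m) (pair∈⁻ R s n)))

  str⁻ : ∀ {N} → V N → ⟦ strᵗ ⟧ (N ∷ []) → IsStr V L X κ N
  str⁻ {N} VN (g , t , u) = record
    { graph = λ p m → g p (↑∈ m) ▹ λ (R , _ , r , _ , k , _ , e , mL , ts) →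
        symbol-nat mL ▹ λ (n , ek) →
        R , r , pair⁻ R r e , n , symbol⁻ R n (ϵ-respˡ (pair-cong ≈-refl ek) mL) ,
        λ x mx → IsTuple-elim n ek (ts x (↑∈ mx)) ▹ λ (xs , mxs , et) →
          xs , mxs , ↓≐ (≈-trans et (≈-reflexive (tuple-def xs)))
    ; total = λ R n m → t R (proj₁ (V-pair⁻ (V-ϵ VL (symbol⁺ R n m)))) (nat n) (V-nat n) (symbol⁺ R n m) ▹ λ (r , _ , mr) →
        r , pair∈⁻ R r mr
    ; unique = λ R r s m n →
        V-pair⁻ (V-ϵ VN (pair∈⁺ R r m)) ▹ λ (VR , Vr) →
        ↓≐ (u R VR r Vr s (proj₂ (V-pair⁻ (V-ϵ VN (pair∈⁺ R s n)))) (pair∈⁺ R r m) (pair∈⁺ R s n))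
    }

  private
    -- For each external `n` the tuples of length `n` are bounded by a set of V. Being such a bound
    -- is first-order, so collection over ω bounds the tuples of all lengths at once.
    all-tuples : ∃[ T ] (V T × (∀ n t → IsTuple (nat n) t → t ϵ T))
    all-tuples =
      collection (∀V (app (derᵗ tuplesᵗ) (⟨ v1 , v0 ⟩ᵗ ∷ []) ⇒ᵗ v0 ∈ᵗ v2)) V-ω ▹ λ (b , Vb , hb) →
      V-⋃ Vb ▹ λ (T , VT , hT) →
      T , VT , λ n t d →
        bounded n ▹ λ (Tₙ , Vₙ , hₙ) →
        hb (nat n) (nat-ϵ-ω n) (Tₙ , Vₙ , λ t Vt d → hₙ t d) ▹ λ (T′ , mT′ , h′) →
        from (hT t) (T′ , mT′ , h′ t (proj₂ (V-pair⁻ (Der⇒V tuplesᵗ d))) d)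
      where
      bounded : ∀ n → ∃[ T ] (V T × (∀ t → IsTuple (nat n) t → t ϵ T))
      bounded n = go n ▹ λ (T , VT , hT) → T , VT , λ t d →
        IsTuple-elim n ≈-refl d ▹ λ (xs , mxs , e) → ϵ-respˡ (≈-sym e) (hT xs mxs)
        where
        go : ∀ n → ∃[ T ] (V T × (∀ (xs : Vec 𝕊 n) → All (_∈ X) xs → tuple xs ϵ T))
        go zero    = ⟅ ∅ , ∅ ⟆ , V-up V-∅ V-∅ , λ { [] [] → ϵ-upˡ ≈-refl }
        go (suc n) = go n ▹ λ (T , VT , hT) → product VX VT ▹ λ (P , VP , hP) →
          P , VP , λ { (x ∷ xs) (m ∷ ms) → from (hP _) (x , tuple xs , ↑∈ m , hT xs ms , ≈-refl) }

    opaque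
      -- Relation symbols lie in the double union of `L` and their interpretations are sets of
      -- tuples, so structures are found in the power set of the product of these symbols with the
      -- power set of `T`.
      structures : ∃[ S ] (V S × (∀ N → N ϵ S ⇔ (V N × IsStr V L X κ N)))
      structures =
       all-tuples ▹ λ (T , VT , hT) →
       V-𝒫 VT ▹ λ (R , VR , hR) →
       V-⋃ VL ▹ λ (L′ , VL′ , hL′) →
       V-⋃ VL′ ▹ λ (L″ , VL″ , hL″) →
       product VL″ VR ▹ λ (P , VP , hP) →
       V-𝒫 VP ▹ λ (B , VB , hB) →
       sep strᵗ VB ▹ λ (S , VS , hS) →
       S , VS , λ N → mk⇔
         (λ m → to (hS N) m ▹ λ (k , h) → V-ϵ VB k , str⁻ (V-ϵ VB k) h)
         (λ (VN , str) → from (hS N) (from (hB N VN) (λ p m →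
            IsStr.graph str p (↓∈ m) ▹ λ (R₀ , r , e , n , mL , ts) →
            symbol⁺ R₀ n mL ▹ λ mL′ →
            from (hP p) (R₀ , r ,
              from (hL″ R₀) (⟅ R₀ , R₀ ⟆ , from (hL′ _) (_ , mL′ , ϵ-respʳ (≈-sym ≈-⟅⟆) (ϵ-upˡ ≈-refl)) , ϵ-upˡ ≈-refl) ,
              from (hR r (proj₂ (V-pair⁻ (V-resp (pair⁺ R₀ r e) (V-ϵ VN m))))) (λ t mt →
                ts t (↓∈ mt) ▹ λ (xs , mxs , et) →
                ϵ-respˡ (≈-trans (≈-reflexive (tuple-def xs)) (≈-sym (↑≐ et))) (hT n _ (IsTuple-intro mxs))) ,
              pair⁺ R₀ r e)) , str⁺ VN str))

  Str : 𝕊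
  Str = proj₁ structures

  V-Str : V Str
  V-Str = proj₁ (proj₂ structures)

  ϵ-Str : ∀ N → N ϵ Str ⇔ (V N × IsStr V L X κ N)
  ϵ-Str = proj₂ (proj₂ structures)

  Meas : 𝕊 → Set₁
  Meas = Measurable V L X κ

  Denotes : 𝕊 → (𝕊 → Set₁) → Set₁
  Denotes B P = V B × (∀ N → N ϵ B ⇔ (N ϵ Str × P N))

  MeasClass : (𝕊 → Set₁) → Set₁
  MeasClass P = ∃[ B ] (Denotes B P × Meas B)

  denotes⁻ : ∀ {B P} → Denotes B P → _IsSetOfStr_ V L X κ B P
  denotes⁻ (VB , h) = VB , λ N → mk⇔
    (λ m → to (h N) (↑∈ m) ▹ λ (n , p) → to (ϵ-Str N) n ▹ λ (VN , str) → VN , str , p)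
    (λ (VN , str , p) → ↓∈ (from (h N) (from (ϵ-Str N) (VN , str) , p)))

  denotes⁺ : ∀ {B P} → _IsSetOfStr_ V L X κ B P → Denotes B P
  denotes⁺ (VB , h) = VB , λ N → mk⇔
    (λ m → to (h N) (↓∈ m) ▹ λ (VN , str , p) → from (ϵ-Str N) (VN , str) , p)
    (λ (n , p) → to (ϵ-Str N) n ▹ λ (VN , str) → ↑∈ (from (h N) (VN , str , p)))

  denotes-unique : ∀ {B B′ P P′} → (∀ N → N ϵ Str → P N ⇔ P′ N) → Denotes B P → Denotes B′ P′ → B ≈ B′
  denotes-unique e (_ , h) (_ , h′) = ext
    (λ N m → to (h N) m ▹ λ (n , p) → from (h′ N) (n , to (e N n) p))
    (λ N m → to (h′ N) m ▹ λ (n , p) → from (h N) (n , from (e N n) p))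

  denotes-resp : ∀ {B P P′} → (∀ N → N ϵ Str → P N ⇔ P′ N) → Denotes B P → Denotes B P′
  denotes-resp e (VB , h) = VB , λ N → mk⇔
    (λ m → to (h N) m ▹ λ (n , p) → n , to (e N n) p) (λ (n , p) → from (h N) (n , from (e N n) p))

  cut : (Q : Fo 1) → ∃[ B ] Denotes B (λ N → ⟦ Q ⟧ (N ∷ []))
  cut Q = sep Q V-Str

  private
    set-≈ : ∀ {A A′ : 𝕊} {P : 𝕊 → Set₁} → A ≈ A′ → _IsSetOfStr_ V L X κ A P → _IsSetOfStr_ V L X κ A′ P
    set-≈ e (VA , h) = V-resp e VA , λ N → mk⇔
      (λ m → to (h N) (↓∈ (ϵ-respʳ (≈-sym e) (↑∈ m)))) (λ p → ↓∈ (ϵ-respʳ e (↑∈ (from (h N) p))))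

    set-≈₀ : ∀ {A A′ : 𝕊} {P : 𝕊 → Set} → A ≈ A′ → _IsSetOfStr_ V L X κ A P → _IsSetOfStr_ V L X κ A′ P
    set-≈₀ e (VA , h) = V-resp e VA , λ N → mk⇔
      (λ m → to (h N) (↓∈ (ϵ-respʳ (≈-sym e) (↑∈ m)))) (λ p → ↓∈ (ϵ-respʳ e (↑∈ (from (h N) p))))

  Meas-resp : ∀ {A A′} → A ≈ A′ → Meas A → Meas A′
  Meas-resp e (basic d l xs ms h) = basic d l xs ms (set-≈ e h)
  Meas-resp e (compl B m h)       = compl B m (set-≈₀ e h)
  Meas-resp e (union U VU c ms h) = union U VU c ms (set-≈ e h)

  MeasClass-resp : ∀ {P P′} → (∀ N → N ϵ Str → P N ⇔ P′ N) → MeasClass P → MeasClass P′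
  MeasClass-resp e (B , d , m) = B , denotes-resp e d , m

  MeasClass-set : ∀ {P B} → MeasClass P → Denotes B P → Meas B
  MeasClass-set (B , d , m) d′ = Meas-resp (denotes-unique (λ N _ → mk⇔ id id) d d′) m

  MeasClass-¬ : ∀ {P} → MeasClass P → MeasClass (λ N → ¬ P N)
  MeasClass-¬ (B , d@(VB , h) , m) =
    cut (¬ᵗ (v0 ∈ᵗ con B VB)) ▹ λ (C , dC) →
    C , denotes-resp (λ N n → mk⇔ (λ k p → k (from (h N) (n , p))) (λ k b → k (proj₂ (to (h N) b)))) dC ,
    compl B m (V-resp ≈-refl (proj₁ dC) , λ N → mk⇔
      (λ c → to (proj₂ (denotes⁻ dC) N) c ▹ λ (VN , str , k) → VN , str , λ b → k (↑∈ b))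
      (λ (VN , str , k) → from (proj₂ (denotes⁻ dC) N) (VN , str , λ b → k (↓∈ b))))

  -- The union constructor takes a set `U` of measurable sets of size at most κ, not an indexed
  -- family. Distinct indices may give the same set, so `g` chooses for each member of `U` the value
  -- under `f` of one of its indices. This is injective because `f` is and the index determines the
  -- set.
  MeasClass-∃ : ∀ {I} → V I → Card≤ V I κ → (Q : Fo 2) →
    (∀ i → i ϵ I → MeasClass (λ N → ⟦ Q ⟧ (i ∷ N ∷ []))) →
    MeasClass (λ N → ∃[ i ] (i ϵ I × ⟦ Q ⟧ (i ∷ N ∷ [])))
  MeasClass-∃ {I} VI card Q meas =
    card⁺ card ▹ λ (f , Vf , F , inj) →
    repl memberᵗ VI (λ i B C iI VB VC hB hC → V-ext VB VC (λ N VN → mk⇔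
      (λ m → proj₂ (hC N VN) (proj₁ (hB N VN) m)) (λ m → proj₂ (hB N VN) (proj₁ (hC N VN) m)))) ▹ λ (U , VU , hU) →
    choice-function (indexᵗ f Vf) VU (λ B m → to (hU B (V-ϵ VU m)) m ▹ λ (i , iI , hB) →
      proj₁ (proj₂ F) i iI ▹ λ (j , mj) →
      j , V-ϵ Vκ (proj₂ (graph-value F (λ _ e k → ϵ-respˡ e k) mj)) , i , iI , mj , hB) ▹ λ (g , Vg , G) →
    cut (∃∈ (con I VI) (app Q (v0 ∷ v1 ∷ []))) ▹ λ (A , dA) →
    A , dA , union U VU (card⁻ (g , Vg , indexed {f} {Vf} F G , injective {f} {Vf} VU inj G)) (λ B m →
      to (hU B (V-ϵ VU (↑∈ m))) (↑∈ m) ▹ λ (i , iI , hB) → MeasClass-set (meas i iI) (member⁺ (V-ϵ VU (↑∈ m)) hB))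
      (proj₁ dA , λ N → mk⇔
        (λ m → to (proj₂ (denotes⁻ dA) N) m ▹ λ (VN , str , i , iI , q) →
          meas i iI ▹ λ (B , d , _) →
          VN , str , B , ↓∈ (from (hU B (proj₁ d)) (i , iI , member⁻ d)) ,
          ↓∈ (from (proj₂ d N) (from (ϵ-Str N) (VN , str) , q)))
        (λ (VN , str , B , mB , mN) →
          V-ϵ VU (↑∈ mB) ▹ λ VB →
          to (hU B VB) (↑∈ mB) ▹ λ (i , iI , hB) →
          from (proj₂ (denotes⁻ dA) N) (VN , str , i , iI , proj₂ (proj₁ (hB N VN) (↑∈ mN)))))
    where
    memberᵗ : Fo 2
    memberᵗ = ∀V ((v0 ∈ᵗ v2) ⇔ᵗ ((v0 ∈ᵗ con Str V-Str) ∧ᵗ app Q (v1 ∷ v0 ∷ [])))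

    indexᵗ : ∀ f → V f → Fo 2
    indexᵗ f Vf = ∃∈ (con I VI) (⟨ v0 , v2 ⟩ᵗ ∈ᵗ con f Vf ∧ᵗ app memberᵗ (v0 ∷ v1 ∷ []))

    member⁺ : ∀ {i B} → V B → ⟦ memberᵗ ⟧ (i ∷ B ∷ []) → Denotes B (λ N → ⟦ Q ⟧ (i ∷ N ∷ []))
    member⁺ VB h = VB , λ N → mk⇔ (λ m → proj₁ (h N (V-ϵ VB m)) m)
      (λ (n , q) → proj₂ (h N (V-ϵ V-Str n)) (n , q))

    member⁻ : ∀ {i B} → Denotes B (λ N → ⟦ Q ⟧ (i ∷ N ∷ [])) → ⟦ memberᵗ ⟧ (i ∷ B ∷ [])
    member⁻ (VB , h) N VN = to (h N) , from (h N)

    indexed : ∀ {f Vf U g} → IsGraph I f (λ _ b → b ϵ κ) → IsGraph U g (λ B j → ⟦ indexᵗ f Vf ⟧ (B ∷ j ∷ [])) →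
      IsGraph U g (λ _ j → j ϵ κ)
    indexed F (graph , total , unique) =
      (λ p m → graph p m ▹ λ (B , j , mB , (i , _ , mf , _) , e) →
        B , j , mB , proj₂ (graph-value F (λ _ e k → ϵ-respˡ e k) mf) , e) , total , unique

    injective : ∀ {f Vf U g} → V U → (∀ a c b → ⟨ a , b ⟩ ϵ f → ⟨ c , b ⟩ ϵ f → a ≈ c) →
      IsGraph U g (λ B j → ⟦ indexᵗ f Vf ⟧ (B ∷ j ∷ [])) → ∀ B C j → ⟨ B , j ⟩ ϵ g → ⟨ C , j ⟩ ϵ g → B ≈ C
    injective {f} {Vf} VU inj G B C j m n =
      graph-value G (λ e₁ e₂ → ⟦⟧-resp (indexᵗ f Vf) (e₁ ∷ e₂ ∷ [])) m ▹ λ (mB , i , _ , mf , hB) →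
      graph-value G (λ e₁ e₂ → ⟦⟧-resp (indexᵗ f Vf) (e₁ ∷ e₂ ∷ [])) n ▹ λ (mC , i′ , _ , mf′ , hC) →
      denotes-unique (λ N _ → mk⇔ (⟦⟧-resp Q (inj i i′ j mf mf′ ∷ ≈-refl ∷ []))
          (⟦⟧-resp Q (≈-sym (inj i i′ j mf mf′) ∷ ≈-refl ∷ [])))
        (member⁺ (V-ϵ VU mB) hB) (member⁺ (V-ϵ VU mC) hC)

  -- A union over ω in which index 0 carries the first set and every other index the second.
  MeasClass-⊎ : ∀ {P Q} → MeasClass P → MeasClass Q → MeasClass (λ N → P N ⊎ Q N)
  MeasClass-⊎ {P} {Q} (B , dB@(VB , hB) , mB) (C , dC@(VC , hC) , mC) =
    MeasClass-resp
      (λ N n → mk⇔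
        (λ { (_ , _ , inj₁ (_ , b)) → inj₁ (proj₂ (to (hB N) b)) ; (_ , _ , inj₂ (_ , c)) → inj₂ (proj₂ (to (hC N) c)) })
        (λ { (inj₁ p) → nat 0 , nat-ϵ-ω 0 , inj₁ (≈-refl , from (hB N) (n , p))
           ; (inj₂ q) → nat 1 , nat-ϵ-ω 1 , inj₂ ((λ e → ∅≉⁺ (≈-sym e)) , from (hC N) (n , q)) }))
      (MeasClass-∃ V-ω card-ω ((v0 ≐ᵗ ∅ᵗ ∧ᵗ v1 ∈ᵗ con B VB) ∨ᵗ ((¬ᵗ (v0 ≐ᵗ ∅ᵗ)) ∧ᵗ v1 ∈ᵗ con C VC)) λ i _ → half i (lem {i ≈ ∅}))
    where
    half : ∀ i → Dec (i ≈ ∅) → MeasClass (λ N → (i ≈ ∅ × N ϵ B) ⊎ ((¬ i ≈ ∅) × N ϵ C))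
    half i (yes e) = MeasClass-resp (λ N n → mk⇔ (λ p → inj₁ (e , from (hB N) (n , p)))
      (λ { (inj₁ (_ , b)) → proj₂ (to (hB N) b) ; (inj₂ (k , _)) → ⊥-elim (k e) })) (B , dB , mB)
    half i (no ¬e) = MeasClass-resp (λ N n → mk⇔ (λ q → inj₂ (¬e , from (hC N) (n , q)))
      (λ { (inj₁ (e , _)) → ⊥-elim (¬e e) ; (inj₂ (_ , c)) → proj₂ (to (hC N) c) })) (C , dC , mC)

  MeasClass-× : ∀ {P Q} → MeasClass P → MeasClass Q → MeasClass (λ N → P N × Q N)
  MeasClass-× {P} {Q} mP mQ = MeasClass-resp
    (λ N _ → mk⇔ (λ k → by-contradiction (k ∘ inj₁) , by-contradiction (k ∘ inj₂))
      (λ (p , q) → λ { (inj₁ k) → k p ; (inj₂ k) → k q }))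
    (MeasClass-¬ (MeasClass-⊎ (MeasClass-¬ mP) (MeasClass-¬ mQ)))

  Sat-⇔ : ∀ s {n φ} (d : Formula n φ) {xs} → All (_∈ X) xs → ∀ N → N ϵ Str →
    Sat s φ (tuple xs) N ⇔ Signed s (N ⊨⟨ d ⟩ xs)
  Sat-⇔ s d {xs} ms N n = mk⇔ (Sat-sound s d xs) (Sat-complete s d (∈X⇒V ms) (V-ϵ V-Str n))

  satAtᵗ : Bool → ∀ {φ t} → V φ → V t → Fo 1
  satAtᵗ s {φ} {t} Vφ Vt = app (derᵗ satᵗ) (⟨ con φ Vφ , ⟨ con t Vt , ⟨ v0 , con (sign s) (V-sign s) ⟩ᵗ ⟩ᵗ ⟩ᵗ ∷ [])

  satInstanceᵗ : Bool → ∀ {ψ t} → V ψ → V t → Fo 2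
  satInstanceᵗ s {ψ} {t} Vψ Vt =
    app (derᵗ satᵗ) (⟨ con ψ Vψ , ⟨ ⟨ v0 , con t Vt ⟩ᵗ , ⟨ v1 , con (sign s) (V-sign s) ⟩ᵗ ⟩ᵗ ⟩ᵗ ∷ [])

  satMemberᵗ : Bool → ∀ {t} → V t → Fo 2
  satMemberᵗ s {t} Vt = app (derᵗ satᵗ) (⟨ v0 , ⟨ con t Vt , ⟨ v1 , con (sign s) (V-sign s) ⟩ᵗ ⟩ᵗ ⟩ᵗ ∷ [])

  module _ {n : ℕ} {xs : Vec 𝕊 n} (ms : All (_∈ X) xs) (N : 𝕊) (N∈ : N ϵ Str) where

    Sat-disj : ∀ {φ} (d : Formula n φ) Φ e VΦ c ds → d ≡ disj Φ e VΦ c ds →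
      Sat true φ (tuple xs) N ⇔ (∃[ ψ ] (ψ ϵ Φ × Sat true ψ (tuple xs) N))
    Sat-disj d Φ e VΦ c ds refl = mk⇔
      (λ k → to (Sat-⇔ true d ms N N∈) k ▹ λ (ψ , m , h) → ψ , ↑∈ m , from (Sat-⇔ true (ds ψ m) ms N N∈) h)
      (λ (ψ , m , k) → from (Sat-⇔ true d ms N N∈) (ψ , ↓∈ m , to (Sat-⇔ true (ds ψ (↓∈ m)) ms N N∈) k))

    Sat-conj : ∀ {φ} (d : Formula n φ) Φ e VΦ c ds → d ≡ conj Φ e VΦ c ds →
      Sat false φ (tuple xs) N ⇔ (∃[ ψ ] (ψ ϵ Φ × Sat false ψ (tuple xs) N))
    Sat-conj d Φ e VΦ c ds refl = mk⇔
      (λ k → by-contradiction λ none → to (Sat-⇔ false d ms N N∈) k λ ψ m → by-contradiction λ h →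
        none (ψ , ↑∈ m , from (Sat-⇔ false (ds ψ m) ms N N∈) h))
      (λ (ψ , m , k) → from (Sat-⇔ false d ms N N∈) λ f → to (Sat-⇔ false (ds ψ (↓∈ m)) ms N N∈) k (f ψ (↓∈ m)))

    Sat-ex : ∀ {φ} (d : Formula n φ) ψ e d′ → d ≡ ex ψ e d′ →
      Sat true φ (tuple xs) N ⇔ (∃[ x ] (x ϵ X × Sat true ψ (tuple (x ∷ xs)) N))
    Sat-ex d ψ e d′ refl = mk⇔
      (λ k → to (Sat-⇔ true d ms N N∈) k ▹ λ (x , m , h) →
        x , ↑∈ m , from (Sat-⇔ true d′ (m ∷ ms) N N∈) h)
      (λ (x , m , k) → from (Sat-⇔ true d ms N N∈) (x , ↓∈ m , to (Sat-⇔ true d′ (↓∈ m ∷ ms) N N∈) k))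

    Sat-all : ∀ {φ} (d : Formula n φ) ψ e d′ → d ≡ all ψ e d′ →
      Sat false φ (tuple xs) N ⇔ (∃[ x ] (x ϵ X × Sat false ψ (tuple (x ∷ xs)) N))
    Sat-all d ψ e d′ refl = mk⇔
      (λ k → by-contradiction λ none → to (Sat-⇔ false d ms N N∈) k λ x m → by-contradiction λ h →
        none (x , ↑∈ m , from (Sat-⇔ false d′ (m ∷ ms) N N∈) h))
      (λ (x , m , k) → from (Sat-⇔ false d ms N N∈) λ f →
        to (Sat-⇔ false d′ (↓∈ m ∷ ms) N N∈) k (f x (↓∈ m)))

    Sat-not : ∀ s {φ} (d : Formula n φ) → (¬ Sat s φ (tuple xs) N) ⇔ Sat (not s) φ (tuple xs) N
    Sat-not true d = mk⇔ (λ k → from (Sat-⇔ false d ms N N∈) (k ∘ from (Sat-⇔ true d ms N N∈)))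
      (λ k → to (Sat-⇔ false d ms N N∈) k ∘ to (Sat-⇔ true d ms N N∈))
    Sat-not false d = mk⇔ (λ k → by-contradiction λ h → k (from (Sat-⇔ false d ms N N∈) (h ∘ from (Sat-⇔ true d ms N N∈))))
      (λ k l → to (Sat-⇔ false d ms N N∈) l (to (Sat-⇔ true d ms N N∈) k))

  private
    MeasClass-not : ∀ s {n φ} (d : Formula n φ) {xs : Vec 𝕊 n} → All (_∈ X) xs →
      MeasClass (Sat s φ (tuple xs)) → MeasClass (Sat (not s) φ (tuple xs))
    MeasClass-not s d ms m = MeasClass-resp (λ N n → Sat-not ms N n s d) (MeasClass-¬ m)

    MeasClass-atomic : ∀ {n φ} (d : Formula n φ) → IsLiteral V L X κ d → ∀ {xs : Vec 𝕊 n} → All (_∈ X) xs →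
      MeasClass (Sat true φ (tuple xs))
    MeasClass-atomic d l {xs} ms =
      cut (satAtᵗ true (Fm⇒V d) (V-tuple (∈X⇒V ms))) ▹ λ (B , dB) →
      B , dB , basic d l xs ms (denotes⁻ (denotes-resp (Sat-⇔ true d ms) dB))

    -- The truth value whose class is treated directly. For `all` and `conj` this is falsity, whose
    -- class is a union; the class of the other value is a complement.
    primary : ∀ {n φ} → Formula n φ → Bool
    primary (all _ _ _)      = false
    primary (conj _ _ _ _ _) = false
    primary _                = true

    adjust : ∀ s s′ {n φ} (d : Formula n φ) {xs : Vec 𝕊 n} → All (_∈ X) xs →
      MeasClass (Sat s φ (tuple xs)) → MeasClass (Sat s′ φ (tuple xs))
    adjust true  true  d ms m = m
    adjust true  false d ms m = MeasClass-not true d ms m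
    adjust false true  d ms m = MeasClass-not false d ms m
    adjust false false d ms m = m

  MeasClass-Sat : ∀ s {n φ} (d : Formula n φ) {xs : Vec 𝕊 n} → All (_∈ X) xs → MeasClass (Sat s φ (tuple xs))

  private
    MeasClass-primary : ∀ {n φ} (d : Formula n φ) {xs : Vec 𝕊 n} → All (_∈ X) xs →
      MeasClass (Sat (primary d) φ (tuple xs))
    MeasClass-primary d@(rel _ _ _ _ _) ms = MeasClass-atomic d tt ms
    MeasClass-primary d@(eq _ _ _) ms = MeasClass-atomic d tt ms
    MeasClass-primary d@(neg ψ e d′) ms = MeasClass-resp
      (λ N n → mk⇔ (λ k → from (Sat-⇔ true d ms N n) (to (Sat-⇔ false d′ ms N n) k))
                   (λ k → from (Sat-⇔ false d′ ms N n) (to (Sat-⇔ true d ms N n) k)))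
      (MeasClass-Sat false d′ ms)
    MeasClass-primary d@(ex ψ e d′) ms = MeasClass-resp
      (λ N n → ⇔-sym (Sat-ex ms N n d ψ e d′ refl))
      (MeasClass-∃ VX card-X (satInstanceᵗ true (Fm⇒V d′) (V-tuple (∈X⇒V ms)))
        (λ x m → MeasClass-Sat true d′ (↓∈ m ∷ ms)))
    MeasClass-primary d@(all ψ e d′) ms = MeasClass-resp
      (λ N n → ⇔-sym (Sat-all ms N n d ψ e d′ refl))
      (MeasClass-∃ VX card-X (satInstanceᵗ false (Fm⇒V d′) (V-tuple (∈X⇒V ms)))
        (λ x m → MeasClass-Sat false d′ (↓∈ m ∷ ms)))
    MeasClass-primary d@(disj Φ e VΦ c ds) ms = MeasClass-resp
      (λ N n → ⇔-sym (Sat-disj ms N n d Φ e VΦ c ds refl))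
      (MeasClass-∃ VΦ c (satMemberᵗ true (V-tuple (∈X⇒V ms)))
        (λ ψ m → MeasClass-Sat true (ds ψ (↓∈ m)) ms))
    MeasClass-primary d@(conj Φ e VΦ c ds) ms = MeasClass-resp
      (λ N n → ⇔-sym (Sat-conj ms N n d Φ e VΦ c ds refl))
      (MeasClass-∃ VΦ c (satMemberᵗ false (V-tuple (∈X⇒V ms)))
        (λ ψ m → MeasClass-Sat false (ds ψ (↓∈ m)) ms))

  MeasClass-Sat s d ms = adjust (primary d) s d ms (MeasClass-primary d ms)

-- Borel codes and their interpretation in V.

⊏-tag : ∀ {x y} k → x ≈ tag k y → y ⊏ x
⊏-tag k e = elem (ϵ-upʳ ≈-refl) then ϵ-respʳ (≈-sym (≈-trans e ≈-⟅⟆)) (ϵ-upʳ ≈-refl)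

module Codes (setting : Setting) where
  open Structures setting public

  BorelCode : 𝕊 → Set₁
  BorelCode = Code V L X κ

  infix 4 _⊩⟨_⟩
  _⊩⟨_⟩ : 𝕊 → ∀ {γ} → BorelCode γ → Set₁
  N ⊩⟨ c ⟩ = _⊩_ V L X κ N c

  basic⁺ : ∀ {γ n} φ (xs : Vec 𝕊 n) → γ ≐ D.tag 0 D.⟨ φ , D.tuple xs ⟩ → γ ≈ tag 0 ⟨ φ , tuple xs ⟩
  basic⁺ φ xs e = ≈-trans (tag⁺ 0 _ e)
    (≈-reflexive (cong (tag 0) (sym (trans ⟨⟩-def (cong D.⟨ φ ,_⟩ (tuple-def xs))))))

  basic⁻ : ∀ {γ n} φ (xs : Vec 𝕊 n) → γ ≈ tag 0 ⟨ φ , tuple xs ⟩ → γ ≐ D.tag 0 D.⟨ φ , D.tuple xs ⟩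
  basic⁻ φ xs e = tag⁻ 0 _ (≈-trans e
    (≈-reflexive (cong (tag 0) (trans ⟨⟩-def (cong D.⟨ φ ,_⟩ (tuple-def xs))))))

  Code⇒V : ∀ {γ} → BorelCode γ → V γ
  Code⇒V (basic {φ = φ} d _ xs ms e) = V-resp (≈-sym (basic⁺ φ xs e))
    (V-tag 0 (V-pair (Fm⇒V d) (V-tuple (∈X⇒V ms))))
  Code⇒V (neg ζ e c)       = V-resp (≈-sym (tag⁺ 1 ζ e)) (V-tag 1 (Code⇒V c))
  Code⇒V (disj Γ e VΓ _ _) = V-resp (≈-sym (tag⁺ 2 Γ e)) (V-tag 2 VΓ)
  Code⇒V (conj Γ e VΓ _ _) = V-resp (≈-sym (tag⁺ 3 Γ e)) (V-tag 3 VΓ)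

  Code-resp : ∀ {γ γ′} → γ ≈ γ′ → BorelCode γ → BorelCode γ′
  Code-resp {γ} {γ′} e (basic d l xs ms p)   = basic d l xs ms (≐-trans γ′ γ _ (↓≐ (≈-sym e)) p)
  Code-resp {γ} {γ′} e (neg ζ p c)           = neg ζ (≐-trans γ′ γ _ (↓≐ (≈-sym e)) p) c
  Code-resp {γ} {γ′} e (disj Γ p VΓ en cs)   = disj Γ (≐-trans γ′ γ _ (↓≐ (≈-sym e)) p) VΓ en cs
  Code-resp {γ} {γ′} e (conj Γ p VΓ en cs)   = conj Γ (≐-trans γ′ γ _ (↓≐ (≈-sym e)) p) VΓ en cs

  private
    kind : ∀ {γ} → BorelCode γ → ℕ
    kind (basic _ _ _ _ _) = 0
    kind (neg _ _ _)       = 1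
    kind (disj _ _ _ _ _)  = 2
    kind (conj _ _ _ _ _)  = 3

    kind-tag : ∀ {γ} (c : BorelCode γ) → ∃[ β ] γ ≈ tag (kind c) β
    kind-tag (basic {φ = φ} _ _ xs _ e) = _ , basic⁺ φ xs e
    kind-tag (neg ζ e _)      = ζ , tag⁺ 1 ζ e
    kind-tag (disj Γ e _ _ _) = Γ , tag⁺ 2 Γ e
    kind-tag (conj Γ e _ _ _) = Γ , tag⁺ 3 Γ e

    same-kind : ∀ {γ γ′} (c : BorelCode γ) (c′ : BorelCode γ′) → γ ≈ γ′ → kind c ≡ kind c′
    same-kind c c′ e = kind-tag c ▹ λ (_ , p) → kind-tag c′ ▹ λ (_ , q) →
      nat-injective (proj₁ (pair-injective (≈-trans (≈-sym p) (≈-trans e q))))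

    body-≈ : ∀ k {γ γ′ β β′} → γ ≈ tag k β → γ′ ≈ tag k β′ → γ ≈ γ′ → β ≈ β′
    body-≈ k p q e = proj₂ (pair-injective (≈-trans (≈-sym p) (≈-trans e q)))

    -- Two derivations of a basic code are compared through `Sat`, which depends only on the
    -- underlying sets. The equation between kinds removes the cases with different constructors.
    invariant : ∀ {γ γ′} (c : BorelCode γ) (c′ : BorelCode γ′) → γ ≈ γ′ → kind c ≡ kind c′ →
      ∀ {N} → N ϵ Str → N ⊩⟨ c ⟩ → N ⊩⟨ c′ ⟩
    invariant (basic {φ = φ} d _ xs ms p) (basic {φ = φ′} d′ _ xs′ ms′ p′) e refl {N} n h =
      pair-injective (body-≈ 0 (basic⁺ φ xs p) (basic⁺ φ′ xs′ p′) e) ▹ λ (e₁ , e₂) →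
      Sat-sound true d′ xs′ (Der-resp satᵗ (pair-cong e₁ (pair-cong e₂ ≈-refl))
        (Sat-complete true d (∈X⇒V ms) (V-ϵ V-Str n) h))
    invariant (neg ζ p c) (neg ζ′ p′ c′) e refl n h k =
      ≈-sym (body-≈ 1 (tag⁺ 1 ζ p) (tag⁺ 1 ζ′ p′) e) ▹ λ e′ → h (invariant c′ c e′ (same-kind c′ c e′) n k)
    invariant (disj Γ p _ _ cs) (disj Γ′ p′ _ _ cs′) e refl n (ζ , m , h) =
      ↓∈ (ϵ-respʳ (body-≈ 2 (tag⁺ 2 Γ p) (tag⁺ 2 Γ′ p′) e) (↑∈ m)) ▹ λ m′ →
      ζ , m′ , invariant (cs ζ m) (cs′ ζ m′) ≈-refl (same-kind (cs ζ m) (cs′ ζ m′) ≈-refl) n h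
    invariant (conj Γ p _ _ cs) (conj Γ′ p′ _ _ cs′) e refl n h ζ m =
      ↓∈ (ϵ-respʳ (≈-sym (body-≈ 3 (tag⁺ 3 Γ p) (tag⁺ 3 Γ′ p′) e)) (↑∈ m)) ▹ λ m′ →
      invariant (cs ζ m′) (cs′ ζ m) ≈-refl (same-kind (cs ζ m′) (cs′ ζ m) ≈-refl) n (h ζ m′)

  -- Different derivations that γ is a code have the same interpretation in V.
  ⊩-invariant : ∀ {γ γ′} (c : BorelCode γ) (c′ : BorelCode γ′) → γ ≈ γ′ →
    ∀ {N} → N ϵ Str → N ⊩⟨ c ⟩ → N ⊩⟨ c′ ⟩
  ⊩-invariant c c′ e = invariant c c′ e (same-kind c c′ e)

  Fm-resp : ∀ {n φ φ′} → φ ≈ φ′ → Formula n φ → Formula n φ′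
  Fm-resp {φ = φ} {φ′} e (rel k R vs m p)    = rel k R vs m (≐-trans φ′ φ _ (↓≐ (≈-sym e)) p)
  Fm-resp {φ = φ} {φ′} e (eq i j p)          = eq i j (≐-trans φ′ φ _ (↓≐ (≈-sym e)) p)
  Fm-resp {φ = φ} {φ′} e (neg ψ p d)         = neg ψ (≐-trans φ′ φ _ (↓≐ (≈-sym e)) p) d
  Fm-resp {φ = φ} {φ′} e (ex ψ p d)          = ex ψ (≐-trans φ′ φ _ (↓≐ (≈-sym e)) p) d
  Fm-resp {φ = φ} {φ′} e (all ψ p d)         = all ψ (≐-trans φ′ φ _ (↓≐ (≈-sym e)) p) d
  Fm-resp {φ = φ} {φ′} e (disj Φ p VΦ c ds)  = disj Φ (≐-trans φ′ φ _ (↓≐ (≈-sym e)) p) VΦ c ds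
  Fm-resp {φ = φ} {φ′} e (conj Φ p VΦ c ds)  = conj Φ (≐-trans φ′ φ _ (↓≐ (≈-sym e)) p) VΦ c ds

  Fm-resp-literal : ∀ {n φ φ′} (e : φ ≈ φ′) (d : Formula n φ) → IsLiteral V L X κ d → IsLiteral V L X κ (Fm-resp e d)
  Fm-resp-literal e (rel _ _ _ _ _) l = l
  Fm-resp-literal e (eq _ _ _)      l = l
  Fm-resp-literal e (neg _ _ _)     l = l

  Fm-resp-⊨ : ∀ {n φ φ′} (e : φ ≈ φ′) (d : Formula n φ) N xs → (N ⊨⟨ Fm-resp e d ⟩ xs) ≡ (N ⊨⟨ d ⟩ xs)
  Fm-resp-⊨ e (rel _ _ _ _ _)  N xs = refl
  Fm-resp-⊨ e (eq _ _ _)       N xs = refl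
  Fm-resp-⊨ e (neg _ _ _)      N xs = refl
  Fm-resp-⊨ e (ex _ _ _)       N xs = refl
  Fm-resp-⊨ e (all _ _ _)      N xs = refl
  Fm-resp-⊨ e (disj _ _ _ _ _) N xs = refl
  Fm-resp-⊨ e (conj _ _ _ _ _) N xs = refl

  card-singleton : ∀ {x} → V x → Card≤ V ⟅ x , x ⟆ κ
  card-singleton {x} Vx = card⁻ (⟅ p , p ⟆ , V-up Vp Vp ,
    ((λ q m → x , nat 0 , ϵ-upˡ ≈-refl , nat-ϵ-κ 0 , [ id , id ]′ (ϵ-up⁻ m)) ,
     (λ a m → nat 0 , ϵ-upˡ (pair-cong ([ id , id ]′ (ϵ-up⁻ m)) ≈-refl)) ,
     (λ a b c m n → ≈-trans (proj₂ (only m)) (≈-sym (proj₂ (only n))))) ,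
    (λ a c b m n → ≈-trans (proj₁ (only m)) (≈-sym (proj₁ (only n)))))
    where
    p : 𝕊
    p = ⟨ x , nat 0 ⟩
    Vp : V p
    Vp = V-pair Vx (V-nat 0)
    only : ∀ {a b} → ⟨ a , b ⟩ ϵ ⟅ p , p ⟆ → a ≈ x × b ≈ nat 0
    only m = pair-injective ([ id , id ]′ (ϵ-up⁻ m))

  -- A basic code carries a conjunction of literals, so a single literal is wrapped in a conjunction
  -- with one member; `tag 6` marks conjunctions of formulas.
  literalCode : 𝕊 → 𝕊 → 𝕊
  literalCode φ t = tag 0 ⟨ tag 6 ⟅ φ , φ ⟆ , t ⟩

  private
    in-singleton : ∀ {x y} → x ∈ ⟅ y , y ⟆ → y ≈ x
    in-singleton m = ≈-sym ([ id , id ]′ (ϵ-up⁻ (↑∈ m)))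

    conjunct : ∀ {n φ} → Formula n φ → Formula n (tag 6 ⟅ φ , φ ⟆)
    conjunct {φ = φ} d = conj ⟅ φ , φ ⟆ (tag⁻ 6 _ ≈-refl) (V-up (Fm⇒V d) (Fm⇒V d)) (card-singleton (Fm⇒V d))
      (λ ψ m → Fm-resp (in-singleton m) d)

  literal : ∀ {n φ} (d : Formula n φ) → IsLiteral V L X κ d → {xs : Vec 𝕊 n} → All (_∈ X) xs →
    BorelCode (literalCode φ (tuple xs))
  literal {φ = φ} d l {xs} ms = basic (conjunct d)
    ((φ ∷ [] , λ y m → here (↓≐ (≈-sym (in-singleton m)))) , λ ψ m → Fm-resp-literal (in-singleton m) d l)
    xs ms (basic⁻ _ xs ≈-refl)

  literal-⊩ : ∀ {n φ} (d : Formula n φ) l {xs : Vec 𝕊 n} (ms : All (_∈ X) xs) N →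
    (N ⊩⟨ literal d l ms ⟩) ⇔ (N ⊨⟨ d ⟩ xs)
  literal-⊩ {φ = φ} d l {xs} ms N = mk⇔
    (λ h → ↓∈ (ϵ-upˡ {φ} {φ} ≈-refl) ▹ λ m → subst id (Fm-resp-⊨ (in-singleton m) d N xs) (h φ m))
    (λ h ψ m → subst id (sym (Fm-resp-⊨ (in-singleton m) d N xs)) h)

  private
    -- The members of a formal conjunction have to be enumerated by all of κ: index 0 is sent to `x`
    -- and every other index to `y`.
    two-valued : ∀ {x y} → V x → V y → Enumerated V κ ⟅ x , y ⟆
    two-valued {x} {y} Vx Vy =
      product Vκ (V-up Vx Vy) ▹ λ (P , VP , hP) →
      sep (∃V ((v0 ≐ᵗ ∅ᵗ ∧ᵗ v1 ≐ᵗ ⟨ v0 , con x Vx ⟩ᵗ) ∨ᵗ ((¬ᵗ (v0 ≐ᵗ ∅ᵗ)) ∧ᵗ v1 ≐ᵗ ⟨ v0 , con y Vy ⟩ᵗ))) VP ▹ λ (f , Vf , hf) →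
      f , Vf , function⁻ {Q = λ _ b → b ϵ ⟅ x , y ⟆}
        ( (λ p m → to (hP p) (proj₁ (to (hf p) m)))
        , (λ i m → total hP hf i m (lem {i ≈ ∅}))
        , (λ i a b m n → unique (proj₂ (to (hf _) m)) (proj₂ (to (hf _) n)))) (λ _ _ _ m → m) ,
      λ a m → onto hP hf a (ϵ-up⁻ (↑∈ m))
      where
      Entry : 𝕊 → Set₁
      Entry p = ∃[ i ] (V i × ((i ≈ ∅ × p ≈ ⟨ i , x ⟩) ⊎ ((¬ i ≈ ∅) × p ≈ ⟨ i , y ⟩)))
      module _ {P f} (hP : ∀ p → p ϵ P ⇔ (∃[ i ] ∃[ z ] (i ϵ κ × z ϵ ⟅ x , y ⟆ × p ≈ ⟨ i , z ⟩)))
                 (hf : ∀ p → p ϵ f ⇔ (p ϵ P × Entry p)) where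
        total : ∀ i → i ϵ κ → Dec (i ≈ ∅) → ∃[ b ] ⟨ i , b ⟩ ϵ f
        total i m (yes e) = x , from (hf _) (from (hP _) (i , x , m , ϵ-upˡ ≈-refl , ≈-refl) , i , V-ϵ Vκ m , inj₁ (e , ≈-refl))
        total i m (no ¬e) = y , from (hf _) (from (hP _) (i , y , m , ϵ-upʳ ≈-refl , ≈-refl) , i , V-ϵ Vκ m , inj₂ (¬e , ≈-refl))
        onto : ∀ a → a ≈ x ⊎ a ≈ y → ∃[ i ] (i ∈ κ × D.⟨ i , a ⟩ ∈ f)
        onto a (inj₁ e) = nat 0 , ↓∈ (nat-ϵ-κ 0) , pair∈⁻ (nat 0) a (from (hf _)
          (from (hP _) (nat 0 , a , nat-ϵ-κ 0 , ϵ-upˡ e , ≈-refl) , nat 0 , V-nat 0 , inj₁ (≈-refl , pair-cong ≈-refl e)))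
        onto a (inj₂ e) = nat 1 , ↓∈ (nat-ϵ-κ 1) , pair∈⁻ (nat 1) a (from (hf _)
          (from (hP _) (nat 1 , a , nat-ϵ-κ 1 , ϵ-upʳ e , ≈-refl) , nat 1 , V-nat 1 ,
           inj₂ ((λ e → ∅≉⁺ (≈-sym e)) , pair-cong ≈-refl e)))
      unique : ∀ {i a b} → Entry ⟨ i , a ⟩ → Entry ⟨ i , b ⟩ → a ≈ b
      unique (_ , _ , inj₁ (_ , p)) (_ , _ , inj₁ (_ , q)) =
        ≈-trans (proj₂ (pair-injective p)) (≈-sym (proj₂ (pair-injective q)))
      unique (_ , _ , inj₂ (_ , p)) (_ , _ , inj₂ (_ , q)) =
        ≈-trans (proj₂ (pair-injective p)) (≈-sym (proj₂ (pair-injective q)))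
      unique (_ , _ , inj₁ (e , p)) (_ , _ , inj₂ (k , q)) =
        ⊥-elim (k (≈-trans (≈-sym (proj₁ (pair-injective q))) (≈-trans (proj₁ (pair-injective p)) e)))
      unique (_ , _ , inj₂ (k , p)) (_ , _ , inj₁ (e , q)) =
        ⊥-elim (k (≈-trans (≈-sym (proj₁ (pair-injective p))) (≈-trans (proj₁ (pair-injective q)) e)))

    difference-def : ∀ {γ ζ} → tag 3 ⟅ γ , tag 1 ζ ⟆ ≡ D.tag 3 D.⟅ γ , D.tag 1 ζ ⟆
    difference-def {γ} = trans (tag-def 3) (cong (D.tag 3) (trans ⟅⟆-def (cong D.⟅ γ ,_⟆ (tag-def 1))))

    part : ∀ {γ ζ} → BorelCode γ → BorelCode ζ → ∀ δ → δ ≈ γ ⊎ δ ≈ tag 1 ζ → BorelCode δ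
    part c k δ (inj₁ e) = Code-resp (≈-sym e) c
    part {ζ = ζ} c k δ (inj₂ e) = neg ζ (tag⁻ 1 ζ e) k

  difference : ∀ {γ ζ} → BorelCode γ → BorelCode ζ → BorelCode (D.tag 3 D.⟅ γ , D.tag 1 ζ ⟆)
  difference {γ} {ζ} c k = conj ⟅ γ , tag 1 ζ ⟆
    (↓≐ (≈-trans (≈-sym (≈-reflexive difference-def)) (≈-reflexive (tag-def 3))))
    (V-up (Code⇒V c) (V-tag 1 (Code⇒V k)))
    (two-valued (Code⇒V c) (V-tag 1 (Code⇒V k)))
    (λ δ m → part c k δ (ϵ-up⁻ (↑∈ m)))

  -- Stated for an arbitrary derivation `δ` because a proof of `γ ≼ ζ` brings its own derivation
  -- that the difference is a code.
  difference-⊩ : ∀ {γ ζ} (c : BorelCode γ) (k : BorelCode ζ) {γ∧¬ζ : 𝕊} (δ : BorelCode γ∧¬ζ) →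
    γ∧¬ζ ≈ D.tag 3 D.⟅ γ , D.tag 1 ζ ⟆ → ∀ {N} → N ϵ Str → (N ⊩⟨ δ ⟩) ⇔ (N ⊩⟨ c ⟩ × ¬ (N ⊩⟨ k ⟩))
  difference-⊩ {γ} {ζ} c k δ e {N} n = mk⇔
    (λ h → ⊩-invariant δ (difference c k) e n h ▹ λ h′ →
      ↓∈ (ϵ-upˡ {γ} {tag 1 ζ} ≈-refl) ▹ λ m → ↓∈ (ϵ-upʳ {γ} {tag 1 ζ} ≈-refl) ▹ λ m′ →
      ⊩-invariant (part c k γ (ϵ-up⁻ (↑∈ m))) c ≈-refl n (h′ γ m) ,
      ⊩-invariant (part c k (tag 1 ζ) (ϵ-up⁻ (↑∈ m′))) negk ≈-refl n (h′ (tag 1 ζ) m′))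
    (λ (h , h′) → ⊩-invariant (difference c k) δ (≈-sym e) n λ ζ′ m →
      [ (λ e → ⊩-invariant c (part c k ζ′ (ϵ-up⁻ (↑∈ m))) (≈-sym e) n h)
      , (λ e → ⊩-invariant negk (part c k ζ′ (ϵ-up⁻ (↑∈ m))) (≈-sym e) n h′) ]′ (ϵ-up⁻ (↑∈ m)))
    where
    negk : BorelCode (tag 1 ζ)
    negk = neg ζ (tag⁻ 1 ζ ≈-refl) k

-- Every measurable set of V is the interpretation of a code.

module Coding (setting : Setting) where
  open Codes setting public

  private
    x₀≠x₀ : Formula 1 (tag 2 (tag 1 ⟨ nat 0 , nat 0 ⟩))
    x₀≠x₀ = neg (tag 1 ⟨ nat 0 , nat 0 ⟩) (tag⁻ 2 _ ≈-refl) (eq zero zero (tag⁻ 1 _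
      (≈-reflexive (cong (tag 1) (trans ⟨⟩-def (cong₂ D.⟨_,_⟩ (nat-def 0) (nat-def 0)))))))

    falsum : BorelCode _
    falsum = literal x₀≠x₀ tt (↓∈ x₀ϵX ∷ [])

    ⊮falsum : ∀ {N} → ¬ (N ⊩⟨ falsum ⟩)
    ⊮falsum {N} h = to (literal-⊩ x₀≠x₀ tt (↓∈ x₀ϵX ∷ []) N) h (lift (≐-refl x₀))

    ⊥-code : 𝕊
    ⊥-code = literalCode (tag 2 (tag 1 ⟨ nat 0 , nat 0 ⟩)) (tuple (x₀ ∷ []))

    V-⊥-code : V ⊥-code
    V-⊥-code = Code⇒V falsum

    atomicᵗ : ∀ {n} → Tm n → Tm n → Tm n → Tm n
    atomicᵗ R v t = tagᵗ 0 ⟨ tagᵗ 6 ⟅ tagᵗ 0 ⟨ R , v ⟩ᵗ , tagᵗ 0 ⟨ R , v ⟩ᵗ ⟆ᵗ , t ⟩ᵗ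

    falsumᵗ relationᵗ complementᵗ unionᵗ functionᵗ : Fo 2
    falsumᵗ = v0 ≐ᵗ ⟨ con ⊥-code V-⊥-code , ∅ᵗ ⟩ᵗ
    -- The bound variables are, from the outside, the symbol, its arity, the tuple of indices, the
    -- tuple of parameters, its length, the entries selected by the indices, and the interpretation.
    relationᵗ = ∃V (∃V (∃V (∃V (∃V (∃V (∃V (
      v7 ≐ᵗ ⟨ atomicᵗ v6 v4 v3 , v0 ⟩ᵗ ∧ᵗ
      ⟨ v6 , v5 ⟩ᵗ ∈ᵗ con L VL ∧ᵗ v2 ∈ᵗ con ω V-ω ∧ᵗ
      app (derᵗ tuplesᵗ) (⟨ v2 , v3 ⟩ᵗ ∷ []) ∧ᵗ
      app (derᵗ lookupsᵗ) (⟨ v5 , ⟨ v4 , ⟨ v3 , v1 ⟩ᵗ ⟩ᵗ ⟩ᵗ ∷ []) ∧ᵗ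
      ∀V ((v0 ∈ᵗ v1) ⇔ᵗ ((v0 ∈ᵗ con Str V-Str) ∧ᵗ
        app (derᵗ satᵗ) (⟨ tagᵗ 0 ⟨ v7 , v5 ⟩ᵗ , ⟨ v4 , ⟨ v0 , natᵗ 1 ⟩ᵗ ⟩ᵗ ⟩ᵗ ∷ []))))))))))
    complementᵗ = ∃V (∃V (∃V (
      v3 ≐ᵗ ⟨ tagᵗ 1 v2 , v0 ⟩ᵗ ∧ᵗ ⟨ v2 , v1 ⟩ᵗ ∈ᵗ v4 ∧ᵗ
      ∀V ((v0 ∈ᵗ v1) ⇔ᵗ ((v0 ∈ᵗ con Str V-Str) ∧ᵗ ¬ᵗ (v0 ∈ᵗ v2))))))
    -- h, W: h is a function from κ to W
    functionᵗ =
      ∀∈ v0 (∃∈ (con κ Vκ) (∃∈ v3 (v2 ≐ᵗ ⟨ v1 , v0 ⟩ᵗ))) ∧ᵗ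
      (∀∈ (con κ Vκ) (∃V (⟨ v1 , v0 ⟩ᵗ ∈ᵗ v2)) ∧ᵗ
      ∀V (∀V (∀V (⟨ v2 , v1 ⟩ᵗ ∈ᵗ v3 ⇒ᵗ ⟨ v2 , v0 ⟩ᵗ ∈ᵗ v3 ⇒ᵗ v1 ≐ᵗ v0))))
    -- The function `h` lists pairs of a code and its interpretation. Both `Γ` and the union are
    -- read off from it, as the first components and the union of the second ones.
    unionᵗ = ∃V (∃V (∃V (
      v3 ≐ᵗ ⟨ tagᵗ 2 v2 , v0 ⟩ᵗ ∧ᵗ app functionᵗ (v1 ∷ v4 ∷ []) ∧ᵗ
      ∀V ((v0 ∈ᵗ v3) ⇔ᵗ ∃V (∃V (⟨ v1 , ⟨ v2 , v0 ⟩ᵗ ⟩ᵗ ∈ᵗ v4))) ∧ᵗ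
      ∀V ((v0 ∈ᵗ v1) ⇔ᵗ ∃V (∃V (∃V (⟨ v2 , ⟨ v1 , v0 ⟩ᵗ ⟩ᵗ ∈ᵗ v5 ∧ᵗ v3 ∈ᵗ v0)))))))

  -- Pairs ⟨c , A⟩ where c is a code built from a restricted stock of basic codes
  -- and A is its interpretation in V.
  codᵗ : Fo 2
  codᵗ = falsumᵗ ∨ᵗ relationᵗ ∨ᵗ complementᵗ ∨ᵗ unionᵗ

  Cod : 𝕊 → 𝕊 → Set₁
  Cod c A = Der codᵗ ⟨ c , A ⟩

  cod-mono : Monotone codᵗ
  cod-mono w W W′ s = map⊎₂ (map⊎₂ (map⊎
    (λ (c , Vc , A′ , VA′ , A , VA , e , m , h) → c , Vc , A′ , VA′ , A , VA , e , s _ m , h)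
    (λ (Γ , VΓ , h , Vh , A , VA , e , (g , t , u) , k) → Γ , VΓ , h , Vh , A , VA , e ,
      ((λ p m → g p m ▹ λ (i , iκ , q , qW , e) → i , iκ , q , s q qW , e) , t , u) , k)))

  Interprets : 𝕊 → 𝕊 → Set₁
  Interprets c A = Σ[ k ∈ BorelCode c ] (∀ N → N ϵ A ⇔ (N ϵ Str × N ⊩⟨ k ⟩))

  private
    interprets-resp : ∀ {c c′ A A′} → c ≈ c′ → A ≈ A′ → Interprets c A → Interprets c′ A′
    interprets-resp {c} {c′} e f (k , h) = Code-resp e k , λ N → mk⇔
      (λ m → to (h N) (ϵ-respʳ (≈-sym f) m) ▹ λ (n , g) → n , ⊩-invariant k (Code-resp e k) e n g)
      (λ (n , g) → ϵ-respʳ f (from (h N) (n , ⊩-invariant (Code-resp e k) k (≈-sym e) n g)))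

    cod-pair : ∀ {q} → Der codᵗ q → ∃[ c ] ∃[ A ] q ≈ ⟨ c , A ⟩
    cod-pair d = der-inversion codᵗ d ▹ λ
      { (W , inj₁ e , _) → _ , _ , e
      ; (W , inj₂ (inj₁ (_ , _ , _ , _ , _ , _ , _ , _ , _ , _ , _ , _ , A , _ , e , _)) , _) → _ , _ , e
      ; (W , inj₂ (inj₂ (inj₁ (_ , _ , _ , _ , A , _ , e , _))) , _) → _ , _ , e
      ; (W , inj₂ (inj₂ (inj₂ (_ , _ , _ , _ , A , _ , e , _))) , _) → _ , _ , e }

    interprets-relation : ∀ {c A W} → ⟦ relationᵗ ⟧ (⟨ c , A ⟩ ∷ W ∷ []) → Interprets c A
    interprets-relation {c} {A} (R , VR , j , Vj , v , Vv , t , Vt , n , Vn , u , Vu , B , VB , e , mR , mn , ht , hl , hB) =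
      symbol-nat mR ▹ λ (k , ej) →
      ϵ-ω⁻ mn ▹ λ (n′ , en) →
      IsTuple-elim n′ en ht ▹ λ (xs , ms , et) →
      Lookups-elim k xs ej et hl ▹ λ (vs , ev , _) →
      symbol⁻ R k (ϵ-respˡ (pair-cong ≈-refl ej) mR) ▹ λ mR′ →
      pair-injective e ▹ λ (e₁ , e₂) →
      finish {vs = vs} (rel k R vs mR′ (rel⁻ R vs ≈-refl)) tt ms ev et e₁ e₂
      where
      rel⁻ : ∀ {φ n k} R (vs : Vec (Fin n) k) → φ ≈ tag 0 ⟨ R , indices vs ⟩ →
        φ ≐ D.tag 0 D.⟨ R , D.tuple (map (D.nat ∘ toℕ) vs) ⟩
      rel⁻ R vs e = tag⁻ 0 _ (≈-trans e (≈-reflexive (cong (tag 0) (trans ⟨⟩-def (cong D.⟨ R ,_⟩ (indices-def vs))))))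

      finish : ∀ {n k} {vs : Vec (Fin n) k} (d : Formula n (tag 0 ⟨ R , indices vs ⟩)) → IsLiteral V L X κ d →
        {xs : Vec 𝕊 n} → All (_∈ X) xs → v ≈ indices vs → t ≈ tuple xs →
        c ≈ literalCode (tag 0 ⟨ R , v ⟩) t → A ≈ B → Interprets c A
      finish d l {xs} ms ev et e₁ e₂ = interprets-resp
        (≈-sym (≈-trans e₁ (pair-cong ≈-refl (pair-cong (pair-cong ≈-refl
          (up-cong (pair-cong ≈-refl (pair-cong ≈-refl ev)) (pair-cong ≈-refl (pair-cong ≈-refl ev)))) et))))
        (≈-sym e₂)
        (literal d l ms , λ N → mk⇔
          (λ m → proj₁ (hB N (V-ϵ VB m)) m ▹ λ (n , h) → n , from (literal-⊩ d l ms N)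
            (to (Sat-⇔ true d ms N n) (Der-resp satᵗ (same N) h)))
          (λ (n , h) → proj₂ (hB N (V-ϵ V-Str n)) (n , Der-resp satᵗ (≈-sym (same N))
            (from (Sat-⇔ true d ms N n) (to (literal-⊩ d l ms N) h)))))
        where
        same : ∀ N → _ ≈ _
        same N = pair-cong (pair-cong ≈-refl (pair-cong ≈-refl ev)) (pair-cong et (≈-refl {⟨ N , nat 1 ⟩}))

    interprets-complement : ∀ {c c′ A A′ B} → c ≈ tag 1 c′ → A ≈ B → V B → Interprets c′ A′ →
      (∀ N → V N → (N ϵ B → N ϵ Str × ¬ N ϵ A′) × (N ϵ Str × ¬ N ϵ A′ → N ϵ B)) → Interprets c A
    interprets-complement {c′ = c′} e f VB (k , h) hB = neg c′ (tag⁻ 1 c′ e) k , λ N → mk⇔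
      (λ m → proj₁ (hB N (V-ϵ VB (ϵ-respʳ f m))) (ϵ-respʳ f m) ▹ λ (n , g) → n , λ g′ → g (from (h N) (n , g′)))
      (λ (n , g) → ϵ-respʳ (≈-sym f) (proj₂ (hB N (V-ϵ V-Str n)) (n , λ g′ → g (proj₂ (to (h N) g′)))))

    module _ {h W : 𝕊} (Vh : V h) (func : ⟦ functionᵗ ⟧ (h ∷ W ∷ [])) where

      h-graph : IsGraph κ h (λ _ q → q ϵ W)
      h-graph = (λ p m → proj₁ func p m ▹ λ (i , iκ , q , qW , e) → i , q , iκ , qW , e) ,
        (λ i iκ → proj₁ (proj₂ func) i iκ ▹ λ (q , _ , m) → q , m) ,
        (λ i q q′ m n → V-pair⁻ (V-ϵ Vh m) ▹ λ (Vi , Vq) →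
          proj₂ (proj₂ func) i Vi q Vq q′ (proj₂ (V-pair⁻ (V-ϵ Vh n))) m n)

      h-value : ∀ {i q} → ⟨ i , q ⟩ ϵ h → i ϵ κ × q ϵ W
      h-value = graph-value h-graph (λ _ e m → ϵ-respˡ e m)

      -- Forgetting the interpretations in `h` leaves an enumeration of `Γ` by κ. That the values of
      -- `h` are pairs at all follows from their being derivable.
      enumerated : ∀ {Γ} → V Γ → (∀ q → q ϵ W → Der codᵗ q) →
        (∀ c → V c → (c ϵ Γ → ∃[ i ] (V i × ∃[ B ] (V B × ⟨ i , ⟨ c , B ⟩ ⟩ ϵ h))) ×
                     (∃[ i ] (V i × ∃[ B ] (V B × ⟨ i , ⟨ c , B ⟩ ⟩ ϵ h)) → c ϵ Γ)) → Enumerated V κ Γ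
      enumerated {Γ} VΓ dW hΓ =
        repl (∃V (∃V (∃V (v3 ≐ᵗ ⟨ v2 , ⟨ v1 , v0 ⟩ᵗ ⟩ᵗ ∧ᵗ v4 ≐ᵗ ⟨ v2 , v1 ⟩ᵗ)))) Vh
          (λ p y z _ _ _ (i , _ , c , _ , B , _ , e , f) (i′ , _ , c′ , _ , B′ , _ , e′ , f′) →
            pair-injective (≈-trans (≈-sym e) e′) ▹ λ (e₁ , e₂) →
            ≈-trans f (≈-trans (pair-cong e₁ (proj₁ (pair-injective e₂))) (≈-sym f′))) ▹ λ (f , Vf , hf) →
        f , Vf , function⁻ {Q = λ _ c → c ϵ Γ}
          ( (λ p m → to (hf p (V-ϵ Vf m)) m ▹ λ (w , wh , i , Vi , c , Vc , B , VB , e , e′) →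
              ϵ-respˡ e wh ▹ λ m′ → i , c , proj₁ (h-value m′) , proj₂ (hΓ c Vc) (i , Vi , B , VB , m′) , e′)
          , (λ i iκ → proj₁ (proj₂ func) i iκ ▹ λ (q , Vq , m) →
              cod-pair (dW q (proj₂ (h-value m))) ▹ λ (c , B , e) →
              V-pair⁻ (V-resp e Vq) ▹ λ (Vc , VB) →
              c , from (hf _ (V-pair (V-ϵ Vκ iκ) Vc)) (_ , m , i , V-ϵ Vκ iκ , c , Vc , B , VB , pair-cong ≈-refl e , ≈-refl))
          , (λ i c c′ m m′ →
              to (hf _ (V-ϵ Vf m)) m ▹ λ (w , wh , j , _ , d , _ , B , _ , e , f) →
              to (hf _ (V-ϵ Vf m′)) m′ ▹ λ (w′ , wh′ , j′ , _ , d′ , _ , B′ , _ , e′ , f′) →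
              pair-injective f ▹ λ (f₁ , f₂) → pair-injective f′ ▹ λ (f₁′ , f₂′) →
              ϵ-respˡ (≈-trans e (pair-cong (≈-sym f₁) (pair-cong (≈-sym f₂) ≈-refl))) wh ▹ λ k →
              ϵ-respˡ (≈-trans e′ (pair-cong (≈-sym f₁′) (pair-cong (≈-sym f₂′) ≈-refl))) wh′ ▹ λ k′ →
              proj₁ (pair-injective (proj₂ (proj₂ h-graph) i _ _ k k′)))) (λ _ _ _ m → m) ,
        λ c m → proj₁ (hΓ c (V-ϵ VΓ (↑∈ m))) (↑∈ m) ▹ λ (i , Vi , B , VB , k) →
          i , ↓∈ (proj₁ (h-value k)) , pair∈⁻ i c (from (hf _ (V-pair Vi (V-ϵ VΓ (↑∈ m))))
            (_ , k , i , Vi , c , V-ϵ VΓ (↑∈ m) , B , VB , ≈-refl , ≈-refl))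

      interprets-union : ∀ {c Γ A B} → c ≈ tag 2 Γ → V Γ → A ≈ B → V B → (∀ q → q ϵ W → Der codᵗ q) →
        (∀ c′ A′ → c′ ϵ Γ → Cod c′ A′ → Interprets c′ A′) →
        (∀ c → V c → (c ϵ Γ → ∃[ i ] (V i × ∃[ B ] (V B × ⟨ i , ⟨ c , B ⟩ ⟩ ϵ h))) ×
                     (∃[ i ] (V i × ∃[ B ] (V B × ⟨ i , ⟨ c , B ⟩ ⟩ ϵ h)) → c ϵ Γ)) →
        (∀ N → V N → (N ϵ B → ∃[ i ] (V i × ∃[ c ] (V c × ∃[ A′ ] (V A′ × ⟨ i , ⟨ c , A′ ⟩ ⟩ ϵ h × N ϵ A′)))) ×
                     (∃[ i ] (V i × ∃[ c ] (V c × ∃[ A′ ] (V A′ × ⟨ i , ⟨ c , A′ ⟩ ⟩ ϵ h × N ϵ A′))) → N ϵ B)) →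
        Interprets c A
      interprets-union {c} {Γ} {A} {B} e VΓ f VB dW IH hΓ hB =
        disj Γ (tag⁻ 2 Γ e) VΓ (enumerated VΓ dW hΓ) (λ ζ m → proj₁ (proj₂ (proj₂ (member ζ (↑∈ m))))) , λ N → mk⇔
          (λ m → proj₁ (hB N (V-ϵ VB (ϵ-respʳ f m))) (ϵ-respʳ f m) ▹ λ (i , Vi , c′ , Vc′ , A′ , VA′ , k , n) →
            proj₂ (hΓ c′ Vc′) (i , Vi , A′ , VA′ , k) ▹ λ c′Γ →
            IH c′ A′ c′Γ (dW _ (proj₂ (h-value k))) ▹ λ (code , hA′) →
            to (hA′ N) n ▹ λ (nS , g) →
            nS , c′ , ↓∈ c′Γ , ⊩-invariant code (proj₁ (proj₂ (proj₂ (member c′ (↑∈ (↓∈ c′Γ)))))) ≈-refl nS g)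
          (λ (nS , c′ , m , g) → member c′ (↑∈ m) ▹ λ (A′ , (i , Vi , VA′ , k) , code , hA′) →
            ϵ-respʳ (≈-sym f) (proj₂ (hB N (V-ϵ V-Str nS)) (i , Vi , c′ , V-ϵ VΓ (↑∈ m) , A′ , VA′ , k , from (hA′ N)
              (nS , ⊩-invariant (proj₁ (proj₂ (proj₂ (member c′ (↑∈ m))))) code ≈-refl nS g))))
        where
        member : ∀ c′ → c′ ϵ Γ → ∃[ A′ ] ((∃[ i ] (V i × V A′ × ⟨ i , ⟨ c′ , A′ ⟩ ⟩ ϵ h)) × Interprets c′ A′)
        member c′ m = proj₁ (hΓ c′ (V-ϵ VΓ m)) m ▹ λ (i , Vi , A′ , VA′ , k) →
          A′ , (i , Vi , VA′ , k) , IH c′ A′ m (dW _ (proj₂ (h-value k)))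

  -- The codes from which `c` is built lie below it in `⊏`. Induction along this relation shows that
  -- even a circular set of justifications contains only correct facts.
  Cod-sound : ∀ c A → Cod c A → Interprets c A
  Cod-sound = ⊏-induction _ λ c IH A d → der-inversion codᵗ d ▹ λ (W , h , dW) → cases c IH A W dW h
    where
    cases : ∀ c → (∀ c′ → c′ ⊏ c → ∀ A → Cod c′ A → Interprets c′ A) → ∀ A W → (∀ q → q ϵ W → Der codᵗ q) →
      ⟦ codᵗ ⟧ (⟨ c , A ⟩ ∷ W ∷ []) → Interprets c A
    cases c IH A W dW (inj₁ e) = pair-injective e ▹ λ (e₁ , e₂) →
      interprets-resp (≈-sym e₁) (≈-sym e₂) (falsum , λ N → mk⇔ (λ m → ⊥-elim (∉∅ m)) (λ (_ , g) → ⊥-elim (⊮falsum {N} g)))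
    cases c IH A W dW (inj₂ (inj₁ r)) = interprets-relation {c} {A} {W} r
    cases c IH A W dW (inj₂ (inj₂ (inj₁ (c′ , _ , A′ , _ , B , VB , e , m , hB)))) = pair-injective e ▹ λ (e₁ , e₂) →
      interprets-complement e₁ e₂ VB (IH c′ (⊏-tag 1 e₁) A′ (dW _ m)) hB
    cases c IH A W dW (inj₂ (inj₂ (inj₂ (Γ , VΓ , h , Vh , B , VB , e , func , hΓ , hB)))) = pair-injective e ▹ λ (e₁ , e₂) →
      interprets-union Vh func e₁ VΓ e₂ VB dW (λ c′ A′ m d → IH c′ (⊏-trans (elem m) (⊏-tag 2 e₁)) A′ d) hΓ hB

  Coded : 𝕊 → Set₁
  Coded A = ∃[ c ] Cod c A

  Coded-resp : ∀ {A A′} → A ≈ A′ → Coded A → Coded A′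
  Coded-resp e (c , d) = c , Der-resp codᵗ (pair-cong ≈-refl e) d

  Coded-∅ : Coded ∅
  Coded-∅ = ⊥-code , der-intro₀ codᵗ cod-mono (V-pair V-⊥-code V-∅) (inj₁ ≈-refl)

  Coded-complement : ∀ {A B} → V B → (∀ N → N ϵ B ⇔ (N ϵ Str × ¬ N ϵ A)) → Coded A → Coded B
  Coded-complement {A} {B} VB h (c , d) = V-pair⁻ (Der⇒V codᵗ d) ▹ λ (Vc , VA) →
    tag 1 c , der-intro₁ codᵗ cod-mono (V-pair (V-tag 1 Vc) VB) d
      (inj₂ (inj₂ (inj₁ (c , Vc , A , VA , B , VB , ≈-refl , ϵ-upˡ ≈-refl , λ N _ → to (h N) , from (h N)))))

  Coded-relation : ∀ {n φ A} (d : Formula n φ) k R vs m e → d ≡ rel k R vs m e → {xs : Vec 𝕊 n} → All (_∈ X) xs →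
    Denotes A (λ N → N ⊨⟨ d ⟩ xs) → Coded A
  Coded-relation {n} {A = A} d k R vs m e refl {xs} ms (VA , h) =
    proj₁ (V-pair⁻ (V-ϵ VL (symbol⁺ R k m))) ▹ λ VR →
    V-tag 0 (V-pair VR (V-indices vs)) ▹ λ Vφ →
    ∈X⇒V ms ▹ λ Vxs →
    _ , der-intro₀ codᵗ cod-mono
      (V-pair (V-tag 0 (V-pair (V-tag 6 (V-up Vφ Vφ)) (V-tuple Vxs))) VA)
      (inj₂ (inj₁ (R , VR , nat k , V-nat k , _ , V-indices vs , _ , V-tuple Vxs , nat n , V-nat n , _ , V-lookups Vxs vs ,
        A , VA , ≈-refl , symbol⁺ R k m , nat-ϵ-ω n , IsTuple-intro ms , Lookups-intro Vxs vs ,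
        λ N _ → (λ k → to (h N) k ▹ λ (nS , g) → nS , Der-resp satᵗ (pair-cong (rel⁺ R vs e) ≈-refl) (from (Sat-⇔ true d ms N nS) g)) ,
                (λ (nS , g) → from (h N) (nS , to (Sat-⇔ true d ms N nS) (Der-resp satᵗ (pair-cong (≈-sym (rel⁺ R vs e)) ≈-refl) g))))))

  -- The truth of an equality between elements of `X` is independent of the structure, so its class
  -- is empty or all of `Str` and comes from the contradictory code. Only relational atoms call for
  -- basic codes of their own.
  Coded-literal : ∀ {n φ} (d : Formula n φ) → IsLiteral V L X κ d → {xs : Vec 𝕊 n} → All (_∈ X) xs →
    ∀ {A} → Denotes A (λ N → N ⊨⟨ d ⟩ xs) → Coded A
  Coded-literal d@(rel k R vs m e) l ms hA = Coded-relation d k R vs m e refl ms hA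
  Coded-literal (eq i j e) l {xs} ms {A} (VA , h) = decide (lem {lookup xs i ≈ lookup xs j})
    where
    decide : Dec (lookup xs i ≈ lookup xs j) → Coded A
    decide (yes p) = Coded-complement VA (λ N → mk⇔ (λ m → proj₁ (to (h N) m) , ∉∅)
      (λ (nS , _) → from (h N) (nS , lift (↓≐ p)))) Coded-∅
    decide (no ¬p) = Coded-resp (ext (λ N m → ⊥-elim (∉∅ m)) (λ N m → ⊥-elim (¬p (↑≐ (lower (proj₂ (to (h N) m))))))) Coded-∅
  Coded-literal (neg ψ e d) l {xs} ms (VA , h) =
    cut (satAtᵗ true (Fm⇒V d) (V-tuple (∈X⇒V ms))) ▹ λ (B , dB) →
    denotes-resp (Sat-⇔ true d ms) dB ▹ λ dB′ →
    Coded-complement VA (λ N → mk⇔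
      (λ m → to (h N) m ▹ λ (nS , g) → nS , λ b → g (proj₂ (to (proj₂ dB′ N) b)))
      (λ (nS , g) → from (h N) (nS , λ k → g (from (proj₂ dB′ N) (nS , k)))))
      (Coded-literal d l ms dB′)

  -- Choice picks codes for all members of `U` simultaneously. Since `f` only injects `U` into κ
  -- while the family of a code is indexed by all of κ, the indices that are not attained receive a
  -- code of the empty set.
  Coded-union : ∀ {U A} → V U → Card≤ V U κ → V A → (∀ N → N ϵ A ⇔ (∃[ B ] (B ϵ U × N ϵ B))) →
    (∀ B → B ϵ U → Coded B) → Coded A
  Coded-union {U} {A} VU card VA hA coded =
    card⁺ card ▹ λ (f , Vf , F , inj) →
    choice-function (assignᵗ f Vf) Vκ (λ i iκ → assign f Vf i iκ (lem {∃[ B ] (B ϵ U × ⟨ B , i ⟩ ϵ f)})) ▹ λ (h , Vh , H) →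
    repl (∃V (∃V (v2 ≐ᵗ ⟨ v1 , ⟨ v3 , v0 ⟩ᵗ ⟩ᵗ))) Vh
      (λ p c c′ _ _ _ (_ , _ , _ , _ , e) (_ , _ , _ , _ , e′) →
        proj₁ (pair-injective (proj₂ (pair-injective (≈-trans (≈-sym e) e′))))) ▹ λ (Γ , VΓ , hΓ) →
    repl (∃V (v1 ≐ᵗ ⟨ v0 , v2 ⟩ᵗ)) Vh
      (λ p q q′ _ _ _ (_ , _ , e) (_ , _ , e′) → proj₂ (pair-injective (≈-trans (≈-sym e) e′))) ▹ λ (W , VW , hW) →
    tag 2 Γ , der-intro codᵗ cod-mono (V-pair (V-tag 2 VΓ) VA) VW
      (λ q m → to (hW q (V-ϵ VW m)) m ▹ λ (p , ph , i , Vi , e) →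
        value f Vf H (ϵ-respˡ e ph) ▹ λ (iκ , c , _ , B , _ , e′ , d , _) → Der-resp codᵗ (≈-sym e′) d)
      (inj₂ (inj₂ (inj₂ (Γ , VΓ , h , Vh , A , VA , ≈-refl ,
        ((λ p m → proj₁ H p m ▹ λ (i , q , iκ , _ , e) → V-pair⁻ (V-resp e (V-ϵ Vh m)) ▹ λ (Vi , Vq) →
            i , iκ , q , from (hW q Vq) (p , m , i , Vi , e) , e) ,
         (λ i iκ → proj₁ (proj₂ H) i iκ ▹ λ (q , m) → q , proj₂ (V-pair⁻ (V-ϵ Vh m)) , m) ,
         (λ i _ q _ q′ _ m m′ → proj₂ (proj₂ H) i q q′ m m′)) ,
        (λ c Vc → (λ m → to (hΓ c Vc) m ▹ λ (p , ph , i , Vi , B , VB , e) → i , Vi , B , VB , ϵ-respˡ e ph) ,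
          (λ (i , Vi , B , VB , m) → from (hΓ c Vc) (_ , m , i , Vi , B , VB , ≈-refl))) ,
        (λ N VN →
          (λ m → to (hA N) m ▹ λ (B , BU , n) →
            proj₁ (proj₂ F) B BU ▹ λ (i , Bi) →
            proj₂ (graph-value F (λ _ e k → ϵ-respˡ e k) Bi) ▹ λ iκ →
            proj₁ (proj₂ H) i iκ ▹ λ (q , qh) →
            value f Vf H qh ▹ λ (_ , c , Vc , B′ , VB′ , e , d , g) →
            i , V-ϵ Vκ iκ , c , Vc , B′ , VB′ , ϵ-respˡ (pair-cong ≈-refl e) qh , found inj BU Bi n g) ,
          (λ (i , Vi , c , Vc , B , VB , m , n) →
            value f Vf H m ▹ λ (_ , c′ , _ , B′ , _ , e , d , g) →
            from (hA N) (belongs g (ϵ-respʳ (proj₂ (pair-injective e)) n))))))))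
    where
    assignᵗ : ∀ f → V f → Fo 2
    assignᵗ f Vf = ∃V (∃V (v3 ≐ᵗ ⟨ v1 , v0 ⟩ᵗ ∧ᵗ app (derᵗ codᵗ) (⟨ v1 , v0 ⟩ᵗ ∷ []) ∧ᵗ
      ((v0 ∈ᵗ con U VU ∧ᵗ ⟨ v0 , v2 ⟩ᵗ ∈ᵗ con f Vf) ∨ᵗ
       ((¬ᵗ (∃∈ (con U VU) (⟨ v0 , v3 ⟩ᵗ ∈ᵗ con f Vf))) ∧ᵗ v0 ≐ᵗ ∅ᵗ))))

    assign : ∀ f Vf i → i ϵ κ → Dec (∃[ B ] (B ϵ U × ⟨ B , i ⟩ ϵ f)) → ∃[ q ] (V q × ⟦ assignᵗ f Vf ⟧ (i ∷ q ∷ []))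
    assign f Vf i iκ (yes (B , BU , Bi)) = coded B BU ▹ λ (c , d) → V-pair⁻ (Der⇒V codᵗ d) ▹ λ (Vc , VB) →
      ⟨ c , B ⟩ , V-pair Vc VB , c , Vc , B , VB , ≈-refl , d , inj₁ (BU , Bi)
    assign f Vf i iκ (no none) = Coded-∅ ▹ λ (c , d) → V-pair⁻ (Der⇒V codᵗ d) ▹ λ (Vc , VB) →
      ⟨ c , ∅ ⟩ , V-pair Vc VB , c , Vc , ∅ , VB , ≈-refl , d , inj₂ (none , ≈-refl)

    value : ∀ f Vf {h} → IsGraph κ h (λ i q → ⟦ assignᵗ f Vf ⟧ (i ∷ q ∷ [])) →
      ∀ {i q} → ⟨ i , q ⟩ ϵ h → i ϵ κ × ⟦ assignᵗ f Vf ⟧ (i ∷ q ∷ [])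
    value f Vf H m = graph-value H (λ e e′ → ⟦⟧-resp (assignᵗ f Vf) (e ∷ e′ ∷ [])) m

    found : ∀ {f} → (∀ a c b → ⟨ a , b ⟩ ϵ f → ⟨ c , b ⟩ ϵ f → a ≈ c) → ∀ {B B′ i N} → B ϵ U → ⟨ B , i ⟩ ϵ f → N ϵ B →
      (B′ ϵ U × ⟨ B′ , i ⟩ ϵ f) ⊎ ((¬ (∃[ B ] (B ϵ U × ⟨ B , i ⟩ ϵ f))) × B′ ≈ ∅) → N ϵ B′
    found inj {B} {B′} {i} BU Bi n (inj₁ (_ , B′i)) = ϵ-respʳ (inj B B′ i Bi B′i) n
    found inj BU Bi n (inj₂ (none , _)) = ⊥-elim (none (_ , BU , Bi))

    belongs : ∀ {f B i N} → (B ϵ U × ⟨ B , i ⟩ ϵ f) ⊎ ((¬ (∃[ B ] (B ϵ U × ⟨ B , i ⟩ ϵ f))) × B ≈ ∅) → N ϵ B →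
      ∃[ B ] (B ϵ U × N ϵ B)
    belongs (inj₁ (BU , _)) n = _ , BU , n
    belongs (inj₂ (_ , e)) n = ⊥-elim (∉∅ (ϵ-respʳ e n))

  -- This turns positive measurable sets into conditions, which the density argument needs after
  -- cutting a condition by a measurable set.
  Meas⇒Coded : ∀ {A} → Meas A → Coded A
  Meas⇒Coded (basic d l xs ms h) = Coded-literal d l ms (denotes⁺ h)
  Meas⇒Coded (compl B m h) = Coded-complement (proj₁ h)
    (λ N → mk⇔ (λ k → to (proj₂ h N) (↓∈ k) ▹ λ (VN , str , g) → from (ϵ-Str N) (VN , str) , λ b → g (↓∈ b))
      (λ (n , g) → to (ϵ-Str N) n ▹ λ (VN , str) → ↑∈ (from (proj₂ h N) (VN , str , λ b → g (↑∈ b)))))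
    (Meas⇒Coded m)
  Meas⇒Coded (union U VU card ms h) = Coded-union VU card (proj₁ h)
    (λ N → mk⇔ (λ k → to (proj₂ h N) (↓∈ k) ▹ λ (_ , _ , B , b , n) → B , ↑∈ b , ↑∈ n)
      (λ (B , b , n) → Coded⊆Str (Meas⇒Coded (ms B (↓∈ b))) n ▹ λ nS → to (ϵ-Str N) nS ▹ λ (VN , str) →
        ↑∈ (from (proj₂ h N) (VN , str , B , ↓∈ b , ↓∈ n))))
    (λ B b → Meas⇒Coded (ms B (↓∈ b)))
    where
    Coded⊆Str : ∀ {A N} → Coded A → N ϵ A → N ϵ Str
    Coded⊆Str {A} {N} (c , d) n = Cod-sound c A d ▹ λ (_ , hA) → proj₁ (to (hA N) n)

-- Sums of cuts and consequences of additivity.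

⊕-negative : ∀ {c d : Cut} → (∀ q → c q → q <ℚ 0ℚ) → (∀ q → d q → q <ℚ 0ℚ) → ∀ q → (c ⊕ d) q → q <ℚ 0ℚ
⊕-negative hc hd q (p , p′ , refl , cp , dp′) = ℚ.+-mono-< (hc p cp) (hd p′ dp′)

-- The cut of a null value consists of negative rationals, and so does every finite sum of such
-- cuts, the empty sum included. Thus infinitely many null sets never add up to a positive one.
sum-negative : ∀ (c : 𝕊 → Cut) is → (∀ i q → c i q → q <ℚ 0ℚ) →
  ∀ q → foldr _⊕_ (rational 0ℚ) (mapL c is) q → q <ℚ 0ℚ
sum-negative c []       h q (lift l) = l
sum-negative c (i ∷ is) h = ⊕-negative (h i) (sum-negative c is h)

split-one : ∀ ε δ → 1ℚ ≡ (1ℚ -ℚ ε) +ℚ (δ +ℚ (ε -ℚ δ))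
split-one = solve 2 (λ ε δ → con 1ℚ := (con 1ℚ :- ε) :+ (δ :+ (ε :- δ))) refl
  where open +-*-Solver

minus-< : ∀ p {ε} → 0ℚ <ℚ ε → p -ℚ ε <ℚ p
minus-< p {ε} l = subst (p -ℚ ε <ℚ_) (ℚ.+-identityʳ p) (ℚ.+-monoʳ-< p (ℚ.neg-antimono-< l))

difference-< : ∀ {ε δ} → ε <ℚ δ → ε -ℚ δ <ℚ 0ℚ
difference-< {ε} {δ} l = subst (ε -ℚ δ <ℚ_) (ℚ.+-inverseʳ δ) (ℚ.+-monoˡ-< (- δ) l)

module Measure (setting : Setting) (μ : 𝕊)
    (measure : IsProbabilityκMeasure (Setting.V setting) (Setting.L setting) (Setting.X setting) (Setting.κ setting) μ) where
  open Coding setting public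
  module μ = IsProbabilityκMeasure measure

  zeroℚ : 𝕊
  zeroℚ = ⌜ 0ℚ ⌝

  Positive : 𝕊 → Set₁
  Positive A = ∃[ r ] (⟨ A , r ⟩ ϵ μ × zeroℚ ϵ r)

  value : ∀ {A} → Meas A → ∃[ r ] ⟨ A , r ⟩ ϵ μ
  value {A} m = μ.total A m ▹ λ (r , h) → r , pair∈⁺ A r h

  private
    real : ∀ {A r} → ⟨ A , r ⟩ ϵ μ → Meas A × ∃[ s ] (r ≈ s × IsReal s)
    real m = μ.graph _ (↓∈ m) ▹ λ (A′ , s , e , mA′ , rs) → pair-injective (pair⁺ A′ s e) ▹ λ (e₁ , e₂) →
      Meas-resp (≈-sym e₁) mA′ , s , e₂ , rs

  measured : ∀ {A r} → ⟨ A , r ⟩ ϵ μ → Meas A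
  measured m = proj₁ (real m)

  below-value : ∀ {A r} → ⟨ A , r ⟩ ϵ μ → ∀ p q → p <ℚ q → ⌜ q ⌝ ϵ r → ⌜ p ⌝ ϵ r
  below-value m p q l h = proj₂ (real m) ▹ λ (s , e , rs) →
    ϵ-respʳ (≈-sym e) (↑∈ (IsReal.lower rs p q l (↓∈ (ϵ-respʳ e h))))

  above-value : ∀ {A r} → ⟨ A , r ⟩ ϵ μ → ∀ p → ⌜ p ⌝ ϵ r → ∃[ q ] (p <ℚ q × ⌜ q ⌝ ϵ r)
  above-value m p h = proj₂ (real m) ▹ λ (s , e , rs) →
    IsReal.open-cut rs p (↓∈ (ϵ-respʳ e h)) ▹ λ (q , l , k) → q , l , ϵ-respʳ (≈-sym e) (↑∈ k)

  null-negative : ∀ {A r} → ⟨ A , r ⟩ ϵ μ → ¬ zeroℚ ϵ r → ∀ q → ⌜ q ⌝ ϵ r → q <ℚ 0ℚ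
  null-negative m null q h with ℚ.<-cmp q 0ℚ
  ... | tri< l _ _    = l
  ... | tri≈ _ refl _ = ⊥-elim (null h)
  ... | tri> _ _ l    = ⊥-elim (null (below-value m 0ℚ q l h))

  value-unique : ∀ {A r s} → ⟨ A , r ⟩ ϵ μ → ⟨ A , s ⟩ ϵ μ → r ≈ s
  value-unique {A} {r} {s} m n = ↑≐ (μ.unique A r s (pair∈⁻ A r m) (pair∈⁻ A s n))

  -- Additivity speaks of families that are elements of V. Here the pieces are given by a formula,
  -- and replacement turns them into such a family. The index set will be ω for cutting a set in two
  -- and κ for unions of classes.
  module Partition {I : 𝕊} (VI : V I) (additive : Additive V L X κ I μ) (Q : Fo 2) {A : 𝕊} (mA : Meas A) (VA : V A)
      (A⊆Str : A ⊆ Str)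
      (pieces : ∀ j → j ϵ I → MeasClass (λ N → N ϵ A × ⟦ Q ⟧ (j ∷ N ∷ [])))
      (covering : ∀ N → N ϵ A → ∃[ j ] (j ϵ I × ⟦ Q ⟧ (j ∷ N ∷ [])))
      (disjoint : ∀ N → N ϵ A → ∀ i j → i ϵ I → j ϵ I → ⟦ Q ⟧ (i ∷ N ∷ []) → ⟦ Q ⟧ (j ∷ N ∷ []) → i ≈ j) where

    Piece : 𝕊 → 𝕊 → Set₁
    Piece j Y = Denotes Y (λ N → N ϵ A × ⟦ Q ⟧ (j ∷ N ∷ []))

    private
      pieceᵗ : Fo 2
      pieceᵗ = ∃V (v2 ≐ᵗ ⟨ v1 , v0 ⟩ᵗ ∧ᵗ
        ∀V ((v0 ∈ᵗ v1) ⇔ᵗ ((v0 ∈ᵗ con Str V-Str) ∧ᵗ (v0 ∈ᵗ con A VA ∧ᵗ app Q (v2 ∷ v0 ∷ [])))))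

      ⟨⟩-piece : ∀ {j p} → ⟦ pieceᵗ ⟧ (j ∷ p ∷ []) → ∃[ Y ] (p ≈ ⟨ j , Y ⟩ × Piece j Y)
      ⟨⟩-piece (Y , VY , e , h) = Y , e , VY , λ N → mk⇔ (λ m → proj₁ (h N (V-ϵ VY m)) m)
        (λ (n , k) → proj₂ (h N (V-ϵ V-Str n)) (n , k))

      piece-unique : ∀ {i j Y Z} → i ≈ j → Piece i Y → Piece j Z → Y ≈ Z
      piece-unique e d d′ = denotes-unique (λ N _ → mk⇔
        (λ (a , q) → a , ⟦⟧-resp Q (e ∷ ≈-refl ∷ []) q) (λ (a , q) → a , ⟦⟧-resp Q (≈-sym e ∷ ≈-refl ∷ []) q)) d d′

    family : ∃[ F ] (V F × (∀ j Y → ⟨ j , Y ⟩ ϵ F ⇔ (j ϵ I × Piece j Y)) × IsDisjointFamily V L X κ I F)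
    family =
      repl pieceᵗ VI (λ j p q _ _ _ h h′ → ⟨⟩-piece h ▹ λ (Y , e , d) → ⟨⟩-piece h′ ▹ λ (Z , e′ , d′) →
        ≈-trans e (≈-trans (pair-cong ≈-refl (piece-unique ≈-refl d d′)) (≈-sym e′))) ▹ λ (F , VF , hF) →
      F , VF , entry VF hF , record
        { in-M = VF
        ; graph = λ p m → to (hF p (V-ϵ VF (↑∈ m))) (↑∈ m) ▹ λ (j , jI , h) → ⟨⟩-piece h ▹ λ (Y , e , d) →
            j , Y , pair⁻ j Y e , ↓∈ jI , MeasClass-set (pieces j jI) d
        ; total = λ j m → pieces j (↑∈ m) ▹ λ (Y , d , _) → Y , pair∈⁻ j Y (from (entry VF hF j Y) (↑∈ m , d))
        ; unique = λ j Y Z m n → to (entry VF hF j Y) (pair∈⁺ j Y m) ▹ λ (_ , d) →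
            to (entry VF hF j Z) (pair∈⁺ j Z n) ▹ λ (_ , d′) → ↓≐ (piece-unique ≈-refl d d′)
        ; disjoint = λ i j Y Z m n i≉j N mY mZ →
            to (entry VF hF i Y) (pair∈⁺ i Y m) ▹ λ (iI , _ , d) →
            to (entry VF hF j Z) (pair∈⁺ j Z n) ▹ λ (jI , _ , d′) →
            to (d N) (↑∈ mY) ▹ λ (_ , a , q) → to (d′ N) (↑∈ mZ) ▹ λ (_ , _ , q′) →
            i≉j (↓≐ (disjoint N a i j iI jI q q′))
        }
      where
      entry : ∀ {F} → V F → (∀ p → V p → p ϵ F ⇔ (∃[ j ] (j ϵ I × ⟦ pieceᵗ ⟧ (j ∷ p ∷ [])))) →
        ∀ j Y → ⟨ j , Y ⟩ ϵ F ⇔ (j ϵ I × Piece j Y)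
      entry VF hF j Y = mk⇔
        (λ m → to (hF _ (V-ϵ VF m)) m ▹ λ (i , iI , h) → ⟨⟩-piece h ▹ λ (Z , e , d) →
          pair-injective e ▹ λ (e₁ , e₂) →
          ϵ-respˡ (≈-sym e₁) iI , V-resp (≈-sym e₂) (proj₁ d) , λ N → mk⇔
            (λ m → to (proj₂ d N) (ϵ-respʳ e₂ m) ▹ λ (n , a , q) → n , a , ⟦⟧-resp Q (≈-sym e₁ ∷ ≈-refl ∷ []) q)
            (λ (n , a , q) → ϵ-respʳ (≈-sym e₂) (from (proj₂ d N) (n , a , ⟦⟧-resp Q (e₁ ∷ ≈-refl ∷ []) q))))
        (λ (jI , VY , d) → from (hF _ (V-pair (V-ϵ VI jI) VY))
          (j , jI , Y , VY , ≈-refl , λ N _ → to (d N) , from (d N)))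

    private
      F : 𝕊
      F = proj₁ family
      entry : ∀ j Y → ⟨ j , Y ⟩ ϵ F ⇔ (j ϵ I × Piece j Y)
      entry = proj₁ (proj₂ (proj₂ family))

    pieceCut : 𝕊 → Cut
    pieceCut j q = ∃[ Y ] ∃[ s ] (D.⟨ j , Y ⟩ ∈ F × D.⟨ Y , s ⟩ ∈ μ × ⌜ q ⌝ ∈ s)

    cut⁺ : ∀ {j Y s} q → j ϵ I → Piece j Y → ⟨ Y , s ⟩ ϵ μ → ⌜ q ⌝ ϵ s → pieceCut j q
    cut⁺ {j} {Y} {s} q jI d m h = Y , s , pair∈⁻ j Y (from (entry j Y) (jI , d)) , pair∈⁻ Y s m , ↓∈ h

    cut⁻ : ∀ j q → pieceCut j q → j ϵ I × ∃[ Y ] ∃[ s ] (Piece j Y × ⟨ Y , s ⟩ ϵ μ × ⌜ q ⌝ ϵ s)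
    cut⁻ j q (Y , s , f , m , h) = to (entry j Y) (pair∈⁺ j Y f) ▹ λ (jI , d) → jI , Y , s , d , pair∈⁺ Y s m , ↑∈ h

    value-sum : ∀ {r} → ⟨ A , r ⟩ ϵ μ → r IsCut sumOver I pieceCut
    value-sum {r} m = additive F (proj₂ (proj₂ (proj₂ family))) A r
      (VA , λ N → mk⇔
        (λ a → to (ϵ-Str N) (A⊆Str N (↑∈ a)) ▹ λ (VN , str) →
          covering N (↑∈ a) ▹ λ (j , jI , q) → pieces j jI ▹ λ (Y , d , _) →
          VN , str , j , Y , pair∈⁻ j Y (from (entry j Y) (jI , d)) ,
          ↓∈ (from (proj₂ d N) (from (ϵ-Str N) (VN , str) , ↑∈ a , q)))
        (λ (VN , str , j , Y , f , y) → to (entry j Y) (pair∈⁺ j Y f) ▹ λ (_ , _ , d) →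
          ↓∈ (proj₁ (proj₂ (to (d N) (↑∈ y))))))
      (pair∈⁻ A r m)

    -- If every piece were null, each finite sum of their cuts would consist of negative rationals,
    -- and 0 could not lie in the cut of `A`.
    positive-piece : Positive A → ∃[ j ] ∃[ Y ] (j ϵ I × Piece j Y × Positive Y)
    positive-piece (r , m , h) = by-contradiction λ none →
      to (value-sum m 0ℚ) (↓∈ h) ▹ λ (is , _ , _ , s) →
      ℚ.<-irrefl refl (sum-negative pieceCut is (λ j q c → cut⁻ j q c ▹ λ (jI , Y , s , d , n , k) →
        null-negative n (λ z → none (j , Y , jI , d , s , n , z)) q k) 0ℚ s)

    positive-whole : ∀ {j Y} → j ϵ I → Piece j Y → Positive Y → Positive A
    positive-whole {j} jI d (s , n , z) =
      -- The sum over the list with the single index `j` still adds the empty sum, the cut of the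
      -- negative rationals. A rational `q` above 0 in the cut of the piece compensates for it, as 0
      -- is `q` plus `- q`.
      value mA ▹ λ (r , m) → above-value n 0ℚ z ▹ λ (q , 0<q , k) →
      r , m , ↑∈ (from (value-sum m 0ℚ) (j ∷ [] , ↓∈ jI ∷A []A , []A ∷P []P ,
        q , - q , sym (ℚ.+-inverseʳ q) , cut⁺ q jI d n k , lift (ℚ.neg-antimono-< 0<q)))

  Meas⊆Str : ∀ {A} → Meas A → V A × A ⊆ Str
  Meas⊆Str (basic d l xs ms h) = proj₁ h , λ N m → proj₁ (to (proj₂ (denotes⁺ h) N) m)
  Meas⊆Str (compl B m (VA , h)) = VA , λ N n → to (h N) (↓∈ n) ▹ λ (VN , str , _) → from (ϵ-Str N) (VN , str)
  Meas⊆Str (union U VU c ms h) = proj₁ h , λ N m → proj₁ (to (proj₂ (denotes⁺ h) N) m)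

  MeasClass-ϵ : ∀ {A} → Meas A → MeasClass (λ N → N ϵ A)
  MeasClass-ϵ {A} mA = Meas⊆Str mA ▹ λ (VA , A⊆Str) →
    A , (VA , λ N → mk⇔ (λ m → A⊆Str N m , m) proj₂) , mA

  -- When `P` fails the class is empty, and the measurable class at hand provides an empty one as
  -- its intersection with its complement.
  MeasClass-guard : ∀ {P : Set₁} {Q} → Dec P → MeasClass Q → MeasClass (λ N → P × Q N)
  MeasClass-guard (yes p) mQ = MeasClass-resp (λ N _ → mk⇔ (p ,_) proj₂) mQ
  MeasClass-guard (no ¬p) mQ = MeasClass-resp
    (λ N _ → mk⇔ (λ (k , q) → ⊥-elim (k q)) (λ (p , _) → ⊥-elim (¬p p))) (MeasClass-× (MeasClass-¬ mQ) mQ)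

  module Halves {A B : 𝕊} (mA : Meas A) (mB : Meas B) where
    private
      VB : V B
      VB = proj₁ (Meas⊆Str mB)

    -- Finite additivity is obtained from additivity over ω: index 0 carries the part inside `B`,
    -- index 1 the part outside, and the pieces at all later indices are empty.
    halfᵗ : Fo 2
    halfᵗ = (v0 ≐ᵗ natᵗ 0 ∧ᵗ v1 ∈ᵗ con B VB) ∨ᵗ (v0 ≐ᵗ natᵗ 1 ∧ᵗ ¬ᵗ (v1 ∈ᵗ con B VB))

    0≉1 : ∀ {i} → i ≈ nat 0 → ¬ i ≈ nat 1
    0≉1 e e′ = ∅≉⁺ (≈-trans (≈-sym e) e′)

    private
      disjoint : ∀ N i j → ⟦ halfᵗ ⟧ (i ∷ N ∷ []) → ⟦ halfᵗ ⟧ (j ∷ N ∷ []) → i ≈ j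
      disjoint N i j (inj₁ (e , _)) (inj₁ (e′ , _)) = ≈-trans e (≈-sym e′)
      disjoint N i j (inj₂ (e , _)) (inj₂ (e′ , _)) = ≈-trans e (≈-sym e′)
      disjoint N i j (inj₁ (_ , b)) (inj₂ (_ , ¬b)) = ⊥-elim (¬b b)
      disjoint N i j (inj₂ (_ , ¬b)) (inj₁ (_ , b)) = ⊥-elim (¬b b)

      covering : ∀ N → Dec (N ϵ B) → ∃[ j ] (j ϵ ω × ⟦ halfᵗ ⟧ (j ∷ N ∷ []))
      covering N (yes b) = nat 0 , nat-ϵ-ω 0 , inj₁ (≈-refl , b)
      covering N (no ¬b) = nat 1 , nat-ϵ-ω 1 , inj₂ (≈-refl , ¬b)

    open Partition V-ω μ.σ-additive halfᵗ mA (proj₁ (Meas⊆Str mA)) (proj₂ (Meas⊆Str mA))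
      (λ j _ → MeasClass-× (MeasClass-ϵ mA) (MeasClass-⊎ (MeasClass-guard lem (MeasClass-ϵ mB))
        (MeasClass-guard lem (MeasClass-¬ (MeasClass-ϵ mB)))))
      (λ N _ → covering N lem) (λ N _ i j _ _ → disjoint N i j) public

    inner : ∀ {Y} → Denotes Y (λ N → N ϵ A × N ϵ B) → Piece (nat 0) Y
    inner = denotes-resp λ N _ → mk⇔ (λ (a , b) → a , inj₁ (≈-refl , b))
      λ { (a , inj₁ (_ , b)) → a , b ; (a , inj₂ (e , _)) → ⊥-elim (0≉1 ≈-refl e) }

    outer : ∀ {Y} → Denotes Y (λ N → N ϵ A × ¬ N ϵ B) → Piece (nat 1) Y
    outer = denotes-resp λ N _ → mk⇔ (λ (a , b) → a , inj₂ (≈-refl , b))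
      λ { (a , inj₂ (_ , b)) → a , b ; (a , inj₁ (e , _)) → ⊥-elim (0≉1 e ≈-refl) }

  Positive-mono : ∀ {A B} → Meas A → B ⊆ A → Positive B → Positive A
  Positive-mono {A} {B} mA B⊆A pos@(r , m , _) = measured m ▹ λ mB → Meas⊆Str mB ▹ λ (VB , B⊆Str) →
    Halves.positive-whole mA mB (nat-ϵ-ω 0)
      (Halves.inner mA mB (VB , λ N → mk⇔ (λ b → B⊆Str N b , B⊆A N b , b) (λ (_ , _ , b) → b))) pos

  Meas-Str : ∀ {A} → Meas A → Meas Str
  Meas-Str mA = MeasClass-set (MeasClass-⊎ (MeasClass-ϵ mA) (MeasClass-¬ (MeasClass-ϵ mA)))
    (V-Str , λ N → mk⇔ (λ n → n , excluded lem) proj₁)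
    where
    excluded : ∀ {P : Set₁} → Dec P → P ⊎ ¬ P
    excluded (yes p) = inj₁ p
    excluded (no ¬p) = inj₂ ¬p

  -- If 0 were in the cut of `C`, openness would give `0 < ε < δ` in that cut. Then `1 - ε` from
  -- `A`, `δ` from `C` and the negative `ε - δ` from the empty sum add up to 1, which would lie in
  -- the cut of the total mass, although that cut stops below 1.
  full-complement : ∀ {A r C} → ⟨ A , r ⟩ ϵ μ → r IsCut rational 1ℚ → Denotes C (λ N → ¬ N ϵ A) → ¬ Positive C
  full-complement {A} {r} {C} m full dC (s , n , z) =
    measured m ▹ λ mA → Meas⊆Str mA ▹ λ (VA , A⊆Str) → Meas-Str mA ▹ λ mS →
    value mS ▹ λ (t , k) →
    above-value n 0ℚ z ▹ λ (ε , 0<ε , hε) →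
    above-value n ε hε ▹ λ (δ , ε<δ , hδ) →
    ℚ.<-irrefl refl (lower (to (μ.total-mass Str t
      (V-Str , λ N → mk⇔ (λ x → to (ϵ-Str N) (↑∈ x) ▹ λ (VN , str) → VN , str , tt)
        (λ (VN , str , _) → ↓∈ (from (ϵ-Str N) (VN , str)))) (pair∈⁻ Str t k) 1ℚ)
      (from (Halves.value-sum mS mA k 1ℚ)
        ( nat 0 ∷ nat 1 ∷ [] , ↓∈ (nat-ϵ-ω 0) ∷A ↓∈ (nat-ϵ-ω 1) ∷A []A
        , ((λ e → ∅≉⁺ (↑≐ e)) ∷A []A) ∷P []A ∷P []P
        , 1ℚ -ℚ ε , δ +ℚ (ε -ℚ δ) , split-one ε δ
        , Halves.cut⁺ mS mA (1ℚ -ℚ ε) (nat-ϵ-ω 0)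
            (Halves.inner mS mA (VA , λ N → mk⇔ (λ a → A⊆Str N a , A⊆Str N a , a) (λ (_ , _ , a) → a)))
            m (↑∈ (from (full (1ℚ -ℚ ε)) (lift (minus-< 1ℚ 0<ε))))
        , δ , ε -ℚ δ , refl
        , Halves.cut⁺ mS mA δ (nat-ϵ-ω 1)
            (Halves.outer mS mA (denotes-resp (λ N x → mk⇔ (x ,_) proj₂) dC)) n hδ
        , lift (difference-< ε<δ)))))

  -- An empty set is the complement of `Str`, which has measure 1; that its cut contains all
  -- negative rationals is nonnegativity of the measure.
  empty-null : ∀ {A r} → (∀ N → ¬ N ϵ A) → ⟨ A , r ⟩ ϵ μ → r IsCut rational 0ℚ
  empty-null {A} {r} none m = λ q → mk⇔
    (λ h → lift (null-negative m
      (λ z → full-complement k full (proj₁ (Meas⊆Str mA) , λ N → mk⇔ (λ a → ⊥-elim (none N a)) (λ (n , ¬n) → ⊥-elim (¬n n))) (r , m , z))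
      q (↑∈ h)))
    (λ (lift l) → μ.nonneg A r (pair∈⁻ A r m) q l)
    where
    mA = measured m
    full-Str = value (Meas-Str mA)
    k = proj₂ full-Str
    full = μ.total-mass Str (proj₁ full-Str)
      (V-Str , λ N → mk⇔ (λ x → to (ϵ-Str N) (↑∈ x) ▹ λ (VN , str) → VN , str , tt)
        (λ (VN , str , _) → ↓∈ (from (ϵ-Str N) (VN , str)))) (pair∈⁻ Str (proj₁ full-Str) k)

  empty-not-positive : ∀ {A} → (∀ N → ¬ N ϵ A) → ¬ Positive A
  empty-not-positive none (r , m , z) = ℚ.<-irrefl refl (lower (to (empty-null none m 0ℚ) (↓∈ z)))

  Positive-split : ∀ {A B} → Meas A → Meas B → Positive A →
    (∃[ Y ] (Denotes Y (λ N → N ϵ A × N ϵ B) × Positive Y)) ⊎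
    (∃[ Y ] (Denotes Y (λ N → N ϵ A × ¬ N ϵ B) × Positive Y))
  Positive-split {A} {B} mA mB pos =
    Halves.positive-piece mA mB pos ▹ λ (j , Y , _ , d , p) → first j d p lem
    where
    Result : Set₁
    Result = (∃[ Y ] (Denotes Y (λ N → N ϵ A × N ϵ B) × Positive Y)) ⊎
      (∃[ Y ] (Denotes Y (λ N → N ϵ A × ¬ N ϵ B) × Positive Y))
    second : ∀ j {Y} → Halves.Piece mA mB j Y → Positive Y → ¬ j ≈ nat 0 → Dec (j ≈ nat 1) → Result
    second j d p ¬e (yes e) = inj₂ (_ , denotes-resp (λ N _ → mk⇔
      (λ { (a , inj₁ (e′ , _)) → ⊥-elim (¬e e′) ; (a , inj₂ (_ , b)) → a , b })
      (λ (a , b) → a , inj₂ (e , b))) d , p)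
    -- An index other than 0 and 1 carries the empty piece, which is not positive.
    second j (VY , d) p ¬e (no ¬e′) = ⊥-elim (empty-not-positive (λ N y → to (d N) y ▹
      λ { (_ , _ , inj₁ (e , _)) → ¬e e ; (_ , _ , inj₂ (e , _)) → ¬e′ e }) p)
    first : ∀ j {Y} → Halves.Piece mA mB j Y → Positive Y → Dec (j ≈ nat 0) → Result
    first j d p (yes e) = inj₁ (_ , denotes-resp (λ N _ → mk⇔
      (λ { (a , inj₁ (_ , b)) → a , b ; (a , inj₂ (e′ , _)) → ⊥-elim (Halves.0≉1 mA mB e e′) })
      (λ (a , b) → a , inj₁ (e , b))) d , p)
    first j d p (no ¬e) = second j d p ¬e lem

-- Forcing with positive codes.

module Forcing (setting : Setting) (μ : 𝕊)
    (measure : IsProbabilityκMeasure (Setting.V setting) (Setting.L setting) (Setting.X setting) (Setting.κ setting) μ)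
    (G : 𝕊)
    (filter : IsRandomGenericFilter (Setting.V setting) (Setting.L setting) (Setting.X setting) (Setting.κ setting) μ G) where
  open Measure setting μ measure public
  module Filter = IsRandomGenericFilter filter

  V-μ : V μ
  V-μ = μ.in-M

  V-zeroℚ : V zeroℚ
  V-zeroℚ = V-resp (≈-reflexive (trans ⟨⟩-def (cong₂ D.⟨_,_⟩ (tag-def 0) (nat-def 1))))
    (V-pair (V-tag 0 (V-resp (≈-reflexive (nat-def 0)) (V-nat 0))) (V-nat 1))

  IsInt : ∀ {γ} → 𝕊 → BorelCode γ → Set₁
  IsInt A c = ∀ N → N ϵ A ⇔ (N ϵ Str × N ⊩⟨ c ⟩)

  positive-V : ∀ {A} → Positive A → V A
  positive-V (r , m , _) = proj₁ (V-pair⁻ (V-ϵ V-μ m))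

  positive-measured : ∀ {A} → Positive A → Meas A
  positive-measured (r , m , _) = measured m

  private
    int⁺ : ∀ {γ A} (c : BorelCode γ) → IsInt A c → ∀ N → N ∈ A ⇔ Int V L X κ V c N
    int⁺ c h N = mk⇔ (λ m → to (h N) (↑∈ m) ▹ λ (n , g) → to (ϵ-Str N) n ▹ λ (VN , str) → VN , str , g)
      (λ (VN , str , g) → ↓∈ (from (h N) (from (ϵ-Str N) (VN , str) , g)))

    int⁻ : ∀ {γ A} (c : BorelCode γ) → (∀ N → N ∈ A ⇔ Int V L X κ V c N) → IsInt A c
    int⁻ c h N = mk⇔ (λ m → to (h N) (↓∈ m) ▹ λ (VN , str , g) → from (ϵ-Str N) (VN , str) , g)
      (λ (n , g) → to (ϵ-Str N) n ▹ λ (VN , str) → ↑∈ (from (h N) (VN , str , g)))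

  pos⁺ : ∀ {γ A} (c : BorelCode γ) → IsInt A c → Positive A → Pos V L X κ μ γ
  pos⁺ {A = A} c h p@(r , m , z) = r , (c , A , positive-V p , int⁺ c h , pair∈⁻ A r m) , ↓∈ z

  pos⁻ : ∀ {γ} → Pos V L X κ μ γ → Σ[ c ∈ BorelCode γ ] ∃[ A ] (IsInt A c × Positive A)
  pos⁻ (r , (c , A , VA , h , m) , z) = c , A , int⁻ c h , r , pair∈⁺ A r m , ↑∈ z

  -- Under outright inclusion the difference is empty, and any measurable `B` yields a measurable
  -- empty set, as `B` minus itself, to interpret it.
  ≼⁺ : ∀ {γ ζ B} (c : BorelCode γ) (k : BorelCode ζ) → Meas B →
    (∀ N → N ϵ Str → N ⊩⟨ c ⟩ → N ⊩⟨ k ⟩) → _≼_ V L X κ μ γ ζ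
  ≼⁺ {γ} {ζ} {B} c k mB sub =
    MeasClass-× (MeasClass-ϵ mB) (MeasClass-¬ (MeasClass-ϵ mB)) ▹ λ (A , (VA , hA) , mA) →
    value mA ▹ λ (r , m) →
    (λ N a → to (hA N) a ▹ λ (_ , b , ¬b) → ¬b b) ▹ λ empty →
    r , (difference c k , A , VA , int⁺ (difference c k) (λ N → mk⇔ (λ a → ⊥-elim (empty N a))
          (λ (n , g) → to (difference-⊩ c k (difference c k) ≈-refl n) g ▹ λ (gc , ¬gk) → ⊥-elim (¬gk (sub N n gc))))
        , pair∈⁻ A r m) ,
    empty-null empty m

  ≼⁻ : ∀ {γ ζ} (c : BorelCode γ) (k : BorelCode ζ) → _≼_ V L X κ μ γ ζ →
    ∃[ Y ] (Meas Y × ¬ Positive Y × (∀ N → N ϵ Y ⇔ (N ϵ Str × N ⊩⟨ c ⟩ × ¬ (N ⊩⟨ k ⟩))))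
  ≼⁻ c k (r , (δ , Y , VY , h , m) , null) = Y , measured (pair∈⁺ Y r m) ,
    (λ (s , n , z) → ℚ.<-irrefl refl (lower (to (null 0ℚ) (↓∈ (ϵ-respʳ (value-unique n (pair∈⁺ Y r m)) z))))) ,
    λ N → mk⇔
      (λ y → to (int⁻ δ h N) y ▹ λ (n , g) → n , to (difference-⊩ c k δ ≈-refl n) g)
      (λ (n , g) → from (int⁻ δ h N) (n , from (difference-⊩ c k δ ≈-refl n) g))

  -- The ultrafilter generated by G: some condition in G forces P outright, not
  -- only up to a null set.
  Forced : (𝕊 → Set₁) → Set₁
  Forced P = ∃[ g ] (g ∈ G × Σ[ c ∈ BorelCode g ] (∀ N → N ϵ Str → N ⊩⟨ c ⟩ → P N))

  forced-mono : ∀ {P Q : 𝕊 → Set₁} → (∀ N → N ϵ Str → P N → Q N) → Forced P → Forced Q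
  forced-mono h (g , m , c , f) = g , m , c , λ N n k → h N n (f N n k)

  forced-positive : ∀ {P : 𝕊 → Set₁} → Forced P → ∃[ A ] (Positive A × (∀ N → N ϵ A → N ϵ Str × P N))
  forced-positive (g , m , c , f) = pos⁻ (Filter.conditions g m) ▹ λ (c′ , A , h , p) →
    A , p , λ N a → to (h N) a ▹ λ (n , k) → n , f N n (⊩-invariant c′ c ≈-refl n k)

  -- A common extension `δ` in G lies below the two conditions only up to null sets `Y` and `Z`. If
  -- `P` and `Q` excluded each other, the positive interpretation of `δ` would be covered by `Y` and
  -- `Z`; splitting it along `Y` makes one of them positive.
  forced-consistent : ∀ {P Q : 𝕊 → Set₁} → Forced P → Forced Q → ¬ (∀ N → N ϵ Str → P N → ¬ Q N)
  forced-consistent (g , m , c , f) (g′ , m′ , c′ , f′) disjoint =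
    Filter.directed g g′ m m′ ▹ λ (δ , mδ , δ≼g , δ≼g′) →
    pos⁻ (Filter.conditions δ mδ) ▹ λ (d , A , hA , pA) →
    ≼⁻ d c δ≼g ▹ λ (Y , mY , ¬pY , hY) →
    ≼⁻ d c′ δ≼g′ ▹ λ (Z , mZ , ¬pZ , hZ) →
    [ (λ (B , hB , pB) → ¬pY (Positive-mono mY (λ N b → proj₂ (proj₂ (to (proj₂ hB N) b))) pB))
    , (λ (B , hB , pB) → ¬pZ (Positive-mono mZ (λ N b →
        to (proj₂ hB N) b ▹ λ (n , a , ¬y) → to (hA N) a ▹ λ (_ , k) →
        from (hZ N) (n , k , λ k′ → ¬y (from (hY N) (n , k , λ kc → disjoint N n (f N n kc) (f′ N n k′))))) pB))
    ]′ (Positive-split (positive-measured pA) mY pA)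

  -- Upward closure of G applies to conditions only, so `ζ` must first be shown positive: it
  -- includes the interpretation of a condition in G.
  enter : ∀ {ζ} (k : BorelCode ζ) → MeasClass (λ N → N ⊩⟨ k ⟩) → Forced (λ N → N ⊩⟨ k ⟩) → ζ ∈ G
  enter {ζ} k (B , hB , mB) F@(g , m , c , f) =
    forced-positive F ▹ λ (A , pA , hA) →
    Filter.upward g ζ m (pos⁺ k (proj₂ hB) (Positive-mono mB (λ N a → from (proj₂ hB N) (hA N a)) pA)) (≼⁺ c k mB f)

  module _ {I : 𝕊} (VI : V I) (card : Card≤ V I κ) (Q : Fo 2)
      (meas : ∀ i → i ϵ I → MeasClass (λ N → ⟦ Q ⟧ (i ∷ N ∷ []))) where

    private
      Some : 𝕊 → Set₁
      Some N = ∃[ i ] (i ϵ I × ⟦ Q ⟧ (i ∷ N ∷ []))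

      -- Q(i, N) holds for the i with f(i) = j but for no i with smaller f(i)
      firstᵗ : ∀ {f} → V f → Fo 2
      firstᵗ {f} Vf = ∃∈ (con I VI) (⟨ v0 , v1 ⟩ᵗ ∈ᵗ con f Vf ∧ᵗ (app Q (v0 ∷ v2 ∷ []) ∧ᵗ
        ¬ᵗ (∃∈ (con I VI) (app Q (v0 ∷ v3 ∷ []) ∧ᵗ ∃∈ v2 (⟨ v1 , v0 ⟩ᵗ ∈ᵗ con f Vf)))))

      module _ {f : 𝕊} (inj : Injection I f) where
        Vf : V f
        Vf = proj₁ inj

        First : 𝕊 → 𝕊 → Set₁
        First j N = ⟦ firstᵗ Vf ⟧ (j ∷ N ∷ [])

        f-value : ∀ {i j} → ⟨ i , j ⟩ ϵ f → i ϵ I × j ϵ κ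
        f-value = graph-value (proj₁ (proj₂ inj)) (λ _ e m → ϵ-respˡ e m)

        first-measurable : ∀ j → j ϵ κ → Dec (∃[ i ] ⟨ i , j ⟩ ϵ f) → MeasClass (First j)
        first-measurable j jκ (yes (i , m)) = MeasClass-resp
          (λ N n → mk⇔ (λ (q , k) → i , proj₁ (f-value m) , m , q , k)
            (λ (i′ , _ , m′ , q , k) → ⟦⟧-resp Q (proj₂ (proj₂ inj) i′ i j m′ m ∷ ≈-refl ∷ []) q , k))
          (MeasClass-× (meas i (proj₁ (f-value m))) (MeasClass-¬ (MeasClass-∃ VI card
            (app Q (v0 ∷ v1 ∷ []) ∧ᵗ ∃∈ (con j (V-ϵ Vκ jκ)) (⟨ v1 , v0 ⟩ᵗ ∈ᵗ con f Vf))
            (λ i iI → MeasClass-resp (λ N _ → mk⇔ (λ (a , b) → b , a) (λ (b , a) → a , b)) (MeasClass-guard lem (meas i iI))))))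
        first-measurable j jκ (no none) = MeasClass-resp
          (λ N n → mk⇔ (λ (k , q) → ⊥-elim (k q)) (λ (i , _ , m , _) → ⊥-elim (none (i , m))))
          (MeasClass-× (MeasClass-¬ (MeasClass-∃ VI card Q meas)) (MeasClass-∃ VI card Q meas))

        first-exists : ∀ N → Some N → ∃[ j ] (j ϵ κ × First j N)
        first-exists N (i , iI , q) = proj₁ (proj₂ (proj₁ (proj₂ inj))) i iI ▹ λ (j , m) →
          ϵ-induction (λ j → (∃[ i ] (⟨ i , j ⟩ ϵ f × ⟦ Q ⟧ (i ∷ N ∷ []))) → ∃[ j ] (j ϵ κ × First j N))
            (λ j IH (i , m , q) → search j IH i m q lem) j (i , m , q)
          where
          search : ∀ j → (∀ j′ → j′ ϵ j → (∃[ i ] (⟨ i , j′ ⟩ ϵ f × ⟦ Q ⟧ (i ∷ N ∷ []))) → ∃[ j ] (j ϵ κ × First j N)) →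
            ∀ i → ⟨ i , j ⟩ ϵ f → ⟦ Q ⟧ (i ∷ N ∷ []) →
            Dec (∃[ i ] (i ϵ I × ⟦ Q ⟧ (i ∷ N ∷ []) × ∃[ j′ ] (j′ ϵ j × ⟨ i , j′ ⟩ ϵ f))) → ∃[ j ] (j ϵ κ × First j N)
          search j IH i m q (yes (i′ , _ , q′ , j′ , l , m′)) = IH j′ l (i′ , m′ , q′)
          search j IH i m q (no none) = j , proj₂ (f-value m) , i , proj₁ (f-value m) , m , q , none

        first-unique : ∀ N j j′ → j ϵ κ → j′ ϵ κ → First j N → First j′ N → j ≈ j′
        first-unique N j j′ jκ jκ′ (i , iI , m , q , none) (i′ , iI′ , m′ , q′ , none′) =
          [ (λ l → ⊥-elim (none′ (i , iI , q , j , l , m)))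
          , [ id , (λ l → ⊥-elim (none (i′ , iI′ , q′ , j′ , l , m′))) ]′ ]′
          (ordinal-compare lem j j′ (ordinal-ϵ κ-ordinal jκ) (ordinal-ϵ κ-ordinal jκ′))

        -- First makes the union over I disjoint, so that κ-additivity applies.
        positive-part : ∀ {Y} → Positive Y → (∀ N → N ϵ Y → Some N) →
          ∃[ i ] ∃[ Z ] (i ϵ I × Positive Z × (∀ N → N ϵ Z → N ϵ Y × ⟦ Q ⟧ (i ∷ N ∷ [])))
        positive-part {Y} pY some =
          positive-measured pY ▹ λ mY → Meas⊆Str mY ▹ λ (VY , Y⊆Str) →
          Partition.positive-piece Vκ μ.κ-additive (firstᵗ Vf) mY VY Y⊆Str
            (λ j jκ → MeasClass-× (MeasClass-ϵ mY) (first-measurable j jκ lem))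
            (λ N y → first-exists N (some N y))
            (λ N y i j iκ jκ → first-unique N i j iκ jκ) pY ▹ λ (j , Z , jκ , hZ , pZ) →
          by-contradiction {∃[ N ] N ϵ Z} (λ none → empty-not-positive (λ N z → none (N , z)) pZ) ▹ λ (N₀ , z₀) →
          to (proj₂ hZ N₀) z₀ ▹ λ (_ , _ , i , iI , m , _) →
          i , Z , iI , pZ , λ N z → to (proj₂ hZ N) z ▹ λ (_ , y , i′ , _ , m′ , q , _) →
            y , ⟦⟧-resp Q (proj₂ (proj₂ inj) i′ i j m′ m ∷ ≈-refl ∷ []) q

      decidedᵗ : Fo 1
      decidedᵗ = (∃∈ (con I VI) (∀∈ v1 (app Q (v1 ∷ v0 ∷ [])))) ∨ᵗ
        ∀∈ v0 (¬ᵗ (∃∈ (con I VI) (app Q (v0 ∷ v1 ∷ []))))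

      conditionᵗ : Fo 1
      conditionᵗ = ∃V (app (derᵗ codᵗ) (⟨ v1 , v0 ⟩ᵗ ∷ []) ∧ᵗ
        (∃V (⟨ v1 , v0 ⟩ᵗ ∈ᵗ con μ V-μ ∧ᵗ con zeroℚ V-zeroℚ ∈ᵗ v0) ∧ᵗ app decidedᵗ (v0 ∷ [])))

      Decided : 𝕊 → Set₁
      Decided A = ⟦ decidedᵗ ⟧ (A ∷ [])

      decide : ∀ {A} → Positive A → ∃[ Z ] (Positive Z × Z ⊆ A × Decided Z)
      decide {A} pA = MeasClass-∃ VI card Q meas ▹ λ (B , hB , mB) →
        [ (λ (Y , hY , pY) → card⁺ card ▹ λ (f , inj) →
            positive-part inj pY (λ N y → to (proj₂ hY N) y ▹ λ (_ , _ , b) → proj₂ (to (proj₂ hB N) b)) ▹ λ (i , Z , iI , pZ , hZ) →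
            Z , pZ , (λ N z → proj₁ (proj₂ (to (proj₂ hY N) (proj₁ (hZ N z))))) ,
            inj₁ (i , iI , λ N z → proj₂ (hZ N z)))
        , (λ (Y , hY , pY) → Y , pY , (λ N y → proj₁ (proj₂ (to (proj₂ hY N) y))) ,
            inj₂ (λ N y some → to (proj₂ hY N) y ▹ λ (n , _ , ¬b) → ¬b (from (proj₂ hB N) (n , some))))
        ]′ (Positive-split (positive-measured pA) mB pA)

    -- The dense set has to be an element of V. Instead of all codes it draws on a set `C`, given by
    -- collection, that contains a derivable code for every coded subset of `Str` in V. This
    -- suffices for density, since every positive set below a condition is measurable and therefore
    -- has such a code.
    generic-decides : (∃[ i ] (i ϵ I × Forced (λ N → ⟦ Q ⟧ (i ∷ N ∷ [])))) ⊎
                      Forced (λ N → ¬ (∃[ i ] (i ϵ I × ⟦ Q ⟧ (i ∷ N ∷ []))))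
    generic-decides =
      V-𝒫 V-Str ▹ λ (𝒫Str , V𝒫 , h𝒫) →
      collection (app (derᵗ codᵗ) (⟨ v1 , v0 ⟩ᵗ ∷ [])) V𝒫 ▹ λ (C , VC , hC) →
      sep conditionᵗ VC ▹ λ (Δ , VΔ , hΔ) →
      Filter.generic Δ VΔ
        ( (λ δ m → proj₂ (to (hΔ δ) (↑∈ m)) ▹ λ (A , VA , d , (r , _ , k , z) , _) →
             Cod-sound δ A d ▹ λ (c , hA) → pos⁺ c hA (r , k , z))
        , (λ γ pγ → pos⁻ pγ ▹ λ (c , A , hA , pA) →
             decide pA ▹ λ (Z , pZ@(r , k , z) , Z⊆A , decided) →
             positive-measured pZ ▹ λ mZ →
             positive-V pZ ▹ λ VZ →
             Meas⇒Coded mZ ▹ λ (c₀ , d₀) →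
             hC Z (from (h𝒫 Z VZ) (proj₂ (Meas⊆Str mZ))) (c₀ , proj₁ (V-pair⁻ (Der⇒V codᵗ d₀)) , d₀) ▹ λ (δ , δC , d) →
             Cod-sound δ Z d ▹ λ (k′ , hZ) →
             δ , ↓∈ (from (hΔ δ) (δC , Z , VZ , d , (r , proj₂ (V-pair⁻ (V-ϵ V-μ k)) , k , z) , decided)) ,
             ≼⁺ k′ c mZ (λ N n g → proj₂ (to (hA N) (Z⊆A N (from (hZ N) (n , g))))))) ▹ λ (δ , δΔ , δG) →
      proj₂ (to (hΔ δ) (↑∈ δΔ)) ▹ λ (A , VA , d , _ , decided) →
      Cod-sound δ A d ▹ λ (c , hA) →
      map⊎ (λ (i , iI , h) → i , iI , δ , δG , c , λ N n g → h N (from (hA N) (n , g)))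
        (λ h → δ , δG , c , λ N n g → h N (from (hA N) (n , g))) decided

    forced-∃ : Forced (λ N → ∃[ i ] (i ϵ I × ⟦ Q ⟧ (i ∷ N ∷ []))) → ∃[ i ] (i ϵ I × Forced (λ N → ⟦ Q ⟧ (i ∷ N ∷ [])))
    forced-∃ F = [ id , (λ F′ → ⊥-elim (forced-consistent F F′ (λ N _ s k → k s))) ]′ generic-decides

  -- Genericity is applied to the constant family with value `A`, indexed by ω. The alternative
  -- would put a positive set inside the complement of `A`.
  full-forced : ∀ {A r} → ⟨ A , r ⟩ ϵ μ → r IsCut rational 1ℚ → Forced (λ N → N ϵ A)
  full-forced {A} {r} m full =
    measured m ▹ λ mA →
    [ (λ (_ , _ , F) → F)
    , (λ F → forced-positive F ▹ λ (B , pB , hB) →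
        MeasClass-¬ (MeasClass-ϵ mA) ▹ λ (C , hC , mC) →
        ⊥-elim (full-complement m full hC (Positive-mono mC
          (λ N b → hB N b ▹ λ (n , k) → from (proj₂ hC N) (n , λ a → k (nat 0 , nat-ϵ-ω 0 , a))) pB)))
    ]′ (generic-decides V-ω card-ω (v1 ∈ᵗ con A (proj₁ (Meas⊆Str mA))) (λ _ _ → MeasClass-ϵ mA))

  -- Truth in the generic structure.

  module Truth (M : 𝕊) (generic-structure : ∀ g (c : BorelCode g) → g ∈ G → M ⊩⟨ c ⟩) where

    private
      -- Here forcing meets `M`. The code of the literal has the same models in V as the forced
      -- class, so it enters G, and `M` satisfies the codes in G.
      atomic-true : ∀ {n φ} (d : Formula n φ) l {xs : Vec 𝕊 n} (ms : All (_∈ X) xs) →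
        Forced (Sat true φ (tuple xs)) → M ⊨⟨ d ⟩ xs
      atomic-true d l {xs} ms F = to (literal-⊩ d l ms M) (generic-structure _ (literal d l ms)
        (enter (literal d l ms)
          (MeasClass-resp (λ N n → mk⇔ (literal⁺ N n) (literal⁻ N n)) (MeasClass-Sat true d ms))
          (forced-mono literal⁺ F)))
        where
        literal⁺ : ∀ N → N ϵ Str → Sat true _ (tuple xs) N → N ⊩⟨ literal d l ms ⟩
        literal⁺ N n h = from (literal-⊩ d l ms N) (to (Sat-⇔ true d ms N n) h)
        literal⁻ : ∀ N → N ϵ Str → N ⊩⟨ literal d l ms ⟩ → Sat true _ (tuple xs) N
        literal⁻ N n h = from (Sat-⇔ true d ms N n) (to (literal-⊩ d l ms N) h)

      atomic-false : ∀ {n φ} (d : Formula n φ) l {xs : Vec 𝕊 n} (ms : All (_∈ X) xs) →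
        Forced (Sat false φ (tuple xs)) → ¬ (M ⊨⟨ d ⟩ xs)
      atomic-false d l {xs} ms F h = generic-structure _ negated
        (enter negated
          (MeasClass-resp (λ N n → mk⇔ (negated⁺ N n) (negated⁻ N n)) (MeasClass-Sat false d ms))
          (forced-mono negated⁺ F)) (from (literal-⊩ d l ms M) h)
        where
        negated : BorelCode (tag 1 _)
        negated = neg _ (tag⁻ 1 _ ≈-refl) (literal d l ms)
        negated⁺ : ∀ N → N ϵ Str → Sat false _ (tuple xs) N → N ⊩⟨ negated ⟩
        negated⁺ N n h k = to (Sat-⇔ false d ms N n) h (to (literal-⊩ d l ms N) k)
        negated⁻ : ∀ N → N ϵ Str → N ⊩⟨ negated ⟩ → Sat false _ (tuple xs) N
        negated⁻ N n h = from (Sat-⇔ false d ms N n) (λ k → h (from (literal-⊩ d l ms N) k))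

    -- Both truth values are carried along because negation exchanges them. Truth of `ex` and `disj`
    -- and falsity of `all` and `conj` need genericity, through `forced-∃`, to choose an instance;
    -- the other cases pass to the parts because the forced classes form an upward closed
    -- collection. `Sat` is used only at structures in V, never at `M`.
    truth : ∀ s {n φ} (d : Formula n φ) {xs : Vec 𝕊 n} → All (_∈ X) xs →
      Forced (Sat s φ (tuple xs)) → Signed s (M ⊨⟨ d ⟩ xs)
    truth true  d@(rel _ _ _ _ _) ms F = atomic-true d tt ms F
    truth false d@(rel _ _ _ _ _) ms F = atomic-false d tt ms F
    truth true  d@(eq _ _ _) ms F = atomic-true d tt ms F
    truth false d@(eq _ _ _) ms F = atomic-false d tt ms F
    truth true  d@(neg ψ e d′) ms F = truth false d′ ms (forced-mono
      (λ N n h → from (Sat-⇔ false d′ ms N n) (to (Sat-⇔ true d ms N n) h)) F)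
    truth false d@(neg ψ e d′) ms F = λ k → k (truth true d′ ms (forced-mono
      (λ N n h → from (Sat-⇔ true d′ ms N n) (by-contradiction (to (Sat-⇔ false d ms N n) h))) F))
    truth true  d@(ex ψ e d′) ms F =
      forced-∃ VX card-X (satInstanceᵗ true (Fm⇒V d′) (V-tuple (∈X⇒V ms)))
        (λ x m → MeasClass-Sat true d′ (↓∈ m ∷ ms))
        (forced-mono (λ N n → to (Sat-ex ms N n d ψ e d′ refl)) F) ▹ λ (x , m , F′) →
      x , ↓∈ m , truth true d′ (↓∈ m ∷ ms) F′
    truth false d@(ex ψ e d′) ms F = λ (x , m , h) → truth false d′ (m ∷ ms) (forced-mono
      (λ N n k → from (Sat-⇔ false d′ (m ∷ ms) N n)
        (λ h → to (Sat-⇔ false d ms N n) k (x , m , h))) F) h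
    truth true  d@(all ψ e d′) ms F = λ x m → truth true d′ (m ∷ ms) (forced-mono
      (λ N n k → from (Sat-⇔ true d′ (m ∷ ms) N n)
        (to (Sat-⇔ true d ms N n) k x m)) F)
    truth false d@(all ψ e d′) ms F =
      forced-∃ VX card-X (satInstanceᵗ false (Fm⇒V d′) (V-tuple (∈X⇒V ms)))
        (λ x m → MeasClass-Sat false d′ (↓∈ m ∷ ms))
        (forced-mono (λ N n → to (Sat-all ms N n d ψ e d′ refl)) F) ▹ λ (x , m , F′) →
      λ h → truth false d′ (↓∈ m ∷ ms) F′ (h x (↓∈ m))
    truth true  d@(disj Φ e VΦ c ds) ms F =
      forced-∃ VΦ c (satMemberᵗ true (V-tuple (∈X⇒V ms)))
        (λ ψ m → MeasClass-Sat true (ds ψ (↓∈ m)) ms)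
        (forced-mono (λ N n → to (Sat-disj ms N n d Φ e VΦ c ds refl)) F) ▹ λ (ψ , m , F′) →
      ψ , ↓∈ m , truth true (ds ψ (↓∈ m)) ms F′
    truth false d@(disj Φ e VΦ c ds) ms F = λ (ψ , m , h) → truth false (ds ψ m) ms (forced-mono
      (λ N n k → from (Sat-⇔ false (ds ψ m) ms N n)
        (λ h → to (Sat-⇔ false d ms N n) k (ψ , m , h))) F) h
    truth true  d@(conj Φ e VΦ c ds) ms F = λ ψ m → truth true (ds ψ m) ms (forced-mono
      (λ N n k → from (Sat-⇔ true (ds ψ m) ms N n)
        (to (Sat-⇔ true d ms N n) k ψ m)) F)
    truth false d@(conj Φ e VΦ c ds) ms F =
      forced-∃ VΦ c (satMemberᵗ false (V-tuple (∈X⇒V ms)))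
        (λ ψ m → MeasClass-Sat false (ds ψ (↓∈ m)) ms)
        (forced-mono (λ N n → to (Sat-conj ms N n d Φ e VΦ c ds refl)) F) ▹ λ (ψ , m , F′) →
      λ h → truth false (ds ψ (↓∈ m)) ms F′ (h ψ (↓∈ m))

    full-true : ∀ {φ A r} (d : Formula 0 φ) → _IsSetOfStr_ V L X κ A (λ N → N ⊨⟨ d ⟩ []) →
      ⟨ A , r ⟩ ϵ μ → r IsCut rational 1ℚ → M ⊨⟨ d ⟩ []
    full-true d A-set A∈μ full = truth true d [] (forced-mono
      (λ N n a → from (Sat-⇔ true d [] N n) (proj₂ (to (proj₂ (denotes⁺ A-set) N) a))) (full-forced A∈μ full))

-- Sentences of measure 1 hold in the generic structure.

infinite-inhabited : ExcludedMiddle 1ℓ → ∀ {x} → Infinite x → ∃[ y ] y ϵ x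
infinite-inhabited lem {x} infinite with lem {∃[ y ] y ϵ x}
... | yes p   = p
... | no none = ⊥-elim (infinite ([] , λ y m → ⊥-elim (none (y , ↑∈ m))))

proposition6p4 : ExcludedMiddle 1ℓ →
    (V : Class) → IsModelOfSetTheory V →
    (κ X L : 𝕊) → V κ → V X → V L →
    IsOrdinal κ → Infinite κ → Infinite X → IsLanguage L → Card≤ V X κ →
    (μ : 𝕊) → IsProbabilityκMeasure V L X κ μ →
    (G : 𝕊) → IsRandomGenericFilter V L X κ μ G →
    (V[G] : Class) → IsGenericExtension V G V[G] →
    (M-G : 𝕊) → IsRandomGenericStructure V L X κ V[G] G M-G →
    (φ : 𝕊) (sentence : Fm V L X κ 0 φ) → InTh V L X κ μ sentence →
    _⊨_[_] V L X κ M-G sentence []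
proposition6p4 lem V model κ X L Vκ VX VL κ-ordinal κ-infinite X-infinite language card-X μ measure G filter
    V[G] _ M-G M-G-generic φ sentence (A , r , A-set , A∈μ , full) =
  infinite-inhabited lem X-infinite ▹ λ (x₀ , x₀ϵX) →
  Forcing.Truth.full-true
    (record
      { lem = lem ; V = V ; model = model ; κ = κ ; X = X ; L = L ; Vκ = Vκ ; VX = VX ; VL = VL
      ; language = language ; κ-ordinal = κ-ordinal ; κ-infinite = κ-infinite
      ; card-X = card-X ; x₀ = x₀ ; x₀ϵX = x₀ϵX })
    -- Read backwards at `M-G` itself, the equivalence that characterises the generic structure says
    -- that it belongs to the interpretation of every code in G.
    μ measure G filter M-G (λ g c m → proj₂ (proj₂ (from (M-G-generic M-G) (≐-refl M-G) g c m)))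
    sentence A-set (pair∈⁺ A r A∈μ) full
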